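{- Let $q$ be the order of a skew symmetric core. Then for each positive integer $m$ there is a regular $\mathrm{QUH}(q^m,q)$, $H$, with $|S(H)| = q^{3m/2}$. Furthermore, if $q$ is an odd prime power with $q\equiv 3 \pmod 4$, then a skew symmetric core $Q$ of order $q$ can be chosen so that, for every positive integer $m$, the matrix $$H_m=\frac{1}{\sqrt{q+1}}\,\mathcal{J}^{(q)}_m + i\sqrt{\frac{q}{q+1}}\,\mathcal{A}^{(q)}_m$$ constructed from $Q$ is a regular $\mathrm{QUH}(q^m,q)$ with $|S(H_m)|=q^{3m/2}$ and is multicirculant.
   Context: A unit Hadamard matrix of order $n$ is an $n\times n$ complex matrix $H$ all of whose entries have modulus $1$ and with $HH^*=nI_n$. For positive integers $n,m$, a $\mathrm{QUH}(n,m)$ (quaternary unit Hadamard matrix) is a unit Hadamard matrix of order $n$ all of whose entries lie in the four-element set $\left\{\epsilon\frac{1}{\sqrt{m+1}}+\delta\, i\sqrt{\frac{m}{m+1}} : \epsilon,\delta\in\{1,-1\}\right\}$. For a matrix $A$, $S(A)$ (the excess) denotes the sum of all entries of $A$. A unit Hadamard matrix of order $n$ is regular if, for every row, the sum of the entries of that row has modulus $\sqrt n$. A Hadamard matrix of order $n$ is an $n\times n$ $(\pm1)$-matrix $H$ with $HH^T=nI_n$; it is of skew type if $H=I+W$ with $W$ a skew symmetric $(0,\pm1)$-matrix. A skew symmetric core of order $q$ is a $q\times q$ matrix $Q$ such that $\begin{pmatrix}1 & j\\ -j^T & I+Q\end{pmatrix}$ is a skew type Hadamard matrix of order $q+1$,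 where $j$ is the $1\times q$ all-ones matrix. Such $Q$ is a skew symmetric $(0,\pm1)$-matrix with $J_qQ=QJ_q=0$ and $QQ^T=qI_q-J_q$, where $J_n$ denotes the $n\times n$ all-ones matrix. Given a skew symmetric core $Q$ of order $q$, define recursively $\mathcal{J}^{(q)}_0=\mathcal{A}^{(q)}_0=J_1$ and, for $m\ge1$, $\mathcal{J}^{(q)}_m=J_q\otimes\mathcal{A}^{(q)}_{m-1}$, $\mathcal{A}^{(q)}_m=I_q\otimes\mathcal{J}^{(q)}_{m-1}+Q\otimes\mathcal{A}^{(q)}_{m-1}$. A block-circulant matrix is a matrix of the form $\mathrm{circ}(A_1,\dots,A_k)$, i.e. the circulant arrangement with first block row $(A_1,\dots,A_k)$ of square blocks $A_i$ of equal order. Multicirculant matrices are defined recursively: every matrix of order $1$ is multicirculant; a matrix of order $n>1$ is multicirculant if and only if it is a block-circulant matrix (with $k\ge 2$ blocks per row, so that the blocks have smaller order) whose blocks are multicirculant. -}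

module Defs where

open import Algebra.Bundles using (CommutativeRing)
open import Algebra.Bundles.Raw using (RawRing)
import Algebra.Definitions.RawMonoid as RawMonoidDefs
open import Data.Bool.Base using (if_then_else_)
open import Data.Fin.Base using (Fin; zero; suc; toℕ; remQuot; cast)
open import Data.Fin.Properties using (nonZeroIndex) renaming (_≟_ to _≟ᶠ_)
open import Data.Integer.Base as ℤ using (ℤ; +_; -[1+_])
import Data.Integer.Properties as ℤP
open import Data.Nat.Base as ℕ using (ℕ; zero; suc)
open import Data.Nat.DivMod using (_mod_)
open import Data.Nat.Primality using (Prime)
import Data.Nat.Properties as ℕP
open import Data.Product.Base using (_×_; _,_; proj₁; proj₂; ∃-syntax; Σ-syntax)
open import Data.Rational.Base as ℚ using (ℚ; 0ℚ; 1ℚ; ½; mkℚ)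
import Data.Rational.Properties as ℚP
open import Data.Rational.Solver using (module +-*-Solver)
open import Data.Rational.Unnormalised.Base as ℚᵘ using (mkℚᵘ)
import Data.Rational.Unnormalised.Properties as ℚᵘP
open import Data.Sum.Base using (_⊎_; inj₁; inj₂)
open import Level using (Level; 0ℓ; _⊔_)
open import Relation.Binary.PropositionalEquality
  using (_≡_; _≢_; refl; sym; trans; cong; cong₂; subst; subst₂; module ≡-Reasoning)
open import Relation.Nullary using (Dec; does; yes; no; ¬_; contradiction)

module RationalEstimates where
  open import Data.Rational.Base
  open import Data.Rational.Properties
  open +-*-Solver

  half+half : ∀ ε → ε * ½ + ε * ½ ≡ ε
  half+half ε = trans (sym (*-distribˡ-+ ε ½ ½)) (*-identityʳ ε)

  *-pos : ∀ {p q} → 0ℚ < p → 0ℚ < q → 0ℚ < p * q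
  *-pos {p} {q} p>0 q>0 = positive⁻¹ (p * q)
    where instance _ = pos*pos⇒pos p {{positive p>0}} q {{positive q>0}}

  *-nonneg : ∀ {p q} → 0ℚ ≤ p → 0ℚ ≤ q → 0ℚ ≤ p * q
  *-nonneg {p} {q} p≥0 q≥0 = nonNegative⁻¹ (p * q)
    where instance _ = nonNeg*nonNeg⇒nonNeg p {{nonNegative p≥0}} q {{nonNegative q≥0}}

  +-pos : ∀ {p q} → 0ℚ < p → 0ℚ < q → 0ℚ < p + q
  +-pos p>0 q>0 = +-mono-< p>0 q>0

  *-mono : ∀ {a b c d} → 0ℚ ≤ b → 0ℚ ≤ c → a ≤ b → c ≤ d → a * c ≤ b * d
  *-mono {a} {b} {c} {d} b≥0 c≥0 a≤b c≤d = ≤-trans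
    (*-monoʳ-≤-nonNeg c {{nonNegative c≥0}} a≤b)
    (*-monoˡ-≤-nonNeg b {{nonNegative b≥0}} c≤d)

  half-pos : ∀ {ε} → 0ℚ < ε → 0ℚ < ε * ½
  half-pos ε>0 = *-pos ε>0 (positive⁻¹ ½)

  ∣-∣-sym : ∀ a b → ∣ a - b ∣ ≡ ∣ b - a ∣
  ∣-∣-sym a b = trans
    (cong ∣_∣ (solve 2 (λ a b → a :- b := :- (b :- a)) refl a b))
    (∣-p∣≡∣p∣ (b - a))

  tri : ∀ {a b c δ ε} → ∣ a - b ∣ < δ → ∣ b - c ∣ < ε → ∣ a - c ∣ < δ + ε
  tri {a} {b} {c} p q = ≤-<-trans
    (subst (λ t → ∣ t ∣ ≤ ∣ a - b ∣ + ∣ b - c ∣)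
      (solve 3 (λ a b c → (a :- b) :+ (b :- c) := a :- c) refl a b c)
      (∣p+q∣≤∣p∣+∣q∣ (a - b) (b - c)))
    (+-mono-< p q)

  close-+ : ∀ {a a′ b b′ δ ε} → ∣ a - a′ ∣ < δ → ∣ b - b′ ∣ < ε →
            ∣ (a + b) - (a′ + b′) ∣ < δ + ε
  close-+ {a} {a′} {b} {b′} p q = ≤-<-trans
    (subst (λ t → ∣ t ∣ ≤ ∣ a - a′ ∣ + ∣ b - b′ ∣)
      (solve 4 (λ a a′ b b′ → (a :- a′) :+ (b :- b′) := (a :+ b) :- (a′ :+ b′)) refl a a′ b b′)
      (∣p+q∣≤∣p∣+∣q∣ (a - a′) (b - b′)))
    (+-mono-< p q)

  close-neg : ∀ {a a′ δ} → ∣ a - a′ ∣ < δ → ∣ - a - - a′ ∣ < δ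
  close-neg {a} {a′} = subst (_< _) (trans (∣-∣-sym a a′)
    (cong ∣_∣ (solve 2 (λ a a′ → a′ :- a := :- a :- :- a′) refl a a′)))

  close-* : ∀ {a a′ b b′ B δ} → 0ℚ < B → ∣ a ∣ ≤ B → ∣ b′ ∣ ≤ B →
            ∣ a - a′ ∣ < δ → ∣ b - b′ ∣ < δ → ∣ a * b - a′ * b′ ∣ < B * δ + B * δ
  close-* {a} {a′} {b} {b′} {B} {δ} B>0 ∣a∣≤B ∣b′∣≤B p q = begin-strict
    ∣ a * b - a′ * b′ ∣
      ≡⟨ cong ∣_∣ (solve 4 (λ a a′ b b′ → a :* b :- a′ :* b′ := a :* (b :- b′) :+ b′ :* (a :- a′)) refl a a′ b b′) ⟩
    ∣ a * (b - b′) + b′ * (a - a′) ∣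
      ≤⟨ ∣p+q∣≤∣p∣+∣q∣ (a * (b - b′)) (b′ * (a - a′)) ⟩
    ∣ a * (b - b′) ∣ + ∣ b′ * (a - a′) ∣
      ≡⟨ cong₂ _+_ (∣p*q∣≡∣p∣*∣q∣ a (b - b′)) (∣p*q∣≡∣p∣*∣q∣ b′ (a - a′)) ⟩
    ∣ a ∣ * ∣ b - b′ ∣ + ∣ b′ ∣ * ∣ a - a′ ∣
      ≤⟨ +-mono-≤ (*-mono (<⇒≤ B>0) (0≤∣p∣ (b - b′)) ∣a∣≤B ≤-refl)
                  (*-mono (<⇒≤ B>0) (0≤∣p∣ (a - a′)) ∣b′∣≤B ≤-refl) ⟩
    B * ∣ b - b′ ∣ + B * ∣ a - a′ ∣
      <⟨ +-mono-< (*-monoʳ-<-pos B {{positive B>0}} q) (*-monoʳ-<-pos B {{positive B>0}} p) ⟩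
    B * δ + B * δ ∎
    where open ≤-Reasoning

  p≤∣p∣ : ∀ p → p ≤ ∣ p ∣
  p≤∣p∣ p with ≤-total 0ℚ p
  ... | inj₁ 0≤p = ≤-reflexive (sym (0≤p⇒∣p∣≡p 0≤p))
  ... | inj₂ p≤0 = ≤-trans p≤0 (0≤∣p∣ p)

  close⇒< : ∀ {a b ε} → ∣ a - b ∣ < ε → a < b + ε
  close⇒< {a} {b} {ε} p = subst (_< b + ε)
    (solve 2 (λ a b → b :+ (a :- b) := a) refl a b)
    (+-monoʳ-< b (≤-<-trans (p≤∣p∣ (a - b)) p))

  <⇒-< : ∀ {a b ε} → a < b + ε → a - b < ε
  <⇒-< {a} {b} {ε} p = subst (a - b <_)
    (solve 2 (λ b ε → b :+ ε :- b := ε) refl b ε) (+-monoˡ-< (- b) p)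

  <⇒close : ∀ {a b ε} → a < b + ε → b < a + ε → ∣ a - b ∣ < ε
  <⇒close {a} {b} {ε} p q with ∣p∣≡p∨∣p∣≡-p (a - b)
  ... | inj₁ e = subst (_< ε) (sym e) (<⇒-< p)
  ... | inj₂ e = subst (_< ε)
    (trans (solve 2 (λ a b → b :- a := :- (a :- b)) refl a b) (sym e)) (<⇒-< q)

  /ᵘ-< : ∀ p q → p ℚᵘ.< q → fromℚᵘ p < fromℚᵘ q
  /ᵘ-< p q p<q = toℚᵘ-cancel-< (ℚᵘP.<-respˡ-≃ (ℚᵘP.≃-sym (toℚᵘ-fromℚᵘ p))
                               (ℚᵘP.<-respʳ-≃ (ℚᵘP.≃-sym (toℚᵘ-fromℚᵘ q)) p<q))

  /ᵘ-+ : ∀ p q → fromℚᵘ (p ℚᵘ.+ q) ≡ fromℚᵘ p + fromℚᵘ q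
  /ᵘ-+ p q = toℚᵘ-injective (ℚᵘP.≃-trans (toℚᵘ-fromℚᵘ (p ℚᵘ.+ q))
    (ℚᵘP.≃-trans (ℚᵘP.+-cong (ℚᵘP.≃-sym (toℚᵘ-fromℚᵘ p)) (ℚᵘP.≃-sym (toℚᵘ-fromℚᵘ q)))
      (ℚᵘP.≃-sym (toℚᵘ-homo-+ (fromℚᵘ p) (fromℚᵘ q)))))

  step : ∀ k n → + suc k / suc n ≡ + k / suc n + + 1 / suc n
  step k n = trans (fromℚᵘ-cong {mkℚᵘ (+ suc k) n} {mkℚᵘ (+ k) n ℚᵘ.+ mkℚᵘ (+ 1) n} (ℚᵘ.*≡* eq)) (/ᵘ-+ (mkℚᵘ (+ k) n) (mkℚᵘ (+ 1) n))
    where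
    D = + suc n
    eq : + suc k ℤ.* (D ℤ.* D) ≡ ((+ k ℤ.* D) ℤ.+ (+ 1 ℤ.* D)) ℤ.* D
    eq = trans (sym (ℤP.*-assoc (+ suc k) D D))
      (cong (ℤ._* D) (trans (cong (ℤ._* D) (ℤP.+-comm (+ 1) (+ k))) (ℤP.*-distribʳ-+ D (+ k) (+ 1))))

  /-nonneg : ∀ k n → 0ℚ ≤ + k / suc n
  /-nonneg k n = nonNegative⁻¹ (+ k / suc n) {{normalize-nonNeg k (suc n)}}

  /-pos : ∀ k n → 0ℚ < + suc k / suc n
  /-pos k n = positive⁻¹ (+ suc k / suc n) {{normalize-pos (suc k) (suc n)}}

  archimedean : ∀ {ε} → 0ℚ < ε → Σ[ N ∈ ℕ ] (∀ n → N ℕ.≤ n → + 1 / suc n < ε)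
  archimedean {ε@(mkℚ (+ zero) d c)} ε>0 = contradiction
    (ε>0) (subst (λ t → ¬ (0ℚ < t)) (sym (↥p≡0⇒p≡0 ε refl)) (<-irrefl refl))
  archimedean {ε@(mkℚ (+ suc a) d c)} ε>0 = suc d , λ n d<n → subst (+ 1 / suc n <_)
    (fromℚᵘ-toℚᵘ ε) (/ᵘ-< (mkℚᵘ (+ 1) n) (toℚᵘ ε)
      (ℚᵘ.*<* (ℤ.+<+ (ℕP.<-≤-trans
        (subst (ℕ._< suc n) (sym (ℕP.*-identityˡ (suc d))) (ℕ.s≤s d<n))
        (ℕP.m≤m+n (suc n) (a ℕ.* suc n))))))
  archimedean {mkℚ -[1+ a ] d c} (*<* ())

  below-num : ∀ a → a < + suc ℤ.∣ ↥ a ∣ / 1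
  below-num a@(mkℚ (+ n) d c) = subst (_< + suc n / 1) (fromℚᵘ-toℚᵘ a)
    (/ᵘ-< (toℚᵘ a) (mkℚᵘ (+ suc n) 0) (ℚᵘ.*<* (subst₂ ℤ._<_ (sym (ℤP.*-identityʳ (+ n))) (ℤP.pos-* (suc n) (suc d))
      (ℤ.+<+ (ℕP.m≤m*n (suc n) (suc d))))))
  below-num a@(mkℚ -[1+ n ] d c) = <-trans (negative⁻¹ a) (/-pos (suc n) 0)

  /-cancel : ∀ c n → + (suc n ℕ.* c) / suc n ≡ + c / 1
  /-cancel c n = fromℚᵘ-cong {mkℚᵘ (+ (suc n ℕ.* c)) n} {mkℚᵘ (+ c) 0} (ℚᵘ.*≡*
    (trans (ℤP.*-identityʳ (+ (suc n ℕ.* c)))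
      (trans (cong +_ (ℕP.*-comm (suc n) c)) (ℤP.pos-* c (suc n)))))

-- Rational lower approximation of √a to within 1/(n+1): the largest k/(n+1) with
-- k ≤ K and (k/(n+1))² ≤ a, or 0 if there is none (in particular if a < 0).
-- The bound K used below satisfies K/(n+1) > √a.

largerRoot : ℚ → ℚ → ℚ → ℚ
largerRoot a s r with s ℚ.* s ℚP.≤? a
... | yes _ = s
... | no  _ = r

searchSqrt : ℚ → ℕ → ℕ → ℚ
searchSqrt a n zero    = 0ℚ
searchSqrt a n (suc K) = largerRoot a (+ suc K ℚ./ suc n) (searchSqrt a n K)

-- Opaque, because unfolding it makes type checking very slow.
opaque
  approxSqrt : ℚ → ℕ → ℚ
  approxSqrt a n = searchSqrt a n (suc n ℕ.* suc ℤ.∣ ℚ.↥ a ∣)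

module SqrtEstimates where
  open import Data.Rational.Base
  open import Data.Rational.Properties
  open +-*-Solver
  open RationalEstimates

  pick : ∀ (P : ℚ → Set) a s r → (s * s ≤ a → P s) → (a < s * s → P r) → P (largerRoot a s r)
  pick P a s r p q with s * s ≤? a
  ... | yes le = p le
  ... | no ¬le = q (≰⇒> ¬le)

  search-nonneg : ∀ a n K → 0ℚ ≤ searchSqrt a n K
  search-nonneg a n zero = ≤-refl
  search-nonneg a n (suc K) = pick (0ℚ ≤_) a (+ suc K / suc n) (searchSqrt a n K)
    (λ _ → /-nonneg (suc K) n) (λ _ → search-nonneg a n K)

  search-lower : ∀ a n K → let s = searchSqrt a n K in s ≡ 0ℚ ⊎ s * s ≤ a
  search-lower a n zero = inj₁ refl
  search-lower a n (suc K) =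
    pick (λ s → s ≡ 0ℚ ⊎ s * s ≤ a) a (+ suc K / suc n) (searchSqrt a n K)
      inj₂ (λ _ → search-lower a n K)

  search-upper : ∀ a n K →
    (let t = + K / suc n + + 1 / suc n in a < t * t) →
    let t = searchSqrt a n K + + 1 / suc n in a < t * t
  search-upper a n zero p =
    subst (λ z → a < (z + + 1 / suc n) * (z + + 1 / suc n)) (0/n≡0 (suc n)) p
  search-upper a n (suc K) p =
    pick (λ s → a < (s + + 1 / suc n) * (s + + 1 / suc n)) a (+ suc K / suc n) (searchSqrt a n K)
      (λ _ → p) (λ q → search-upper a n K (subst (λ t → a < t * t) (step K n) q))

  start-upper : ∀ a n → let t = + (suc n ℕ.* suc ℤ.∣ ↥ a ∣) / suc n + + 1 / suc n in a < t * t
  start-upper a n = begin-strict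
    a                   <⟨ below-num a ⟩
    c                   ≡⟨ *-identityʳ c ⟨
    c * 1ℚ              ≤⟨ *-mono c≥0 (<⇒≤ (positive⁻¹ 1ℚ)) ≤-refl 1≤c ⟩
    c * c               ≤⟨ *-mono t≥0 c≥0 c≤t c≤t ⟩
    t * t               ∎
    where
    open ≤-Reasoning
    k = ℤ.∣ ↥ a ∣
    c = + suc k / 1
    h = + 1 / suc n
    t = + (suc n ℕ.* suc k) / suc n + h
    c≥0 : 0ℚ ≤ c
    c≥0 = /-nonneg (suc k) 0
    1≤c : 1ℚ ≤ c
    1≤c = begin
      1ℚ              ≤⟨ ≤-reflexive (sym (+-identityˡ 1ℚ)) ⟩
      0ℚ + 1ℚ         ≤⟨ +-monoˡ-≤ 1ℚ (/-nonneg k 0) ⟩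
      + k / 1 + 1ℚ    ≡⟨ step k 0 ⟨
      c               ∎
    c≤t : c ≤ t
    c≤t = begin
      c               ≡⟨ +-identityʳ c ⟨
      c + 0ℚ          ≤⟨ +-mono-≤ (≤-reflexive (sym (/-cancel (suc k) n))) (/-nonneg 1 n) ⟩
      t               ∎
    t≥0 : 0ℚ ≤ t
    t≥0 = ≤-trans c≥0 c≤t

  opaque
    unfolding approxSqrt

    sqrt-nonneg : ∀ a n → 0ℚ ≤ approxSqrt a n
    sqrt-nonneg a n = search-nonneg a n (suc n ℕ.* suc ℤ.∣ ↥ a ∣)

    sqrt-lower : ∀ a n → let s = approxSqrt a n in s ≡ 0ℚ ⊎ s * s ≤ a
    sqrt-lower a n = search-lower a n (suc n ℕ.* suc ℤ.∣ ↥ a ∣)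

    sqrt-upper : ∀ a n → let t = approxSqrt a n + + 1 / suc n in a < t * t
    sqrt-upper a n = search-upper a n (suc n ℕ.* suc ℤ.∣ ↥ a ∣) (start-upper a n)

  square-split : ∀ t δ → (t + δ) * (t + δ) + δ * δ + (t + δ) * (δ + δ) ≡
                         (t + (δ + δ)) * (t + (δ + δ))
  square-split = solve 2 (λ t δ →
    (t :+ δ) :* (t :+ δ) :+ δ :* δ :+ (t :+ δ) :* (δ :+ δ) :=
    (t :+ (δ :+ δ)) :* (t :+ (δ :+ δ))) refl

  root-mono : ∀ a b δ h s t → 0ℚ < δ → a < b + δ * δ → 0ℚ ≤ h → h < δ → 0ℚ ≤ t →
              s ≡ 0ℚ ⊎ s * s ≤ a → b < (t + h) * (t + h) → s < t + (δ + δ)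
  root-mono a b δ h s t δ>0 a<b+δ² h≥0 h<δ t≥0 lower upper = ≰⇒> (λ le → absurd le lower)
    where
    open ≤-Reasoning
    t+δ≥0 : 0ℚ ≤ t + δ
    t+δ≥0 = +-mono-≤ t≥0 (<⇒≤ δ>0)
    2δ>0 : 0ℚ < δ + δ
    2δ>0 = +-pos δ>0 δ>0
    t+h≥0 : 0ℚ ≤ t + h
    t+h≥0 = +-mono-≤ t≥0 h≥0
    t+h≤t+δ : t + h ≤ t + δ
    t+h≤t+δ = +-monoʳ-≤ t (<⇒≤ h<δ)
    t+2δ>0 : 0ℚ < t + (δ + δ)
    t+2δ>0 = +-mono-≤-< t≥0 2δ>0
    cross≥0 : 0ℚ ≤ (t + δ) * (δ + δ)
    cross≥0 = *-nonneg {t + δ} {δ + δ} t+δ≥0 (<⇒≤ 2δ>0)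
    absurd : t + (δ + δ) ≤ s → ¬ (s ≡ 0ℚ ⊎ s * s ≤ a)
    absurd le (inj₁ s≡0) = <-irrefl refl (<-≤-trans t+2δ>0 (subst (t + (δ + δ) ≤_) s≡0 le))
    absurd le (inj₂ s²≤a) = <-irrefl refl (begin-strict
      a
        <⟨ a<b+δ² ⟩
      b + δ * δ
        <⟨ +-monoˡ-< (δ * δ) upper ⟩
      (t + h) * (t + h) + δ * δ
        ≤⟨ +-monoˡ-≤ (δ * δ) (*-mono {t + h} {t + δ} {t + h} {t + δ} t+δ≥0 t+h≥0 t+h≤t+δ t+h≤t+δ) ⟩
      (t + δ) * (t + δ) + δ * δ
        ≡⟨ +-identityʳ ((t + δ) * (t + δ) + δ * δ) ⟨
      (t + δ) * (t + δ) + δ * δ + 0ℚ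
        ≤⟨ +-monoʳ-≤ ((t + δ) * (t + δ) + δ * δ) cross≥0 ⟩
      (t + δ) * (t + δ) + δ * δ + (t + δ) * (δ + δ)
        ≡⟨ square-split t δ ⟩
      (t + (δ + δ)) * (t + (δ + δ))
        ≤⟨ *-mono {t + (δ + δ)} {s} {t + (δ + δ)} {s} (≤-trans (<⇒≤ t+2δ>0) le) (<⇒≤ t+2δ>0) le le ⟩
      s * s
        ≤⟨ s²≤a ⟩
      a ∎)

  sqrt-mono : ∀ a b δ m n → 0ℚ < δ → a < b + δ * δ → + 1 / suc n < δ →
              approxSqrt a m < approxSqrt b n + (δ + δ)
  sqrt-mono a b δ m n δ>0 a<b+δ² h<δ = root-mono a b δ (+ 1 / suc n) (approxSqrt a m) (approxSqrt b n)
    δ>0 a<b+δ² (/-nonneg 1 n) h<δ (sqrt-nonneg b n) (sqrt-lower a m) (sqrt-upper b n)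

  sqrt-close : ∀ a b ε m n → 0ℚ < ε → ∣ a - b ∣ < (ε * ½) * (ε * ½) →
               + 1 / suc m < ε * ½ → + 1 / suc n < ε * ½ →
               ∣ approxSqrt a m - approxSqrt b n ∣ < ε
  sqrt-close a b ε m n ε>0 ∣a-b∣< hm hn = <⇒close {approxSqrt a m} {approxSqrt b n} {ε}
    (subst (λ z → approxSqrt a m < approxSqrt b n + z) (half+half ε)
      (sqrt-mono a b (ε * ½) m n (half-pos ε>0) (close⇒< {a} {b} ∣a-b∣<) hn))
    (subst (λ z → approxSqrt b n < approxSqrt a m + z) (half+half ε)
      (sqrt-mono b a (ε * ½) n m (half-pos ε>0)
        (close⇒< {b} {a} (subst (_< (ε * ½) * (ε * ½)) (∣-∣-sym a b) ∣a-b∣<)) hm))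

-- x ~ y says that x and y are Cauchy sequences with the same limit.
infix 4 _~_
record _~_ (x y : ℕ → ℚ) : Set where
  constructor merging
  field
    within : ∀ ε → 0ℚ ℚ.< ε →
      ∃[ N ] (∀ m n → N ℕ.≤ m → N ℕ.≤ n → ℚ.∣ x m ℚ.- y n ∣ ℚ.< ε)

open _~_

module Limits where
  open import Data.Rational.Base
  open import Data.Rational.Properties
  open +-*-Solver
  open RationalEstimates
  open SqrtEstimates

  ≤⊔ˡ : ∀ {m n k} → m ℕ.⊔ n ℕ.≤ k → m ℕ.≤ k
  ≤⊔ˡ {m} {n} = ℕP.m⊔n≤o⇒m≤o m n

  ≤⊔ʳ : ∀ {m n k} → m ℕ.⊔ n ℕ.≤ k → n ℕ.≤ k
  ≤⊔ʳ {m} {n} = ℕP.m⊔n≤o⇒n≤o m n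

  ~-sym : ∀ {x y} → x ~ y → y ~ x
  (~-sym {x} {y} p) .within ε ε>0 with within p ε ε>0
  ... | N , f = N , λ m n Nm Nn → subst (_< ε) (∣-∣-sym (x n) (y m)) (f n m Nn Nm)

  ~-trans : ∀ {x y z} → x ~ y → y ~ z → x ~ z
  (~-trans {x} {y} {z} p q) .within ε ε>0 with within p (ε * ½) (half-pos ε>0) | within q (ε * ½) (half-pos ε>0)
  ... | N , f | M , g = N ℕ.⊔ M , λ m n Nm Nn →
    subst (∣ x m - z n ∣ <_) (half+half ε)
      (tri {x m} {y (N ℕ.⊔ M)} {z n} {ε * ½} {ε * ½} (f m (N ℕ.⊔ M) (≤⊔ˡ Nm) (ℕP.m≤m⊔n N M)) (g (N ℕ.⊔ M) n (ℕP.m≤n⊔m N M) (≤⊔ʳ Nn)))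

  ~-reflˡ : ∀ {x y} → x ~ y → x ~ x
  ~-reflˡ p = ~-trans p (~-sym p)

  ~-pointwise : ∀ {x y} → (∀ n → x n ≡ y n) → x ~ x → x ~ y
  (~-pointwise {x} {y} e p) .within ε ε>0 with within p ε ε>0
  ... | N , f = N , λ m n Nm Nn → subst (λ t → ∣ x m - t ∣ < ε) (e n) (f m n Nm Nn)

  ~-diagonal : ∀ {x y} → x ~ x →
    (∀ ε → 0ℚ < ε → ∃[ N ] (∀ n → N ℕ.≤ n → ∣ x n - y n ∣ < ε)) → x ~ y
  (~-diagonal {x} {y} p q) .within ε ε>0 with within p (ε * ½) (half-pos ε>0) | q (ε * ½) (half-pos ε>0)
  ... | N , f | M , g = N ℕ.⊔ M , λ m n Nm Nn →
    subst (∣ x m - y n ∣ <_) (half+half ε) (tri {x m} {x n} {y n} {ε * ½} {ε * ½} (f m n (≤⊔ˡ Nm) (≤⊔ˡ Nn)) (g n (≤⊔ʳ Nn)))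

  ~-const : ∀ p → (λ _ → p) ~ (λ _ → p)
  (~-const p) .within ε ε>0 = 0 , λ _ _ _ _ → subst (_< ε) (cong ∣_∣ (sym (+-inverseʳ p))) ε>0

  ~-+ : ∀ {x x′ y y′} → x ~ x′ → y ~ y′ → (λ n → x n + y n) ~ (λ n → x′ n + y′ n)
  (~-+ {x} {x′} {y} {y′} p q) .within ε ε>0 with within p (ε * ½) (half-pos ε>0) | within q (ε * ½) (half-pos ε>0)
  ... | N , f | M , g = N ℕ.⊔ M , λ m n Nm Nn →
    subst (∣ (x m + y m) - (x′ n + y′ n) ∣ <_) (half+half ε)
      (close-+ {x m} {x′ n} {y m} {y′ n} {ε * ½} {ε * ½} (f m n (≤⊔ˡ Nm) (≤⊔ˡ Nn)) (g m n (≤⊔ʳ Nm) (≤⊔ʳ Nn)))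

  ~-neg : ∀ {x x′} → x ~ x′ → (λ n → - x n) ~ (λ n → - x′ n)
  (~-neg {x} {x′} p) .within ε ε>0 with within p ε ε>0
  ... | N , f = N , λ m n Nm Nn → close-neg {x m} {x′ n} (f m n Nm Nn)

  bounded : ∀ {x} → x ~ x → ∃[ B ] (1ℚ < B × ∃[ N ] (∀ n → N ℕ.≤ n → ∣ x n ∣ < B))
  bounded {x} p with within p 1ℚ (positive⁻¹ 1ℚ)
  ... | N , f = B , B>1 , N , λ n Nn → ≤-<-trans (∣x∣≤ n) (+-monoˡ-< ∣ x N ∣ (<-trans (f n N Nn ℕP.≤-refl) 1<2))
    where
    2ℚ = 1ℚ + 1ℚ
    1<2 : 1ℚ < 2ℚ
    1<2 = +-monoʳ-< 1ℚ (positive⁻¹ 1ℚ)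
    B = 2ℚ + ∣ x N ∣
    B>1 : 1ℚ < B
    B>1 = +-mono-<-≤ 1<2 (0≤∣p∣ (x N))
    ∣x∣≤ : ∀ n → ∣ x n ∣ ≤ ∣ x n - x N ∣ + ∣ x N ∣
    ∣x∣≤ n = subst (λ t → ∣ t ∣ ≤ ∣ x n - x N ∣ + ∣ x N ∣)
      (solve 2 (λ a b → a :- b :+ b := a) refl (x n) (x N)) (∣p+q∣≤∣p∣+∣q∣ (x n - x N) (x N))

  quotient : ∀ {B} ε → 0ℚ < B → 0ℚ < ε → ∃[ δ ] (0ℚ < δ × B * δ ≡ ε)
  quotient {B} ε B>0 ε>0 = ε * B⁻¹ , *-pos ε>0 B⁻¹>0 , (begin
      B * (ε * B⁻¹)   ≡⟨ solve 3 (λ b e i → b :* (e :* i) := e :* (b :* i)) refl B ε B⁻¹ ⟩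
      ε * (B * B⁻¹)   ≡⟨ cong (ε *_) (*-inverseʳ B) ⟩
      ε * 1ℚ          ≡⟨ *-identityʳ ε ⟩
      ε               ∎)
    where
    open ≡-Reasoning
    instance
      B-pos : Positive B
      B-pos = positive B>0
      B-nz : NonZero B
      B-nz = pos⇒nonZero B
    B⁻¹ = 1/ B
    B⁻¹>0 : 0ℚ < B⁻¹
    B⁻¹>0 = positive⁻¹ B⁻¹ {{1/pos⇒pos B}}

  ~-* : ∀ {x x′ y y′} → x ~ x′ → y ~ y′ → (λ n → x n * y n) ~ (λ n → x′ n * y′ n)
  (~-* {x} {x′} {y} {y′} p q) .within ε ε>0 = (K ℕ.⊔ L) ℕ.⊔ (N ℕ.⊔ M) , λ m n Nm Nn →
    subst (∣ x m * y m - x′ n * y′ n ∣ <_) Dδ+Dδ≡ε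
      (close-* {x m} {x′ n} {y m} {y′ n} {D} {δ} D>0
        (<⇒≤ (<-trans (b m (≤⊔ˡ {K} {L} (≤⊔ˡ {K ℕ.⊔ L} {N ℕ.⊔ M} Nm))) B<D))
        (<⇒≤ (<-trans (c n (≤⊔ʳ {K} {L} (≤⊔ˡ {K ℕ.⊔ L} {N ℕ.⊔ M} Nn))) C<D))
        (f m n (≤⊔ˡ {N} {M} (≤⊔ʳ {K ℕ.⊔ L} {N ℕ.⊔ M} Nm)) (≤⊔ˡ {N} {M} (≤⊔ʳ {K ℕ.⊔ L} {N ℕ.⊔ M} Nn)))
        (g m n (≤⊔ʳ {N} {M} (≤⊔ʳ {K ℕ.⊔ L} {N ℕ.⊔ M} Nm)) (≤⊔ʳ {N} {M} (≤⊔ʳ {K ℕ.⊔ L} {N ℕ.⊔ M} Nn))))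
    where
    bx = bounded (~-reflˡ p)
    by = bounded (~-reflˡ (~-sym q))
    B = proj₁ bx
    C = proj₁ by
    K = proj₁ (proj₂ (proj₂ bx))
    L = proj₁ (proj₂ (proj₂ by))
    b = proj₂ (proj₂ (proj₂ bx))
    c = proj₂ (proj₂ (proj₂ by))
    D = B + C
    B>0 : 0ℚ < B
    B>0 = <-trans (positive⁻¹ 1ℚ) (proj₁ (proj₂ bx))
    C>0 : 0ℚ < C
    C>0 = <-trans (positive⁻¹ 1ℚ) (proj₁ (proj₂ by))
    D>0 : 0ℚ < D
    D>0 = +-pos B>0 C>0
    B<D : B < D
    B<D = subst (_< D) (+-identityʳ B) (+-monoʳ-< B C>0)
    C<D : C < D
    C<D = subst (_< D) (+-identityˡ C) (+-monoˡ-< C B>0)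
    quot = quotient {D} (ε * ½) D>0 (half-pos ε>0)
    δ = proj₁ quot
    δ>0 = proj₁ (proj₂ quot)
    Dδ+Dδ≡ε : D * δ + D * δ ≡ ε
    Dδ+Dδ≡ε = trans (cong (λ t → t + t) (proj₂ (proj₂ quot))) (half+half ε)
    N = proj₁ (within p δ δ>0)
    M = proj₁ (within q δ δ>0)
    f = proj₂ (within p δ δ>0)
    g = proj₂ (within q δ δ>0)

  ~-√ : ∀ {x x′} → x ~ x′ → (λ n → approxSqrt (x n) n) ~ (λ n → approxSqrt (x′ n) n)
  (~-√ {x} {x′} p) .within ε ε>0 = N ℕ.⊔ M , λ m n Nm Nn →
    sqrt-close (x m) (x′ n) ε m n ε>0 (proj₂ close m n (≤⊔ˡ {N} {M} Nm) (≤⊔ˡ {N} {M} Nn))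
      (proj₂ small m (≤⊔ʳ {N} {M} Nm)) (proj₂ small n (≤⊔ʳ {N} {M} Nn))
    where
    close = within p (ε * ½ * (ε * ½)) (*-pos {ε * ½} {ε * ½} (half-pos ε>0) (half-pos ε>0))
    small = archimedean (half-pos ε>0)
    N = proj₁ close
    M = proj₁ small

  ~-shift : ∀ {x} N → x ~ x → (λ n → x (N ℕ.+ n)) ~ x
  (~-shift {x} N p) .within ε ε>0 with within p ε ε>0
  ... | M , f = M , λ m n Mm Mn → f (N ℕ.+ m) n (ℕP.≤-trans Mm (ℕP.m≤n+m m N)) Mn

  inv : ∀ p → 0ℚ < p → ℚ
  inv p p>0 = 1/ p
    where instance _ = pos⇒nonZero p {{positive p>0}}

  inv-pos : ∀ p (p>0 : 0ℚ < p) → 0ℚ < inv p p>0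
  inv-pos p p>0 = positive⁻¹ (1/ p) {{1/pos⇒pos p}}
    where
    instance
      _ = positive p>0
      _ = pos⇒nonZero p {{positive p>0}}

  inv-* : ∀ p (p>0 : 0ℚ < p) → p * inv p p>0 ≡ 1ℚ
  inv-* p p>0 = *-inverseʳ p
    where instance _ = pos⇒nonZero p {{positive p>0}}

  -- Here i and j play the role of 1/a and 1/b.
  inv-difference : ∀ a b i j → a * i ≡ 1ℚ → b * j ≡ 1ℚ → i - j ≡ (b - a) * (i * j)
  inv-difference a b i j ai bj = begin
    i - j                     ≡⟨ cong₂ _-_ (sym (*-identityʳ i)) (sym (*-identityʳ j)) ⟩
    i * 1ℚ - j * 1ℚ           ≡⟨ cong₂ (λ u v → i * u - j * v) (sym bj) (sym ai) ⟩
    i * (b * j) - j * (a * i) ≡⟨ solve 4 (λ a b i j → i :* (b :* j) :- j :* (a :* i) := (b :- a) :* (i :* j)) refl a b i j ⟩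
    (b - a) * (i * j)         ∎
    where open ≡-Reasoning

  inv-bound : ∀ e a k i → 0ℚ ≤ k → 0ℚ ≤ i → e < a → e * k ≡ 1ℚ → a * i ≡ 1ℚ → i ≤ k
  inv-bound e a k i k≥0 i≥0 e<a ek ai = begin
    i               ≡⟨ *-identityʳ i ⟨
    i * 1ℚ          ≡⟨ cong (i *_) (sym ek) ⟩
    i * (e * k)     ≡⟨ *-assoc i e k ⟨
    i * e * k       ≤⟨ *-monoʳ-≤-nonNeg k {{nonNegative k≥0}}
                         (*-monoˡ-≤-nonNeg i {{nonNegative i≥0}} (<⇒≤ e<a)) ⟩
    i * a * k       ≡⟨ cong (_* k) (trans (*-comm i a) ai) ⟩
    1ℚ * k          ≡⟨ *-identityˡ k ⟩
    k               ∎
    where open ≤-Reasoning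

  inv-close : ∀ a b i j k δ → 0ℚ < k → 0ℚ < i → 0ℚ < j → i ≤ k → j ≤ k →
              a * i ≡ 1ℚ → b * j ≡ 1ℚ → ∣ a - b ∣ < δ → ∣ i - j ∣ < (k * k) * δ
  inv-close a b i j k δ k>0 i>0 j>0 i≤k j≤k ai bj d = begin-strict
    ∣ i - j ∣                   ≡⟨ cong ∣_∣ (inv-difference a b i j ai bj) ⟩
    ∣ (b - a) * (i * j) ∣       ≡⟨ ∣p*q∣≡∣p∣*∣q∣ (b - a) (i * j) ⟩
    ∣ b - a ∣ * ∣ i * j ∣       ≡⟨ cong₂ _*_ (∣-∣-sym b a) (0≤p⇒∣p∣≡p (<⇒≤ (*-pos {i} {j} i>0 j>0))) ⟩
    ∣ a - b ∣ * (i * j)         ≤⟨ *-monoˡ-≤-nonNeg ∣ a - b ∣ {{nonNegative (0≤∣p∣ (a - b))}}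
                                     (*-mono {i} {k} {j} {k} (<⇒≤ k>0) (<⇒≤ j>0) i≤k j≤k) ⟩
    ∣ a - b ∣ * (k * k)         <⟨ *-monoˡ-<-pos (k * k) {{positive (*-pos {k} {k} k>0 k>0)}} d ⟩
    δ * (k * k)                 ≡⟨ *-comm δ (k * k) ⟩
    (k * k) * δ                 ∎
    where open ≤-Reasoning

  ~-inv : ∀ {x} e → 0ℚ < e → (e<x : ∀ n → e < x n) (x>0 : ∀ n → 0ℚ < x n) → x ~ x →
          (λ n → inv (x n) (x>0 n)) ~ (λ n → inv (x n) (x>0 n))
  (~-inv {x} e e>0 e<x x>0 p) .within ε ε>0 = proj₁ (within p δ δ>0) , λ m n Nm Nn →
    subst (∣ inv (x m) (x>0 m) - inv (x n) (x>0 n) ∣ <_) (proj₂ (proj₂ quot))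
      (inv-close (x m) (x n) (inv (x m) (x>0 m)) (inv (x n) (x>0 n)) k δ
        k>0 (inv-pos (x m) (x>0 m)) (inv-pos (x n) (x>0 n)) (bound m) (bound n)
        (inv-* (x m) (x>0 m)) (inv-* (x n) (x>0 n)) (proj₂ (within p δ δ>0) m n Nm Nn))
    where
    k = inv e e>0
    k>0 = inv-pos e e>0
    quot = quotient {k * k} ε (*-pos {k} {k} k>0 k>0) ε>0
    δ = proj₁ quot
    δ>0 = proj₁ (proj₂ quot)
    bound : ∀ n → inv (x n) (x>0 n) ≤ k
    bound n = inv-bound e (x n) k (inv (x n) (x>0 n)) (<⇒≤ k>0) (<⇒≤ (inv-pos (x n) (x>0 n)))
      (e<x n) (inv-* e e>0) (inv-* (x n) (x>0 n))

  root-pos : ∀ a ε h s t → 0ℚ < h → h * h ≤ ε → ε < a → 0ℚ ≤ s → 0ℚ ≤ t → t < h * ½ →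
             a < (s + t) * (s + t) → h * ½ < s
  root-pos a ε h s t h>0 h²≤ε ε<a s≥0 t≥0 t<h/2 a< = ≰⇒> λ s≤h/2 →
    let s+t≤h = subst (s + t ≤_) (half+half h) (+-mono-≤ s≤h/2 (<⇒≤ t<h/2)) in
    <-irrefl refl (<-≤-trans (<-trans ε<a a<)
      (≤-trans (*-mono {s + t} {h} {s + t} {h} (<⇒≤ h>0) (+-mono-≤ s≥0 t≥0) s+t≤h s+t≤h) h²≤ε))

  small-square : ∀ ε → 0ℚ < ε → ∃[ h ] (0ℚ < h × h * h ≤ ε)
  small-square ε ε>0 with ≤-total ε 1ℚ
  ... | inj₁ ε≤1 = ε , ε>0 , subst (ε * ε ≤_) (*-identityʳ ε)
                    (*-monoˡ-≤-nonNeg ε {{nonNegative (<⇒≤ ε>0)}} ε≤1)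
  ... | inj₂ 1≤ε = 1ℚ , positive⁻¹ 1ℚ , 1≤ε

  root-square : ∀ a s h B δ ε → 0ℚ ≤ s → s ≤ B → 0ℚ ≤ h → h ≤ B → 0ℚ < B → h < δ →
                (B + B + B) * δ ≡ ε → 0ℚ < ε → 0ℚ < a + ε →
                s ≡ 0ℚ ⊎ s * s ≤ a → a < (s + h) * (s + h) → ∣ s * s - a ∣ < ε
  root-square a s h B δ ε s≥0 s≤B h≥0 h≤B B>0 h<δ Dδ≡ε ε>0 a+ε>0 lower upper =
    <⇒close {s * s} {a} {ε} (below lower) (begin-strict
      a
        <⟨ upper ⟩
      (s + h) * (s + h)
        ≡⟨ solve 2 (λ s h → (s :+ h) :* (s :+ h) := s :* s :+ (s :+ s :+ h) :* h) refl s h ⟩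
      s * s + (s + s + h) * h
        ≤⟨ +-monoʳ-≤ (s * s) (*-mono {s + s + h} {B + B + B} {h} {h} (<⇒≤ D>0) h≥0
             (+-mono-≤ (+-mono-≤ s≤B s≤B) h≤B) ≤-refl) ⟩
      s * s + (B + B + B) * h
        <⟨ +-monoʳ-< (s * s) (*-monoʳ-<-pos (B + B + B) {{positive D>0}} h<δ) ⟩
      s * s + (B + B + B) * δ
        ≡⟨ cong (λ u → s * s + u) Dδ≡ε ⟩
      s * s + ε ∎)
    where
    open ≤-Reasoning
    D>0 : 0ℚ < B + B + B
    D>0 = +-pos (+-pos B>0 B>0) B>0
    below : s ≡ 0ℚ ⊎ s * s ≤ a → s * s < a + ε
    below (inj₁ s≡0) = subst (_< a + ε) (sym (trans (cong (_* s) s≡0) (*-zeroˡ s))) a+ε>0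
    below (inj₂ s²≤a) = ≤-<-trans s²≤a (subst (_< a + ε) (+-identityʳ a) (+-monoʳ-< a ε>0))

  ~-√-square : ∀ {x} → x ~ x → (∀ ε → 0ℚ < ε → ∃[ N ] (∀ n → N ℕ.≤ n → 0ℚ < x n + ε)) →
               (λ n → approxSqrt (x n) n * approxSqrt (x n) n) ~ x
  ~-√-square {x} p x≥0 = ~-diagonal (~-* (~-√ p) (~-√ p)) λ ε ε>0 →
    let bs = bounded (~-√ p)
        B = proj₁ bs
        1<B = proj₁ (proj₂ bs)
        K = proj₁ (proj₂ (proj₂ bs))
        bound = proj₂ (proj₂ (proj₂ bs))
        B>0 = <-trans (positive⁻¹ 1ℚ) 1<B
        quot = quotient {B + B + B} ε (+-pos (+-pos B>0 B>0) B>0) ε>0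
        δ = proj₁ quot
        a₁ = archimedean (proj₁ (proj₂ quot))
        a₂ = archimedean B>0
        N = proj₁ (x≥0 ε ε>0)
        M = proj₁ a₁ ℕ.⊔ proj₁ a₂
    in (K ℕ.⊔ N) ℕ.⊔ M , λ n le →
      let s = approxSqrt (x n) n
          Mn = ≤⊔ʳ {K ℕ.⊔ N} {M} le
          KNn = ≤⊔ˡ {K ℕ.⊔ N} {M} le
      in root-square (x n) s (+ 1 / suc n) B δ ε (sqrt-nonneg (x n) n)
        (≤-trans (p≤∣p∣ s) (<⇒≤ (bound n (≤⊔ˡ {K} {N} KNn))))
        (/-nonneg 1 n) (<⇒≤ (proj₂ a₂ n (≤⊔ʳ {proj₁ a₁} {proj₁ a₂} Mn))) B>0
        (proj₂ a₁ n (≤⊔ˡ {proj₁ a₁} {proj₁ a₂} Mn)) (proj₂ (proj₂ quot)) ε>0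
        (proj₂ (x≥0 ε ε>0) n (≤⊔ʳ {K} {N} KNn)) (sqrt-lower (x n) n) (sqrt-upper (x n) n)

record ℝ : Set where
  no-eta-equality
  constructor real
  field
    seq    : ℕ → ℚ
    cauchy : seq ~ seq

open ℝ

infix 4 _≈_
record _≈_ (x y : ℝ) : Set where
  constructor mk≈
  field same-limit : seq x ~ seq y

open _≈_

infixl 6 _+_
infixl 7 _*_
infix  8 -_

fromℚ : ℚ → ℝ
fromℚ p .seq _  = p
fromℚ p .cauchy = Limits.~-const p

fromℤ : ℤ → ℝ
fromℤ z = fromℚ (z ℚ./ 1)

fromℕ : ℕ → ℝ
fromℕ n = fromℤ (+ n)

_+_ : ℝ → ℝ → ℝ
(x + y) .seq n  = seq x n ℚ.+ seq y n
(x + y) .cauchy = Limits.~-+ (cauchy x) (cauchy y)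

_*_ : ℝ → ℝ → ℝ
(x * y) .seq n  = seq x n ℚ.* seq y n
(x * y) .cauchy = Limits.~-* (cauchy x) (cauchy y)

-_ : ℝ → ℝ
(- x) .seq n  = ℚ.- seq x n
(- x) .cauchy = Limits.~-neg (cauchy x)

Positive : ℝ → Set
Positive x = ∃[ ε ] (0ℚ ℚ.< ε × ∃[ N ] (∀ n → N ℕ.≤ n → ε ℚ.< seq x n))

NonNegative : ℝ → Set
NonNegative x = ∀ ε → 0ℚ ℚ.< ε → ∃[ N ] (∀ n → N ℕ.≤ n → 0ℚ ℚ.< seq x n ℚ.+ ε)

-- The square root is total; it is 0 on negative numbers.
√_ : ℝ → ℝ
(√ x) .seq n  = approxSqrt (seq x n) n
(√ x) .cauchy = Limits.~-√ (cauchy x)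

-- Finitely many terms of x may vanish, so the sequence is shifted before inverting it.
recip : (x : ℝ) → Positive x → ℝ
recip x (ε , ε>0 , N , ε<x) = λ where
    .seq n  → Limits.inv (seq x (N ℕ.+ n)) (x>0 n)
    .cauchy → Limits.~-inv ε ε>0 ε<x′ x>0 (Limits.~-trans (Limits.~-shift N (cauchy x))
                (Limits.~-sym (Limits.~-shift N (cauchy x))))
  where
  ε<x′ : ∀ n → ε ℚ.< seq x (N ℕ.+ n)
  ε<x′ n = ε<x (N ℕ.+ n) (ℕP.m≤m+n N n)
  x>0 : ∀ n → 0ℚ ℚ.< seq x (N ℕ.+ n)
  x>0 n = ℚP.<-trans ε>0 (ε<x′ n)

≈-refl : ∀ {x} → x ≈ x
≈-refl {x} = mk≈ (cauchy x)

≈-sym : ∀ {x y} → x ≈ y → y ≈ x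
≈-sym (mk≈ p) = mk≈ (Limits.~-sym p)

≈-trans : ∀ {x y z} → x ≈ y → y ≈ z → x ≈ z
≈-trans (mk≈ p) (mk≈ q) = mk≈ (Limits.~-trans p q)

pointwise : ∀ {x y} → (∀ n → seq x n ≡ seq y n) → x ≈ y
pointwise {x} e = mk≈ (Limits.~-pointwise e (cauchy x))

ℝ-commutativeRing : CommutativeRing 0ℓ 0ℓ
ℝ-commutativeRing = record
  { Carrier = ℝ ; _≈_ = _≈_ ; _+_ = _+_ ; _*_ = _*_ ; -_ = -_ ; 0# = fromℕ 0 ; 1# = fromℕ 1
  ; isCommutativeRing = record
    { isRing = record
      { +-isAbelianGroup = record
        { isGroup = record
          { isMonoid = record
            { isSemigroup = record
              { isMagma = record
                { isEquivalence = record { refl = ≈-refl ; sym = ≈-sym ; trans = ≈-trans }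
                ; ∙-cong = λ (mk≈ p) (mk≈ q) → mk≈ (Limits.~-+ p q) }
              ; assoc = λ x y z → pointwise λ n → ℚP.+-assoc (seq x n) (seq y n) (seq z n) }
            ; identity = (λ x → pointwise λ n → ℚP.+-identityˡ (seq x n))
                       , (λ x → pointwise λ n → ℚP.+-identityʳ (seq x n)) }
          ; inverse = (λ x → pointwise λ n → ℚP.+-inverseˡ (seq x n))
                    , (λ x → pointwise λ n → ℚP.+-inverseʳ (seq x n))
          ; ⁻¹-cong = λ (mk≈ p) → mk≈ (Limits.~-neg p) }
        ; comm = λ x y → pointwise λ n → ℚP.+-comm (seq x n) (seq y n) }
      ; *-cong = λ (mk≈ p) (mk≈ q) → mk≈ (Limits.~-* p q)
      ; *-assoc = λ x y z → pointwise λ n → ℚP.*-assoc (seq x n) (seq y n) (seq z n)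
      ; *-identity = (λ x → pointwise λ n → ℚP.*-identityˡ (seq x n))
                   , (λ x → pointwise λ n → ℚP.*-identityʳ (seq x n))
      ; distrib = (λ x y z → pointwise λ n → ℚP.*-distribˡ-+ (seq x n) (seq y n) (seq z n))
                , (λ x y z → pointwise λ n → ℚP.*-distribʳ-+ (seq x n) (seq y n) (seq z n)) }
    ; *-comm = λ x y → pointwise λ n → ℚP.*-comm (seq x n) (seq y n) } }

√-cong : ∀ {x y} → x ≈ y → √ x ≈ √ y
√-cong (mk≈ p) = mk≈ (Limits.~-√ p)

√-square : ∀ x → NonNegative x → √ x * √ x ≈ x
√-square x x≥0 = mk≈ (Limits.~-√-square (cauchy x) x≥0)

√-nonneg : ∀ x → NonNegative (√ x)
√-nonneg x ε ε>0 = 0 , λ n _ →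
  ℚP.+-mono-≤-< (SqrtEstimates.sqrt-nonneg (seq x n) n) ε>0

√-positive : ∀ x → Positive x → Positive (√ x)
√-positive x (ε , ε>0 , N , ε<x) =
  h ℚ.* ½ , h/2>0 , N ℕ.⊔ proj₁ small , λ n le →
    Limits.root-pos (seq x n) ε h (approxSqrt (seq x n) n) (+ 1 ℚ./ suc n) h>0 (proj₂ (proj₂ sq))
      (ε<x n (ℕP.m⊔n≤o⇒m≤o N (proj₁ small) le))
      (SqrtEstimates.sqrt-nonneg (seq x n) n) (RationalEstimates./-nonneg 1 n)
      (proj₂ small n (ℕP.m⊔n≤o⇒n≤o N (proj₁ small) le)) (SqrtEstimates.sqrt-upper (seq x n) n)
  where
  sq = Limits.small-square ε ε>0
  h = proj₁ sq
  h>0 = proj₁ (proj₂ sq)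
  h/2>0 = RationalEstimates.half-pos h>0
  small = RationalEstimates.archimedean h/2>0

recip-inverse : ∀ x x>0 → x * recip x x>0 ≈ fromℕ 1
recip-inverse x x>0@(ε , ε>0 , N , ε<x) = mk≈ (Limits.~-trans
  (Limits.~-* (Limits.~-sym (Limits.~-shift N (cauchy x))) (cauchy (recip x x>0)))
  (Limits.~-sym (Limits.~-pointwise
    (λ n → sym (Limits.inv-* (seq x (N ℕ.+ n)) (ℚP.<-trans ε>0 (ε<x (N ℕ.+ n) (ℕP.m≤m+n N n)))))
    (cauchy (fromℕ 1)))))

suc-positive : ∀ n → Positive (fromℕ (suc n))
suc-positive n = ½ , ℚP.positive⁻¹ ½ , 0 , λ _ _ → ℚP.<-≤-trans ½<1 1≤n+1
  where
  ½<1 : ½ ℚ.< 1ℚ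
  ½<1 = ℚP.+-monoʳ-< ½ (ℚP.positive⁻¹ ½)
  1≤n+1 : 1ℚ ℚ.≤ + suc n ℚ./ 1
  1≤n+1 = subst₂ ℚ._≤_ (ℚP.+-identityˡ 1ℚ) (sym (RationalEstimates.step n 0))
    (ℚP.+-monoˡ-≤ 1ℚ (RationalEstimates./-nonneg n 0))

record ℂ : Set where
  no-eta-equality
  constructor _+i_
  field
    re im : ℝ

open ℂ

infix 4 _≈ᶜ_
record _≈ᶜ_ (z w : ℂ) : Set where
  constructor mk≈ᶜ
  field
    re-≈ : re z ≈ re w
    im-≈ : im z ≈ im w

infixl 6 _+ᶜ_
infixl 7 _*ᶜ_

_+ᶜ_ : ℂ → ℂ → ℂ
z +ᶜ w = (re z + re w) +i (im z + im w)

_*ᶜ_ : ℂ → ℂ → ℂ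
z *ᶜ w = (re z * re w + - (im z * im w)) +i (re z * im w + im z * re w)

-ᶜ_ : ℂ → ℂ
-ᶜ z = (- re z) +i (- im z)

conj : ℂ → ℂ
conj z = re z +i (- im z)

modulus : ℂ → ℝ
modulus z = √ (re z * re z + im z * im z)

ofReal : ℝ → ℂ
ofReal x = x +i fromℕ 0

𝕚 : ℂ
𝕚 = fromℕ 0 +i fromℕ 1

ℤ→ℂ : ℤ → ℂ
ℤ→ℂ z = ofReal (fromℤ z)

ℂ-rawRing : RawRing 0ℓ 0ℓ
ℂ-rawRing = record
  { Carrier = ℂ ; _≈_ = _≈ᶜ_ ; _+_ = _+ᶜ_ ; _*_ = _*ᶜ_ ; -_ = -ᶜ_
  ; 0# = ofReal (fromℕ 0) ; 1# = ofReal (fromℕ 1) }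

Matrix : ∀ {a} → Set a → ℕ → ℕ → Set a
Matrix A m n = Fin m → Fin n → A

map : ∀ {a b} {A : Set a} {B : Set b} {m n} → (A → B) → Matrix A m n → Matrix B m n
map f M i j = f (M i j)

_ᵀ : ∀ {a} {A : Set a} {m n} → Matrix A m n → Matrix A n m
(M ᵀ) i j = M j i

-- The column-minus-row index (j - i) mod k.
offset : ∀ {k} → Fin k → Fin k → Fin k
offset {k} i j = ((toℕ j ℕ.+ k) ℕ.∸ toℕ i) mod k
  where instance _ = nonZeroIndex i

-- circ (A₁, …, A_k): each block row is the cyclic right shift of the previous one.
circ : ∀ {a} {A : Set a} {k b} → (Fin k → Matrix A b b) → Matrix A (k ℕ.* b) (k ℕ.* b)
circ {b = b} A x y =
  let (i , r) = remQuot b x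
      (j , s) = remQuot b y
  in A (offset i j) r s

module MatrixOps {c ℓ} (R : RawRing c ℓ) where
  private module R = RawRing R
  open RawMonoidDefs R.+-rawMonoid using (sum)

  private
    variable
      m n m′ n′ : ℕ

  infix  4 _≈ᴹ_
  infixl 6 _+ᴹ_
  infixl 7 _*ᴹ_ _⊗_
  infixr 7 _·_

  _≈ᴹ_ : Matrix R.Carrier m n → Matrix R.Carrier m n → Set ℓ
  M ≈ᴹ N = ∀ i j → M i j R.≈ N i j

  _+ᴹ_ : Matrix R.Carrier m n → Matrix R.Carrier m n → Matrix R.Carrier m n
  (M +ᴹ N) i j = M i j R.+ N i j

  -ᴹ_ : Matrix R.Carrier m n → Matrix R.Carrier m n
  (-ᴹ M) i j = R.- M i j

  _·_ : R.Carrier → Matrix R.Carrier m n → Matrix R.Carrier m n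
  (x · M) i j = x R.* M i j

  _*ᴹ_ : ∀ {k} → Matrix R.Carrier m k → Matrix R.Carrier k n → Matrix R.Carrier m n
  (M *ᴹ N) i j = sum λ k → M i k R.* N k j

  _⊗_ : Matrix R.Carrier m n → Matrix R.Carrier m′ n′ → Matrix R.Carrier (m ℕ.* m′) (n ℕ.* n′)
  _⊗_ {m′ = m′} {n′ = n′} M N x y =
    let (i , r) = remQuot m′ x
        (j , s) = remQuot n′ y
    in M i j R.* N r s

  I : ∀ n → Matrix R.Carrier n n
  I n i j = if does (i ≟ᶠ j) then R.1# else R.0#

  J : ∀ n → Matrix R.Carrier n n
  J n i j = R.1#

  rowSum : Matrix R.Carrier m n → Fin m → R.Carrier
  rowSum M i = sum (M i)

  excess : Matrix R.Carrier m n → R.Carrier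
  excess M = sum (rowSum M)

  -- The order n is kept as a variable, so that orders such as q ^ m need not be
  -- syntactically products k * b.
  data Multicirculant : ∀ {n} → Matrix R.Carrier n n → Set (c ⊔ ℓ) where
    order-1 : (M : Matrix R.Carrier 1 1) → Multicirculant M
    blocks  : ∀ {n} (M : Matrix R.Carrier n n) k b (eq : n ≡ k ℕ.* b) → 2 ℕ.≤ k →
              (A : Fin k → Matrix R.Carrier b b) →
              (∀ i j → M i j R.≈ circ A (cast eq i) (cast eq j)) →
              (∀ i → Multicirculant (A i)) →
              Multicirculant M

module ℤᴹ = MatrixOps ℤ.+-*-rawRing
module ℂᴹ = MatrixOps ℂ-rawRing

IsSign : ℤ → Set
IsSign z = z ≡ + 1 ⊎ z ≡ ℤ.- + 1

module _ where
  open ℤᴹ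

  record IsHadamard (n : ℕ) (H : Matrix ℤ n n) : Set where
    field
      entries    : ∀ i j → IsSign (H i j)
      orthogonal : H *ᴹ H ᵀ ≈ᴹ + n · I n

  record IsSkewType (n : ℕ) (H : Matrix ℤ n n) : Set where
    field
      hadamard       : IsHadamard n H
      W              : Matrix ℤ n n
      W-entries      : ∀ i j → W i j ≡ + 0 ⊎ IsSign (W i j)
      W-skew         : W ᵀ ≈ᴹ -ᴹ W
      decomposition  : H ≈ᴹ I n +ᴹ W

  bordered : ∀ {q} → Matrix ℤ q q → Matrix ℤ (suc q) (suc q)
  bordered     Q zero    zero    = + 1
  bordered     Q zero    (suc j) = + 1
  bordered     Q (suc i) zero    = ℤ.- + 1
  bordered {q} Q (suc i) (suc j) = (I q +ᴹ Q) i j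

  IsSkewCore : (q : ℕ) → Matrix ℤ q q → Set
  IsSkewCore q Q = IsSkewType (suc q) (bordered Q)

  mutual
    𝒥 : ∀ {q} → Matrix ℤ q q → (m : ℕ) → Matrix ℤ (q ℕ.^ m) (q ℕ.^ m)
    𝒥     Q zero    = J 1
    𝒥 {q} Q (suc m) = J q ⊗ 𝒜 Q m

    𝒜 : ∀ {q} → Matrix ℤ q q → (m : ℕ) → Matrix ℤ (q ℕ.^ m) (q ℕ.^ m)
    𝒜     Q zero    = J 1
    𝒜 {q} Q (suc m) = I q ⊗ 𝒥 Q m +ᴹ Q ⊗ 𝒜 Q m

-- α m = 1/√(m+1) and β m = √(m/(m+1)).
α β : ℕ → ℝ
α m = recip (√ fromℕ (suc m)) (√-positive (fromℕ (suc m)) (suc-positive m))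
β m = √ fromℚ (+ m ℚ./ suc m)

module _ where
  open ℂᴹ

  IsUnitHadamard : (n : ℕ) → Matrix ℂ n n → Set
  IsUnitHadamard n H =
    (∀ i j → modulus (H i j) ≈ fromℕ 1) ×
    H *ᴹ map conj (H ᵀ) ≈ᴹ ℤ→ℂ (+ n) · I n

  IsQUH : (n m : ℕ) → Matrix ℂ n n → Set
  IsQUH n m H =
    IsUnitHadamard n H ×
    (∀ i j → ∃[ ε ] ∃[ δ ] IsSign ε × IsSign δ ×
      H i j ≈ᶜ ℤ→ℂ ε *ᶜ ofReal (α m) +ᶜ ℤ→ℂ δ *ᶜ 𝕚 *ᶜ ofReal (β m))

  IsRegular : (n : ℕ) → Matrix ℂ n n → Set
  IsRegular n H = ∀ i → modulus (rowSum H i) ≈ √ fromℕ n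

  hadamardFromCore : ∀ {q} → Matrix ℤ q q → (m : ℕ) → Matrix ℂ (q ℕ.^ m) (q ℕ.^ m)
  hadamardFromCore {q} Q m =
    ofReal (α q) · map ℤ→ℂ (𝒥 Q m) +ᴹ
    (𝕚 *ᶜ ofReal (β q)) · map ℤ→ℂ (𝒜 Q m)

IsOddPrimePower : ℕ → Set
IsOddPrimePower q = ∃[ p ] ∃[ k ] Prime p × p ≢ 2 × 1 ℕ.≤ k × q ≡ p ℕ.^ k

module Submission where

-- A skew core Q of order n satisfies Q Jₙ = 0 and Q Qᵀ = n I − Jₙ.  With 𝒜 and 𝒥 given by
-- 𝒜ₘ₊₁ = I ⊗ 𝒥ₘ + Q ⊗ 𝒜ₘ and 𝒥ₘ₊₁ = J ⊗ 𝒜ₘ, induction on m shows that 𝒜ₘ 𝒥ₘᵀ is symmetric and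
-- n 𝒜ₘ 𝒜ₘᵀ + 𝒥ₘ 𝒥ₘᵀ = nᵐ (n + 1) I, which are the imaginary and real parts of H H* = nᵐ I up to positive factors.
--
-- Multicirculant cores of order pᵏ with k odd are obtained without finite fields.  For k = 1 take
-- Paley's circulant matrix, whose entries are Legendre symbols of differences modulo p.  For odd k
-- use Turyn's power: the sum of all tensor words of length k, read around a cycle, that are tiled by
-- the letter Q and the two-letter word I J.  It is the trace of the k-th tensor power of
-- [[Q, I], [J, 0]], so its Gram matrix follows from the same recursion with other initial values.
-- If q = pᵏ ≡ 3 modulo 4, then p ≡ 3 modulo 4 and k is odd, so this covers all such q.

open import Defs
open import Algebra.Bundles using (CommutativeMonoid; CommutativeRing)
open import Algebra.Bundles.Raw using (RawRing)
import Algebra.Definitions.RawMonoid as RawMonoidDefs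
import Algebra.Properties.AbelianGroup as AbelianGroupProperties
import Algebra.Properties.CommutativeMonoid.Sum as MonoidSum
import Algebra.Solver.Ring as RingSolver
open import Algebra.Solver.Ring.AlmostCommutativeRing using (fromCommutativeRing; _-Raw-AlmostCommutative⟶_)
open import Data.Bool.Base using (if_then_else_)
open import Data.Fin.Base using (Fin; zero; suc; toℕ; fromℕ<; cast; remQuot; combine; _↑ˡ_; _↑ʳ_)
open import Data.Fin.Permutation using (permutation)
open import Data.Fin.Properties using (remQuot-combine; combine-remQuot; toℕ-injective; toℕ-cast; toℕ-combine; toℕ-fromℕ<; toℕ<n; cast-is-id; cast-trans) renaming (_≟_ to _≟ᶠ_)
open import Data.Integer.Base as ℤ using (ℤ; +_; 0ℤ; 1ℤ; -1ℤ)
import Data.Integer.DivMod as ℤD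
open import Data.Integer.Divisibility.Signed using (divides; ∣⇒∣ᵤ)
import Data.Integer.Properties as ℤP
open import Algebra.Properties.Semiring.Sum ℤP.+-*-semiring
  using (sum; sum-cong-≗; ∑-distrib-+; *-distribˡ-sum; *-distribʳ-sum; sum-replicate-zero)
open import Data.Integer.Tactic.RingSolver using (solve-∀)
open import Data.Maybe.Base using (Maybe; just; nothing)
open import Data.Nat.Base as ℕ using (ℕ; zero; suc; _≤_; _<_; _^_; s≤s; z≤n)
open import Data.Nat.Coprimality using (prime⇒coprime; coprime-Bézout)
import Data.Nat.Divisibility as ℕDiv
open import Data.Nat.DivMod using (_%_; _/_; m≡m%n+[m/n]*n; m%n<n; %-distribˡ-*)
open import Data.Nat.GCD using (module Bézout)
open import Data.Nat.Primality using (Prime; prime⇒nonTrivial)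
import Data.Nat.Properties as ℕP
import Data.Nat.Tactic.RingSolver as ℕSolver
open import Data.Product.Base using (_×_; _,_; proj₁; proj₂; Σ-syntax; uncurry)
open import Data.Rational.Base as ℚ using (0ℚ)
import Data.Rational.Properties as ℚP
open import Data.Rational.Unnormalised.Base as ℚᵘ using (mkℚᵘ)
import Data.Rational.Unnormalised.Properties as ℚᵘP
open import Data.Sum.Base using (_⊎_; inj₁; inj₂)
open import Data.Unit.Base using (⊤; tt)
open import Function.Base using (_∘_)
import Relation.Binary.Reasoning.Setoid as SetoidReasoning
open import Relation.Binary.PropositionalEquality
  using (_≡_; _≢_; refl; sym; trans; cong; cong₂; subst; subst₂; module ≡-Reasoning)
open import Relation.Nullary using (Dec; yes; no; ¬_; contradiction)
open import Relation.Nullary.Decidable using (dec-true; dec-false)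
open ℤᴹ using (I; J; _⊗_; _+ᴹ_; _*ᴹ_; rowSum)

-- A core of prime power order usually comes from the quadratic character of a finite field, and it
-- is multicirculant because the additive group is a power of the integers modulo p. In Turyn's
-- power each word is a tensor product of circulant p × p letters, so the same structure is there
-- from the start. The words fit together because of supports. Where two digits differ, I vanishes,
-- so the letter is Q or J and closes a tile; where they agree, Q vanishes. Reading on around the
-- cycle from a differing digit, every tile is therefore forced, and each off-diagonal entry comes
-- from exactly one word. An odd cycle leaves an odd number of letters Q: this gives the sign under
-- transposition and the vanishing row sums. The weights n and 1 in the Gram identity are β² and α²
-- up to a common factor, so the complex statements reduce to integer ones.

private
  variable
    m n k l : ℕ

  infixl 6 _+ℤ_
  infixl 7 _*ℤ_
  _+ℤ_ = ℤ._+_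
  _*ℤ_ = ℤ._*_

-- Finite sums, the identity matrix and Gram matrices of tensor products

sum-const : ∀ n c → sum {n} (λ _ → c) ≡ + n *ℤ c
sum-const zero    c = refl
sum-const (suc n) c = trans (cong (c +ℤ_) (sum-const n c)) (lem c (+ n))
  where
  lem : ∀ c n → c +ℤ n *ℤ c ≡ (+ 1 +ℤ n) *ℤ c
  lem = solve-∀

sum-splitAt : ∀ m (f : Fin (m ℕ.+ n) → ℤ) →
              sum f ≡ sum (λ i → f (i ↑ˡ n)) +ℤ sum (λ j → f (m ↑ʳ j))
sum-splitAt zero    f = sym (ℤP.+-identityˡ (sum f))
sum-splitAt (suc m) f = trans (cong (f zero +ℤ_) (sum-splitAt m (f ∘ suc)))
  (sym (ℤP.+-assoc (f zero) _ _))

sum-combine : ∀ m n (f : Fin (m ℕ.* n) → ℤ) →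
              sum f ≡ sum λ i → sum λ j → f (combine {m} {n} i j)
sum-combine zero    n f = refl
sum-combine (suc m) n f = trans (sum-splitAt n f)
  (cong (sum (λ j → f (j ↑ˡ (m ℕ.* n))) +ℤ_) (sum-combine m n (λ x → f (n ↑ʳ x))))

sum-remQuot : ∀ m n (F : Fin m × Fin n → ℤ) →
              sum (λ x → F (remQuot {m} n x)) ≡ sum λ i → sum λ j → F (i , j)
sum-remQuot m n F = trans (sum-combine m n (λ x → F (remQuot {m} n x)))
  (sum-cong-≗ λ i → sum-cong-≗ λ j → cong F (remQuot-combine i j))

sum-outer : (a : Fin m → ℤ) (b : Fin n → ℤ) →
            sum (λ i → sum λ j → a i *ℤ b j) ≡ sum a *ℤ sum b
sum-outer a b = trans (sum-cong-≗ λ i → sym (*-distribˡ-sum (a i) b)) (sym (*-distribʳ-sum (sum b) a))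

sum-neg : (f : Fin n → ℤ) → sum (λ i → ℤ.- f i) ≡ ℤ.- sum f
sum-neg f = trans (sum-cong-≗ λ i → sym (ℤP.-1*i≡-i (f i)))
  (trans (sym (*-distribˡ-sum (ℤ.- + 1) f)) (ℤP.-1*i≡-i (sum f)))

sum-linear : ∀ (a b : ℤ) (f g : Fin n → ℤ) →
             sum (λ i → a *ℤ f i +ℤ b *ℤ g i) ≡ a *ℤ sum f +ℤ b *ℤ sum g
sum-linear a b f g = trans (∑-distrib-+ (λ i → a *ℤ f i) (λ i → b *ℤ g i))
  (cong₂ _+ℤ_ (sym (*-distribˡ-sum a f)) (sym (*-distribˡ-sum b g)))

δ-diag : (i : Fin n) → I n i i ≡ + 1
δ-diag i = cong (if_then + 1 else + 0) (dec-true (i ≟ᶠ i) refl)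

δ-off : {i j : Fin n} → i ≢ j → I n i j ≡ + 0
δ-off {i = i} {j} i≢j = cong (if_then + 1 else + 0) (dec-false (i ≟ᶠ j) i≢j)

δ-sym : (i j : Fin n) → I n i j ≡ I n j i
δ-sym i j with i ≟ᶠ j
... | yes refl = sym (δ-diag i)
... | no  i≢j  = sym (δ-off (i≢j ∘ sym))

sum-δ : (i : Fin n) (f : Fin n → ℤ) → sum (λ k → I n i k *ℤ f k) ≡ f i
sum-δ {suc n} zero f = trans
  (cong₂ _+ℤ_ (ℤP.*-identityˡ (f zero)) (trans (sum-cong-≗ λ k → ℤP.*-zeroˡ (f (suc k))) (sum-replicate-zero n)))
  (ℤP.+-identityʳ (f zero))
sum-δ {suc n} (suc i) f = trans
  (cong₂ _+ℤ_ (ℤP.*-zeroˡ (f zero))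
    (sum-δ i (f ∘ suc)))
  (ℤP.+-identityˡ (f (suc i)))

sum-δʳ : (i : Fin n) (f : Fin n → ℤ) → sum (λ k → f k *ℤ I n i k) ≡ f i
sum-δʳ {n} i f = trans (sum-cong-≗ λ k → ℤP.*-comm (f k) (I n i k)) (sum-δ i f)

sum-δ-row : (i : Fin n) → sum (I n i) ≡ + 1
sum-δ-row {n} i = trans (sum-cong-≗ λ k → sym (ℤP.*-identityʳ (I n i k))) (sum-δ i (λ _ → + 1))

remQuot-injective : ∀ m n {x y : Fin (m ℕ.* n)} → remQuot {m} n x ≡ remQuot {m} n y → x ≡ y
remQuot-injective m n {x} {y} eq = trans (sym (combine-remQuot {m} n x))
  (trans (cong (uncurry combine) eq) (combine-remQuot {m} n y))

δ-⊗ : ∀ m n (x y : Fin (m ℕ.* n)) → I (m ℕ.* n) x y ≡ (I m ⊗ I n) x y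
δ-⊗ m n x y with x ≟ᶠ y
... | yes refl = sym (cong₂ _*ℤ_ (δ-diag (proj₁ (remQuot {m} n x))) (δ-diag (proj₂ (remQuot {m} n x))))
... | no x≢y with proj₁ (remQuot {m} n x) ≟ᶠ proj₁ (remQuot {m} n y)
...   | no _ = sym (ℤP.*-zeroˡ (I n (proj₂ (remQuot {m} n x)) (proj₂ (remQuot {m} n y))))
...   | yes i≡j = sym (cong (+ 1 *ℤ_) (δ-off λ r≡s → x≢y (remQuot-injective m n (cong₂ _,_ i≡j r≡s))))

gram : Matrix ℤ m k → Matrix ℤ n k → Matrix ℤ m n
gram M N = M *ᴹ N ᵀ

gram-comm : (M : Matrix ℤ m k) (N : Matrix ℤ n k) → ∀ i j → gram M N i j ≡ gram N M j i
gram-comm M N i j = sum-cong-≗ λ k → ℤP.*-comm (M i k) (N j k)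

gram-⊗ : (A : Matrix ℤ m k) (B : Matrix ℤ n l) {m′ n′ : ℕ} (C : Matrix ℤ m′ k) (D : Matrix ℤ n′ l) →
         ∀ x y → gram (A ⊗ B) (C ⊗ D) x y ≡ (gram A C ⊗ gram B D) x y
gram-⊗ {m} {k} {n} {l} A B {m′} {n′} C D x y = trans
  (sum-remQuot k l λ (u , v) → A i u *ℤ B r v *ℤ (C j u *ℤ D s v))
  (trans (sum-cong-≗ λ u → sum-cong-≗ λ v → lem (A i u) (B r v) (C j u) (D s v))
    (sum-outer (λ u → A i u *ℤ C j u) (λ v → B r v *ℤ D s v)))
  where
  i = proj₁ (remQuot {m} n x)
  r = proj₂ (remQuot {m} n x)
  j = proj₁ (remQuot {m′} n′ y)
  s = proj₂ (remQuot {m′} n′ y)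
  lem : ∀ a b c d → a *ℤ b *ℤ (c *ℤ d) ≡ a *ℤ c *ℤ (b *ℤ d)
  lem = solve-∀

gram-+ˡ : (A B : Matrix ℤ m k) (C : Matrix ℤ n k) → ∀ i j →
          gram (A +ᴹ B) C i j ≡ gram A C i j +ℤ gram B C i j
gram-+ˡ A B C i j = trans (sum-cong-≗ λ k → ℤP.*-distribʳ-+ (C j k) (A i k) (B i k))
  (∑-distrib-+ (λ k → A i k *ℤ C j k) (λ k → B i k *ℤ C j k))

gram-+ʳ : (A : Matrix ℤ m k) (B C : Matrix ℤ n k) → ∀ i j →
          gram A (B +ᴹ C) i j ≡ gram A B i j +ℤ gram A C i j
gram-+ʳ A B C i j = trans (sum-cong-≗ λ k → ℤP.*-distribˡ-+ (A i k) (B j k) (C j k))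
  (∑-distrib-+ (λ k → A i k *ℤ B j k) (λ k → A i k *ℤ C j k))

rowSum-⊗ : (A : Matrix ℤ m k) (B : Matrix ℤ n l) → ∀ x →
           rowSum (A ⊗ B) x ≡ rowSum A (proj₁ (remQuot {m} n x)) *ℤ rowSum B (proj₂ (remQuot {m} n x))
rowSum-⊗ {m} {k} {n} {l} A B x = trans
  (sum-remQuot k l λ (u , v) → A (proj₁ (remQuot {m} n x)) u *ℤ B (proj₂ (remQuot {m} n x)) v)
  (sum-outer (A (proj₁ (remQuot {m} n x))) (B (proj₂ (remQuot {m} n x))))

-- Skew symmetric cores

-- Conditions on `Q` alone, because `IsSkewCore` speaks of the bordered matrix, whose blocks would
-- have to be unpacked at every use.
record IsCore (n : ℕ) (Q : Matrix ℤ n n) : Set where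
  field
    diagonal : ∀ i → Q i i ≡ 0ℤ
    offDiag  : ∀ {i j} → i ≢ j → IsSign (Q i j)
    skew     : ∀ i j → Q j i ≡ ℤ.- Q i j
    rowSum-0 : ∀ i → rowSum Q i ≡ 0ℤ
    gram-Q   : ∀ i j → gram Q Q i j ≡ + n *ℤ I n i j ℤ.- 1ℤ

IsSign-* : ∀ {x y} → IsSign x → IsSign y → IsSign (x *ℤ y)
IsSign-* (inj₁ refl) (inj₁ refl) = inj₁ refl
IsSign-* (inj₁ refl) (inj₂ refl) = inj₂ refl
IsSign-* (inj₂ refl) (inj₁ refl) = inj₂ refl
IsSign-* (inj₂ refl) (inj₂ refl) = inj₁ refl

IsSign⇒square : ∀ {z} → IsSign z → z *ℤ z ≡ 1ℤ
IsSign⇒square (inj₁ refl) = refl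
IsSign⇒square (inj₂ refl) = refl

self-neg⇒0 : ∀ {z} → z ≡ ℤ.- z → z ≡ 0ℤ
self-neg⇒0 {+ zero} _ = refl
self-neg⇒0 {+ suc n} ()
self-neg⇒0 {ℤ.-[1+ n ]} ()

module _ {n} {Q : Matrix ℤ n n} (c : IsCore n Q) where
  open IsCore c

  -- In the lower right block, skewness cancels the two cross terms of (I + Q)(I + Q)ᵀ, and the J
  -- contributed by the border cancels the -J in Q Qᵀ.
  bordered-gram : ∀ i j → gram (bordered Q) (bordered Q) i j ≡ + suc n *ℤ I (suc n) i j
  bordered-gram zero zero = trans (cong (1ℤ +ℤ_) (sum-const n 1ℤ)) (lem (+ n))
    where
    lem : ∀ x → 1ℤ +ℤ x *ℤ 1ℤ ≡ (1ℤ +ℤ x) *ℤ 1ℤ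
    lem = solve-∀
  bordered-gram zero (suc j) = trans
    (cong (-1ℤ +ℤ_) (trans (sum-cong-≗ λ k → ℤP.*-identityˡ (I n j k +ℤ Q j k))
      (trans (∑-distrib-+ (I n j) (Q j)) (cong₂ _+ℤ_ (sum-δ-row j) (rowSum-0 j)))))
    (sym (ℤP.*-zeroʳ (+ suc n)))
  bordered-gram (suc i) zero = trans (gram-comm (bordered Q) (bordered Q) (suc i) zero)
    (bordered-gram zero (suc i))
  bordered-gram (suc i) (suc j) = trans (cong (1ℤ +ℤ_) inner) (lem (+ n) (I n i j) (Q i j))
    where
    inner : gram (I n +ᴹ Q) (I n +ᴹ Q) i j ≡
            (I n i j +ℤ ℤ.- Q i j) +ℤ (Q i j +ℤ (+ n *ℤ I n i j ℤ.- 1ℤ))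
    inner = trans (gram-+ˡ (I n) Q (I n +ᴹ Q) i j) (cong₂ _+ℤ_
      (trans (sum-δ i _) (cong₂ _+ℤ_ (δ-sym j i) (skew i j)))
      (trans (gram-+ʳ Q (I n) Q i j) (cong₂ _+ℤ_ (sum-δʳ j (Q i)) (gram-Q i j))))
    lem : ∀ x d q → 1ℤ +ℤ ((d +ℤ ℤ.- q) +ℤ (q +ℤ (x *ℤ d ℤ.- 1ℤ))) ≡ (1ℤ +ℤ x) *ℤ d
    lem = solve-∀

  bordered-sign : ∀ i j → IsSign (bordered Q i j)
  bordered-sign zero zero = inj₁ refl
  bordered-sign zero (suc j) = inj₁ refl
  bordered-sign (suc i) zero = inj₂ refl
  bordered-sign (suc i) (suc j) with i ≟ᶠ j
  ... | yes refl = inj₁ (cong (1ℤ +ℤ_) (diagonal i))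
  ... | no  i≢j  = subst IsSign (sym (ℤP.+-identityˡ (Q i j))) (offDiag i≢j)

  private
    W : Matrix ℤ (suc n) (suc n)
    W zero    zero    = 0ℤ
    W zero    (suc j) = 1ℤ
    W (suc i) zero    = -1ℤ
    W (suc i) (suc j) = Q i j

    W-entries : ∀ i j → W i j ≡ 0ℤ ⊎ IsSign (W i j)
    W-entries zero    zero    = inj₁ refl
    W-entries zero    (suc j) = inj₂ (inj₁ refl)
    W-entries (suc i) zero    = inj₂ (inj₂ refl)
    W-entries (suc i) (suc j) with i ≟ᶠ j
    ... | yes refl = inj₁ (diagonal i)
    ... | no  i≢j  = inj₂ (offDiag i≢j)

    W-skew : ∀ i j → W j i ≡ ℤ.- W i j
    W-skew zero    zero    = refl
    W-skew zero    (suc j) = refl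
    W-skew (suc i) zero    = refl
    W-skew (suc i) (suc j) = skew i j

    decomposition : ∀ i j → bordered Q i j ≡ (I (suc n) +ᴹ W) i j
    decomposition zero    zero    = refl
    decomposition zero    (suc j) = refl
    decomposition (suc i) zero    = refl
    decomposition (suc i) (suc j) = refl

  IsCore⇒IsSkewCore : IsSkewCore n Q
  IsCore⇒IsSkewCore = record
    { hadamard = record { entries = bordered-sign ; orthogonal = bordered-gram }
    ; W = W ; W-entries = W-entries ; W-skew = W-skew ; decomposition = decomposition }

module _ {n} {Q : Matrix ℤ n n} (s : IsSkewCore n Q) where
  open IsSkewType s
  open IsHadamard hadamard

  private
    cancelˡ : ∀ {x y z : ℤ} → x +ℤ y ≡ x +ℤ z → y ≡ z
    cancelˡ {x} {y} {z} = AbelianGroupProperties.∙-cancelˡ ℤP.+-0-abelianGroup x y z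

    Q≡W : ∀ i j → Q i j ≡ W (suc i) (suc j)
    Q≡W i j = cancelˡ {I n i j} (decomposition (suc i) (suc j))

    core-skew : ∀ i j → Q j i ≡ ℤ.- Q i j
    core-skew i j = trans (Q≡W j i) (trans (W-skew (suc i) (suc j)) (cong ℤ.-_ (sym (Q≡W i j))))

    core-diagonal : ∀ i → Q i i ≡ 0ℤ
    core-diagonal i = self-neg⇒0 (core-skew i i)

    -- The border row is orthogonal to row `suc i`, and in their product the -1 of the border
    -- cancels the 1 from the identity.
    core-rowSum : ∀ i → rowSum Q i ≡ 0ℤ
    core-rowSum i = cancelˡ { -1ℤ +ℤ 1ℤ} (trans (sym eq) (trans (orthogonal zero (suc i)) (ℤP.*-zeroʳ (+ suc n))))
      where
      eq : gram (bordered Q) (bordered Q) zero (suc i) ≡ (-1ℤ +ℤ 1ℤ) +ℤ rowSum Q i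
      eq = trans (cong (-1ℤ +ℤ_) (trans (sum-cong-≗ λ k → ℤP.*-identityˡ (I n i k +ℤ Q i k))
          (trans (∑-distrib-+ (I n i) (Q i)) (cong (_+ℤ rowSum Q i) (sum-δ-row i)))))
        (sym (ℤP.+-assoc -1ℤ 1ℤ (rowSum Q i)))

    core-gram : ∀ i j → gram Q Q i j ≡ + n *ℤ I n i j ℤ.- 1ℤ
    core-gram i j = cancelˡ {1ℤ +ℤ I n i j} (trans (sym eq) (trans (orthogonal (suc i) (suc j)) (rhs (+ n) (I n i j))))
      where
      lhs : ∀ d q g → 1ℤ +ℤ ((d +ℤ ℤ.- q) +ℤ (q +ℤ g)) ≡ 1ℤ +ℤ d +ℤ g
      lhs = solve-∀
      rhs : ∀ x d → (1ℤ +ℤ x) *ℤ d ≡ 1ℤ +ℤ d +ℤ (x *ℤ d ℤ.- 1ℤ)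
      rhs = solve-∀
      eq : gram (bordered Q) (bordered Q) (suc i) (suc j) ≡ 1ℤ +ℤ I n i j +ℤ gram Q Q i j
      eq = trans (cong (1ℤ +ℤ_) (trans (gram-+ˡ (I n) Q (I n +ᴹ Q) i j) (cong₂ _+ℤ_
          (trans (sum-δ i _) (cong₂ _+ℤ_ (δ-sym j i) (core-skew i j)))
          (trans (gram-+ʳ Q (I n) Q i j) (cong (_+ℤ gram Q Q i j) (sum-δʳ j (Q i)))))))
        (lhs (I n i j) (Q i j) (gram Q Q i j))

    core-offDiag : ∀ {i j} → i ≢ j → IsSign (Q i j)
    core-offDiag {i} {j} i≢j = subst IsSign
      (trans (cong (_+ℤ Q i j) (δ-off i≢j)) (ℤP.+-identityˡ (Q i j))) (entries (suc i) (suc j))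

  IsSkewCore⇒IsCore : IsCore n Q
  IsSkewCore⇒IsCore = record
    { diagonal = core-diagonal ; offDiag = core-offDiag ; skew = core-skew
    ; rowSum-0 = core-rowSum ; gram-Q = core-gram }

-- Tensor words

-- The column (P, N) is (x, y) multiplied on the left k times, through tensor products, by the block
-- matrix [[Q, I], [J, 0]].  In particular 𝒜 = P Q 1 1 and 𝒥 = N Q 1 1.
mutual
  P : Matrix ℤ n n → (x y : ℤ) → ∀ k → Matrix ℤ (n ^ k) (n ^ k)
  P         Q x y zero    = λ _ _ → x
  P {n = n} Q x y (suc k) = Q ⊗ P Q x y k +ᴹ I n ⊗ N Q x y k

  N : Matrix ℤ n n → (x y : ℤ) → ∀ k → Matrix ℤ (n ^ k) (n ^ k)
  N         Q x y zero    = λ _ _ → y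
  N {n = n} Q x y (suc k) = J n ⊗ P Q x y k

-- This is `a` for even `k` and `b` for odd `k`; each tensor factor interchanges the roles of the
-- two initial values.
alternate : ∀ {A : Set} → ℕ → A → A → A
alternate zero    a b = a
alternate (suc k) a b = alternate k b a

alternate-idem : ∀ {A : Set} k (a : A) → alternate k a a ≡ a
alternate-idem zero    a = refl
alternate-idem (suc k) a = alternate-idem k a

data Odd : ℕ → Set where
  one : Odd 1
  2+_ : ∀ {k} → Odd k → Odd (suc (suc k))

alternate-odd : ∀ {A : Set} {k} → Odd k → (a b : A) → alternate k a b ≡ b
alternate-odd one    a b = refl
alternate-odd (2+ o) a b = alternate-odd o a b

-1^odd : ∀ {k} → Odd k → -1ℤ ℤ.^ k ≡ -1ℤ
-1^odd one = refl
-1^odd (2+_ {k} o) = cong (λ z → -1ℤ *ℤ (-1ℤ *ℤ z)) (-1^odd o)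

module Words {n} {Q : Matrix ℤ n n} (c : IsCore n Q) where
  open IsCore c

  private
    hi : ∀ k → Fin (n ^ suc k) → Fin n
    hi k x = proj₁ (remQuot {n} (n ^ k) x)
    lo : ∀ k → Fin (n ^ suc k) → Fin (n ^ k)
    lo k x = proj₂ (remQuot {n} (n ^ k) x)

    gram-QJ : ∀ i (j : Fin n) → gram Q (J n) i j ≡ 0ℤ
    gram-QJ i j = trans (sum-cong-≗ λ k → ℤP.*-identityʳ (Q i k)) (rowSum-0 i)

    gram-IJ : ∀ i (j : Fin n) → gram (I n) (J n) i j ≡ 1ℤ
    gram-IJ i j = sum-δ i _

    gram-JJ : ∀ i (j : Fin n) → gram (J n) (J n) i j ≡ + n
    gram-JJ i j = trans (sum-const n 1ℤ) (ℤP.*-identityʳ (+ n))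

  -- Q J = 0 kills the first summand, and I J = J is constantly 1, so the leading digit drops out.
  gram-PN-step : ∀ k (A B C : Matrix ℤ (n ^ k) (n ^ k)) x y →
    gram (Q ⊗ A +ᴹ I n ⊗ B) (J n ⊗ C) x y ≡ gram B C (lo k x) (lo k y)
  gram-PN-step k A B C x y = begin
    gram (Q ⊗ A +ᴹ I n ⊗ B) (J n ⊗ C) x y
      ≡⟨ gram-+ˡ (Q ⊗ A) (I n ⊗ B) (J n ⊗ C) x y ⟩
    gram (Q ⊗ A) (J n ⊗ C) x y +ℤ gram (I n ⊗ B) (J n ⊗ C) x y
      ≡⟨ cong₂ _+ℤ_ (gram-⊗ Q A (J n) C x y) (gram-⊗ (I n) B (J n) C x y) ⟩
    gram Q (J n) i j *ℤ gram A C r s +ℤ gram (I n) (J n) i j *ℤ gram B C r s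
      ≡⟨ cong₂ (λ u v → u *ℤ gram A C r s +ℤ v *ℤ gram B C r s) (gram-QJ i j) (gram-IJ i j) ⟩
    0ℤ *ℤ gram A C r s +ℤ 1ℤ *ℤ gram B C r s
      ≡⟨ lem (gram A C r s) (gram B C r s) ⟩
    gram B C r s ∎
    where
    open ≡-Reasoning
    i = hi k x
    j = hi k y
    r = lo k x
    s = lo k y
    lem : ∀ a b → 0ℤ *ℤ a +ℤ 1ℤ *ℤ b ≡ b
    lem = solve-∀

  mutual
    -- Each step removes a digit and exchanges P with N, so the product is a constant matrix. Two
    -- different columns are allowed because the power mixes (1, 0) with (0, 1).
    gram-PN : ∀ x y x′ y′ k u v →
      gram (P Q x y k) (N Q x′ y′ k) u v ≡ alternate k (x *ℤ y′) (y *ℤ x′)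
    gram-PN x y x′ y′ zero    u v = ℤP.+-identityʳ (x *ℤ y′)
    gram-PN x y x′ y′ (suc k) u v = trans
      (gram-PN-step k (P Q x y k) (N Q x y k) (P Q x′ y′ k) u v)
      (gram-NP x y x′ y′ k (lo k u) (lo k v))

    gram-NP : ∀ x y x′ y′ k u v →
      gram (N Q x y k) (P Q x′ y′ k) u v ≡ alternate k (y *ℤ x′) (x *ℤ y′)
    gram-NP x y x′ y′ zero    u v = ℤP.+-identityʳ (y *ℤ x′)
    gram-NP x y x′ y′ (suc k) u v = trans (gram-comm (N Q x y (suc k)) (P Q x′ y′ (suc k)) u v)
      (trans (gram-PN-step k (P Q x′ y′ k) (N Q x′ y′ k) (P Q x y k) v u)
        (trans (gram-comm (N Q x′ y′ k) (P Q x y k) (lo k v) (lo k u))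
          (gram-PN x y x′ y′ k (lo k u) (lo k v))))

  -- For a single column the two alternating constants are x y and y x, so the parity of `k` makes
  -- no difference.
  gram-PN≡NP : ∀ x y k u v → gram (P Q x y k) (N Q x y k) u v ≡ gram (N Q x y k) (P Q x y k) u v
  gram-PN≡NP x y k u v = trans (gram-PN x y x y k u v)
    (trans (cong (λ z → alternate k z (y *ℤ x)) (ℤP.*-comm x y))
      (trans (cong (alternate k (y *ℤ x)) (ℤP.*-comm y x)) (sym (gram-NP x y x y k u v))))

  -- The cross terms Q ⊗ P Nᵀ and Qᵀ ⊗ N Pᵀ cancel, because Q is skew and P Nᵀ = N Pᵀ.
  gram-PP : ∀ x y k u v → gram (P Q x y (suc k)) (P Q x y (suc k)) u v ≡
    (+ n *ℤ I n (hi k u) (hi k v) ℤ.- 1ℤ) *ℤ gram (P Q x y k) (P Q x y k) (lo k u) (lo k v) +ℤ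
    I n (hi k u) (hi k v) *ℤ gram (N Q x y k) (N Q x y k) (lo k u) (lo k v)
  gram-PP x y k u v = begin
    gram (Q ⊗ A +ᴹ I n ⊗ B) (Q ⊗ A +ᴹ I n ⊗ B) u v
      ≡⟨ gram-+ˡ (Q ⊗ A) (I n ⊗ B) (Q ⊗ A +ᴹ I n ⊗ B) u v ⟩
    gram (Q ⊗ A) (Q ⊗ A +ᴹ I n ⊗ B) u v +ℤ gram (I n ⊗ B) (Q ⊗ A +ᴹ I n ⊗ B) u v
      ≡⟨ cong₂ _+ℤ_ (gram-+ʳ (Q ⊗ A) (Q ⊗ A) (I n ⊗ B) u v) (gram-+ʳ (I n ⊗ B) (Q ⊗ A) (I n ⊗ B) u v) ⟩
    gram (Q ⊗ A) (Q ⊗ A) u v +ℤ gram (Q ⊗ A) (I n ⊗ B) u v +ℤ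
    (gram (I n ⊗ B) (Q ⊗ A) u v +ℤ gram (I n ⊗ B) (I n ⊗ B) u v)
      ≡⟨ cong₂ _+ℤ_
           (cong₂ _+ℤ_ (gram-⊗ Q A Q A u v) (gram-⊗ Q A (I n) B u v))
           (cong₂ _+ℤ_ (gram-⊗ (I n) B Q A u v) (gram-⊗ (I n) B (I n) B u v)) ⟩
    gram Q Q i j *ℤ gram A A r s +ℤ gram Q (I n) i j *ℤ gram A B r s +ℤ
    (gram (I n) Q i j *ℤ gram B A r s +ℤ gram (I n) (I n) i j *ℤ gram B B r s)
      ≡⟨ cong₂ _+ℤ_
           (cong₂ _+ℤ_ (cong (_*ℤ gram A A r s) (gram-Q i j))
                       (cong₂ _*ℤ_ (sum-δʳ j (Q i)) (gram-PN≡NP x y k r s)))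
           (cong₂ _+ℤ_ (cong (_*ℤ gram B A r s) (trans (sum-δ i (Q j)) (skew i j)))
                       (cong (_*ℤ gram B B r s) (trans (sum-δ i (I n j)) (δ-sym j i)))) ⟩
    (+ n *ℤ I n i j ℤ.- 1ℤ) *ℤ gram A A r s +ℤ Q i j *ℤ gram B A r s +ℤ
    (ℤ.- Q i j *ℤ gram B A r s +ℤ I n i j *ℤ gram B B r s)
      ≡⟨ lem ((+ n *ℤ I n i j ℤ.- 1ℤ) *ℤ gram A A r s) (Q i j) (gram B A r s) (I n i j *ℤ gram B B r s) ⟩
    (+ n *ℤ I n i j ℤ.- 1ℤ) *ℤ gram A A r s +ℤ I n i j *ℤ gram B B r s ∎
    where
    open ≡-Reasoning
    A = P Q x y k
    B = N Q x y k
    i = hi k u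
    j = hi k v
    r = lo k u
    s = lo k v
    lem : ∀ a q b d → a +ℤ q *ℤ b +ℤ (ℤ.- q *ℤ b +ℤ d) ≡ a +ℤ d
    lem = solve-∀

  gram-NN : ∀ x y k u v → gram (N Q x y (suc k)) (N Q x y (suc k)) u v ≡
    + n *ℤ gram (P Q x y k) (P Q x y k) (lo k u) (lo k v)
  gram-NN x y k u v = trans (gram-⊗ (J n) (P Q x y k) (J n) (P Q x y k) u v)
    (cong (_*ℤ gram (P Q x y k) (P Q x y k) (lo k u) (lo k v)) (gram-JJ (hi k u) (hi k v)))

  -- The weight `n` is what closes the induction: the term -n J ⊗ P Pᵀ coming from Q Qᵀ is cancelled
  -- by the new N Nᵀ = n J ⊗ P Pᵀ, leaving n I ⊗ (n P Pᵀ + N Nᵀ).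
  gram-total : ∀ x y k u v →
    + n *ℤ gram (P Q x y k) (P Q x y k) u v +ℤ gram (N Q x y k) (N Q x y k) u v ≡
    + (n ^ k) *ℤ (+ n *ℤ (x *ℤ x) +ℤ y *ℤ y) *ℤ I (n ^ k) u v
  gram-total x y zero zero zero = lem (+ n) x y
    where
    lem : ∀ n x y → n *ℤ (x *ℤ x +ℤ 0ℤ) +ℤ (y *ℤ y +ℤ 0ℤ) ≡ 1ℤ *ℤ (n *ℤ (x *ℤ x) +ℤ y *ℤ y) *ℤ 1ℤ
    lem = solve-∀
  gram-total x y (suc k) u v = begin
    + n *ℤ gram (P Q x y (suc k)) (P Q x y (suc k)) u v +ℤ gram (N Q x y (suc k)) (N Q x y (suc k)) u v
      ≡⟨ cong₂ (λ a b → + n *ℤ a +ℤ b) (gram-PP x y k u v) (gram-NN x y k u v) ⟩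
    + n *ℤ ((+ n *ℤ d ℤ.- 1ℤ) *ℤ p +ℤ d *ℤ q) +ℤ + n *ℤ p
      ≡⟨ lem₁ (+ n) d p q ⟩
    + n *ℤ d *ℤ (+ n *ℤ p +ℤ q)
      ≡⟨ cong (+ n *ℤ d *ℤ_) (gram-total x y k (lo k u) (lo k v)) ⟩
    + n *ℤ d *ℤ (+ (n ^ k) *ℤ e *ℤ I (n ^ k) (lo k u) (lo k v))
      ≡⟨ lem₂ (+ n) d (+ (n ^ k)) e (I (n ^ k) (lo k u) (lo k v)) ⟩
    + n *ℤ + (n ^ k) *ℤ e *ℤ (d *ℤ I (n ^ k) (lo k u) (lo k v))
      ≡⟨ cong₂ (λ a b → a *ℤ e *ℤ b) (sym (ℤP.pos-* n (n ^ k))) (sym (δ-⊗ n (n ^ k) u v)) ⟩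
    + (n ^ suc k) *ℤ e *ℤ I (n ^ suc k) u v ∎
    where
    open ≡-Reasoning
    d = I n (hi k u) (hi k v)
    e = + n *ℤ (x *ℤ x) +ℤ y *ℤ y
    p = gram (P Q x y k) (P Q x y k) (lo k u) (lo k v)
    q = gram (N Q x y k) (N Q x y k) (lo k u) (lo k v)
    lem₁ : ∀ n d p q → n *ℤ ((n *ℤ d ℤ.- 1ℤ) *ℤ p +ℤ d *ℤ q) +ℤ n *ℤ p ≡ n *ℤ d *ℤ (n *ℤ p +ℤ q)
    lem₁ = solve-∀
    lem₂ : ∀ n d m e f → n *ℤ d *ℤ (m *ℤ e *ℤ f) ≡ n *ℤ m *ℤ e *ℤ (d *ℤ f)
    lem₂ = solve-∀

  mutual
    -- `ρ` and `σ` are the common row sums of `P` and `N`. Rows of Q sum to 0, so one step takes (ρ,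
    -- σ) to (σ, n ρ).
    ρ : (x y : ℤ) → ℕ → ℤ
    ρ x y zero    = x
    ρ x y (suc k) = σ x y k

    σ : (x y : ℤ) → ℕ → ℤ
    σ x y zero    = y
    σ x y (suc k) = + n *ℤ ρ x y k

  mutual
    rowSum-P : ∀ x y k u → rowSum (P Q x y k) u ≡ ρ x y k
    rowSum-P x y zero    u = ℤP.+-identityʳ x
    rowSum-P x y (suc k) u = trans (∑-distrib-+ ((Q ⊗ P Q x y k) u) ((I n ⊗ N Q x y k) u))
      (trans (cong₂ _+ℤ_
          (trans (rowSum-⊗ Q (P Q x y k) u) (cong (_*ℤ rowSum (P Q x y k) (lo k u)) (rowSum-0 (hi k u))))
          (trans (rowSum-⊗ (I n) (N Q x y k) u) (cong₂ _*ℤ_ (sum-δ-row (hi k u)) (rowSum-N x y k (lo k u)))))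
        (lem (rowSum (P Q x y k) (lo k u)) (σ x y k)))
      where
      lem : ∀ a b → 0ℤ *ℤ a +ℤ 1ℤ *ℤ b ≡ b
      lem = solve-∀

    rowSum-N : ∀ x y k u → rowSum (N Q x y k) u ≡ σ x y k
    rowSum-N x y zero    u = ℤP.+-identityʳ y
    rowSum-N x y (suc k) u = trans (rowSum-⊗ (J n) (P Q x y k) u)
      (cong₂ _*ℤ_ (trans (sum-const n 1ℤ) (ℤP.*-identityʳ (+ n))) (rowSum-P x y k (lo k u)))

  -- The analogue of `gram-total` for row sums, from which regularity and the excess follow.
  ρσ-norm : ∀ x y k → + n *ℤ (ρ x y k *ℤ ρ x y k) +ℤ σ x y k *ℤ σ x y k ≡
                      + (n ^ k) *ℤ (+ n *ℤ (x *ℤ x) +ℤ y *ℤ y)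
  ρσ-norm x y zero    = sym (ℤP.*-identityˡ _)
  ρσ-norm x y (suc k) = trans (lem₁ (+ n) (ρ x y k) (σ x y k))
    (trans (cong (+ n *ℤ_) (ρσ-norm x y k))
      (trans (sym (ℤP.*-assoc (+ n) (+ (n ^ k)) _))
        (cong (_*ℤ (+ n *ℤ (x *ℤ x) +ℤ y *ℤ y)) (sym (ℤP.pos-* n (n ^ k))))))
    where
    lem₁ : ∀ n r s → n *ℤ (s *ℤ s) +ℤ n *ℤ r *ℤ (n *ℤ r) ≡ n *ℤ (n *ℤ (r *ℤ r) +ℤ s *ℤ s)
    lem₁ = solve-∀

  -- After an odd number of steps only the other initial value, here 0, is left. In terms of words:
  -- a tiling of odd length contains a Q.
  ρ-vanishes : ∀ {k} → Odd k → ∀ x → ρ x 0ℤ k ≡ 0ℤ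
  ρ-vanishes one    x = refl
  ρ-vanishes (2+ o) x = trans (cong (+ n *ℤ_) (ρ-vanishes o x)) (ℤP.*-zeroʳ (+ n))

  σ-vanishes : ∀ {k} → Odd k → ∀ y → σ 0ℤ y k ≡ 0ℤ
  σ-vanishes one    y = ℤP.*-zeroʳ (+ n)
  σ-vanishes (2+ o) y = trans (cong (+ n *ℤ_) (σ-vanishes o y)) (ℤP.*-zeroʳ (+ n))

  mutual
    -- Transposition changes the sign of a word once per letter Q. In `P` the number of these has
    -- the parity of `k` for the column (1, 0) and the opposite one for (0, 1); `e` = 1 and `e` = -1
    -- cover the two cases.
    P-transpose : ∀ e {x y} → x ≡ e *ℤ x → y ≡ ℤ.- (e *ℤ y) → ∀ k u v →
                  P Q x y k v u ≡ e *ℤ -1ℤ ℤ.^ k *ℤ P Q x y k u v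
    P-transpose e {x} ex ey zero    u v = trans ex (cong (_*ℤ x) (sym (ℤP.*-identityʳ e)))
    P-transpose e {x} {y} ex ey (suc k) u v = trans
      (cong₂ _+ℤ_ (cong₂ _*ℤ_ (skew i j) (P-transpose e ex ey k r s))
                  (cong₂ _*ℤ_ (δ-sym j i) (N-transpose e ex ey k r s)))
      (lem e (-1ℤ ℤ.^ k) (Q i j) (P Q x y k r s) (I n i j) (N Q x y k r s))
      where
      i = hi k u
      j = hi k v
      r = lo k u
      s = lo k v
      lem : ∀ e g q p d m → ℤ.- q *ℤ (e *ℤ g *ℤ p) +ℤ d *ℤ ℤ.- (e *ℤ g *ℤ m) ≡
                            e *ℤ (-1ℤ *ℤ g) *ℤ (q *ℤ p +ℤ d *ℤ m)
      lem = solve-∀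

    N-transpose : ∀ e {x y} → x ≡ e *ℤ x → y ≡ ℤ.- (e *ℤ y) → ∀ k u v →
                  N Q x y k v u ≡ ℤ.- (e *ℤ -1ℤ ℤ.^ k *ℤ N Q x y k u v)
    N-transpose e {x} {y} ex ey zero    u v = trans ey (cong (λ z → ℤ.- (z *ℤ y)) (sym (ℤP.*-identityʳ e)))
    N-transpose e {x} {y} ex ey (suc k) u v = trans
      (cong (1ℤ *ℤ_) (P-transpose e ex ey k (lo k u) (lo k v)))
      (lem e (-1ℤ ℤ.^ k) (P Q x y k (lo k u) (lo k v)))
      where
      lem : ∀ e g p → 1ℤ *ℤ (e *ℤ g *ℤ p) ≡ ℤ.- (e *ℤ (-1ℤ *ℤ g) *ℤ (1ℤ *ℤ p))
      lem = solve-∀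

  -- By `gram-PP`, the next P Pᵀ is I ⊗ (n P Pᵀ + N Nᵀ) - J ⊗ P Pᵀ. By `gram-total` the bracket for
  -- (1, 0) is n times that for (0, 1), so the difference only changes sign at each step, starting
  -- from 1.
  gram-difference : ∀ k u v →
    gram (P Q 1ℤ 0ℤ k) (P Q 1ℤ 0ℤ k) u v ≡ + n *ℤ gram (P Q 0ℤ 1ℤ k) (P Q 0ℤ 1ℤ k) u v +ℤ -1ℤ ℤ.^ k
  gram-difference zero    u v = sym (cong (_+ℤ 1ℤ) (ℤP.*-zeroʳ (+ n)))
  gram-difference (suc k) u v = trans (gram-PP 1ℤ 0ℤ k u v)
    (trans (lem (+ n) d X NX μ δ Y NY (-1ℤ ℤ.^ k)
        (gram-total 1ℤ 0ℤ k r s) (gram-total 0ℤ 1ℤ k r s) (gram-difference k r s))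
      (sym (cong (λ z → + n *ℤ z +ℤ -1ℤ ℤ.^ suc k) (gram-PP 0ℤ 1ℤ k u v))))
    where
    r = lo k u
    s = lo k v
    d = I n (hi k u) (hi k v)
    μ = + (n ^ k)
    δ = I (n ^ k) r s
    X = gram (P Q 1ℤ 0ℤ k) (P Q 1ℤ 0ℤ k) r s
    Y = gram (P Q 0ℤ 1ℤ k) (P Q 0ℤ 1ℤ k) r s
    NX = gram (N Q 1ℤ 0ℤ k) (N Q 1ℤ 0ℤ k) r s
    NY = gram (N Q 0ℤ 1ℤ k) (N Q 0ℤ 1ℤ k) r s
    lem : ∀ n d X NX m δ Y NY z →
      n *ℤ X +ℤ NX ≡ m *ℤ (n *ℤ 1ℤ +ℤ 0ℤ) *ℤ δ → n *ℤ Y +ℤ NY ≡ m *ℤ (n *ℤ 0ℤ +ℤ 1ℤ) *ℤ δ →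
      X ≡ n *ℤ Y +ℤ z →
      (n *ℤ d ℤ.- 1ℤ) *ℤ X +ℤ d *ℤ NX ≡ n *ℤ ((n *ℤ d ℤ.- 1ℤ) *ℤ Y +ℤ d *ℤ NY) +ℤ -1ℤ *ℤ z
    lem n d X NX m δ Y NY z tX tY XY = trans (expand₁ n d X NX)
      (trans (cong₂ (λ a b → d *ℤ a ℤ.- b) tX XY)
        (trans (middle n d m δ Y z)
          (trans (cong (λ a → n *ℤ (d *ℤ a ℤ.- Y) +ℤ -1ℤ *ℤ z) (sym tY)) (expand₂ n d Y NY z))))
      where
      expand₁ : ∀ n d X NX → (n *ℤ d ℤ.- 1ℤ) *ℤ X +ℤ d *ℤ NX ≡ d *ℤ (n *ℤ X +ℤ NX) ℤ.- X
      expand₁ = solve-∀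
      middle : ∀ n d m δ Y z → d *ℤ (m *ℤ (n *ℤ 1ℤ +ℤ 0ℤ) *ℤ δ) ℤ.- (n *ℤ Y +ℤ z) ≡
        n *ℤ (d *ℤ (m *ℤ (n *ℤ 0ℤ +ℤ 1ℤ) *ℤ δ) ℤ.- Y) +ℤ -1ℤ *ℤ z
      middle = solve-∀
      expand₂ : ∀ n d Y NY z → n *ℤ (d *ℤ (n *ℤ Y +ℤ NY) ℤ.- Y) +ℤ -1ℤ *ℤ z ≡
        n *ℤ ((n *ℤ d ℤ.- 1ℤ) *ℤ Y +ℤ d *ℤ NY) +ℤ -1ℤ *ℤ z
      expand₂ = solve-∀

  -- The possible shapes of the 2 × 2 matrix with rows (`P` 1 0, `P` 0 1) and (`N` 1 0, `N` 0 1): a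
  -- permutation matrix on the diagonal, and otherwise one column of signs beside a column of zeros.
  -- In the latter shapes exactly one of the two trace entries is nonzero.
  data Cell (k : ℕ) (u v : Fin (n ^ k)) : Set where
    onDiagonal : u ≡ v →
      P Q 1ℤ 0ℤ k u v ≡ alternate k 1ℤ 0ℤ → P Q 0ℤ 1ℤ k u v ≡ alternate k 0ℤ 1ℤ →
      N Q 1ℤ 0ℤ k u v ≡ alternate k 0ℤ 1ℤ → N Q 0ℤ 1ℤ k u v ≡ alternate k 1ℤ 0ℤ → Cell k u v
    column₁ : IsSign (P Q 1ℤ 0ℤ k u v) → P Q 0ℤ 1ℤ k u v ≡ 0ℤ →
              IsSign (N Q 1ℤ 0ℤ k u v) → N Q 0ℤ 1ℤ k u v ≡ 0ℤ → Cell k u v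
    column₂ : P Q 1ℤ 0ℤ k u v ≡ 0ℤ → IsSign (P Q 0ℤ 1ℤ k u v) →
              N Q 1ℤ 0ℤ k u v ≡ 0ℤ → IsSign (N Q 0ℤ 1ℤ k u v) → Cell k u v

  N-entry : ∀ x y k u v → N Q x y (suc k) u v ≡ P Q x y k (lo k u) (lo k v)
  N-entry x y k u v = ℤP.*-identityˡ _

  P-entry-diag : ∀ x y k u v → hi k u ≡ hi k v → P Q x y (suc k) u v ≡ N Q x y k (lo k u) (lo k v)
  P-entry-diag x y k u v eq = trans
    (cong₂ (λ a b → a *ℤ P Q x y k (lo k u) (lo k v) +ℤ b *ℤ N Q x y k (lo k u) (lo k v))
      (trans (cong (Q (hi k u)) (sym eq)) (diagonal (hi k u)))
      (trans (cong (I n (hi k u)) (sym eq)) (δ-diag (hi k u))))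
    (lem (P Q x y k (lo k u) (lo k v)) (N Q x y k (lo k u) (lo k v)))
    where
    lem : ∀ a b → 0ℤ *ℤ a +ℤ 1ℤ *ℤ b ≡ b
    lem = solve-∀

  P-entry-off : ∀ x y k u v → hi k u ≢ hi k v →
    P Q x y (suc k) u v ≡ Q (hi k u) (hi k v) *ℤ P Q x y k (lo k u) (lo k v)
  P-entry-off x y k u v neq = trans
    (cong (λ b → Q (hi k u) (hi k v) *ℤ P Q x y k (lo k u) (lo k v) +ℤ b *ℤ N Q x y k (lo k u) (lo k v)) (δ-off neq))
    (lem (Q (hi k u) (hi k v)) (P Q x y k (lo k u) (lo k v)) (N Q x y k (lo k u) (lo k v)))
    where
    lem : ∀ q a b → q *ℤ a +ℤ 0ℤ *ℤ b ≡ q *ℤ a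
    lem = solve-∀

  parity : ∀ k → (alternate k 1ℤ 0ℤ ≡ 1ℤ × alternate k 0ℤ 1ℤ ≡ 0ℤ) ⊎
                 (alternate k 1ℤ 0ℤ ≡ 0ℤ × alternate k 0ℤ 1ℤ ≡ 1ℤ)
  parity zero = inj₁ (refl , refl)
  parity (suc k) with parity k
  ... | inj₁ (a , b) = inj₂ (b , a)
  ... | inj₂ (a , b) = inj₁ (b , a)

  -- Per pair of indices, [[P 1 0, P 0 1], [N 1 0, N 0 1]] is a product of factors
  -- [[0, 1], [1, 0]] (equal digits) and [[±1, 0], [1, 0]] (distinct digits).
  cell : ∀ k u v → Cell k u v
  cell zero zero zero = onDiagonal refl refl refl refl refl
  cell (suc k) u v with hi k u ≟ᶠ hi k v
  ... | yes eq = extend (cell k (lo k u) (lo k v))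
    where
    p : ∀ x y {a} → N Q x y k (lo k u) (lo k v) ≡ a → P Q x y (suc k) u v ≡ a
    p x y = trans (P-entry-diag x y k u v eq)
    w : ∀ x y {a} → P Q x y k (lo k u) (lo k v) ≡ a → N Q x y (suc k) u v ≡ a
    w x y = trans (N-entry x y k u v)
    p± : ∀ x y → IsSign (N Q x y k (lo k u) (lo k v)) → IsSign (P Q x y (suc k) u v)
    p± x y = subst IsSign (sym (P-entry-diag x y k u v eq))
    w± : ∀ x y → IsSign (P Q x y k (lo k u) (lo k v)) → IsSign (N Q x y (suc k) u v)
    w± x y = subst IsSign (sym (N-entry x y k u v))
    extend : Cell k (lo k u) (lo k v) → Cell (suc k) u v
    extend (onDiagonal r≡s a b c d) = onDiagonal (remQuot-injective n (n ^ k) (cong₂ _,_ eq r≡s))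
      (p 1ℤ 0ℤ c) (p 0ℤ 1ℤ d) (w 1ℤ 0ℤ a) (w 0ℤ 1ℤ b)
    extend (column₁ a b c d) = column₁ (p± 1ℤ 0ℤ c) (p 0ℤ 1ℤ d) (w± 1ℤ 0ℤ a) (w 0ℤ 1ℤ b)
    extend (column₂ a b c d) = column₂ (p 1ℤ 0ℤ c) (p± 0ℤ 1ℤ d) (w 1ℤ 0ℤ a) (w± 0ℤ 1ℤ b)
  ... | no neq = extend (cell k (lo k u) (lo k v))
    where
    q = Q (hi k u) (hi k v)
    zeroes : ∀ x y → P Q x y k (lo k u) (lo k v) ≡ 0ℤ →
             P Q x y (suc k) u v ≡ 0ℤ × N Q x y (suc k) u v ≡ 0ℤ
    zeroes x y z = trans (P-entry-off x y k u v neq) (trans (cong (q *ℤ_) z) (ℤP.*-zeroʳ q)) ,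
                   trans (N-entry x y k u v) z
    signs : ∀ x y → IsSign (P Q x y k (lo k u) (lo k v)) →
            IsSign (P Q x y (suc k) u v) × IsSign (N Q x y (suc k) u v)
    signs x y z = subst IsSign (sym (P-entry-off x y k u v neq)) (IsSign-* (offDiag neq) z) ,
                  subst IsSign (sym (N-entry x y k u v)) z
    col₁ : IsSign (P Q 1ℤ 0ℤ k (lo k u) (lo k v)) → P Q 0ℤ 1ℤ k (lo k u) (lo k v) ≡ 0ℤ → Cell (suc k) u v
    col₁ a b = column₁ (proj₁ (signs 1ℤ 0ℤ a)) (proj₁ (zeroes 0ℤ 1ℤ b))
                       (proj₂ (signs 1ℤ 0ℤ a)) (proj₂ (zeroes 0ℤ 1ℤ b))
    col₂ : P Q 1ℤ 0ℤ k (lo k u) (lo k v) ≡ 0ℤ → IsSign (P Q 0ℤ 1ℤ k (lo k u) (lo k v)) → Cell (suc k) u v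
    col₂ a b = column₂ (proj₁ (zeroes 1ℤ 0ℤ a)) (proj₁ (signs 0ℤ 1ℤ b))
                       (proj₂ (zeroes 1ℤ 0ℤ a)) (proj₂ (signs 0ℤ 1ℤ b))
    extend : Cell k (lo k u) (lo k v) → Cell (suc k) u v
    extend (column₁ a b c d) = col₁ a b
    extend (column₂ a b c d) = col₂ a b
    -- The lowest differing digit copies the `P` row of a permutation matrix into both rows; the
    -- parity of the number of equal digits below it decides which column survives.
    extend (onDiagonal _ a b _ _) with parity k
    ... | inj₁ (a′ , b′) = col₁ (inj₁ (trans a a′)) (trans b b′)
    ... | inj₂ (a′ , b′) = col₂ (trans a a′) (inj₁ (trans b b′))

  mutual
    -- Q and I have complementary supports, so only one of the two summands of `P` is nonzero at
    -- each position.
    P-sign : ∀ k u v → IsSign (P Q 1ℤ 1ℤ k u v)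
    P-sign zero    u v = inj₁ refl
    P-sign (suc k) u v = split (hi k u ≟ᶠ hi k v)
      where
      split : Dec (hi k u ≡ hi k v) → IsSign (P Q 1ℤ 1ℤ (suc k) u v)
      split (yes eq) = subst IsSign (sym (P-entry-diag 1ℤ 1ℤ k u v eq)) (N-sign k (lo k u) (lo k v))
      split (no neq) = subst IsSign (sym (P-entry-off 1ℤ 1ℤ k u v neq))
                         (IsSign-* (offDiag neq) (P-sign k (lo k u) (lo k v)))

    N-sign : ∀ k u v → IsSign (N Q 1ℤ 1ℤ k u v)
    N-sign zero    u v = inj₁ refl
    N-sign (suc k) u v = subst IsSign (sym (N-entry 1ℤ 1ℤ k u v)) (P-sign k (lo k u) (lo k v))

-- The trace of the k-th tensor power of [[Q, I], [J, 0]].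
power : ∀ {n} → Matrix ℤ n n → ∀ k → Matrix ℤ (n ^ k) (n ^ k)
power Q k = P Q 1ℤ 0ℤ k +ᴹ N Q 0ℤ 1ℤ k

module _ {n} {Q : Matrix ℤ n n} (c : IsCore n Q) {k} (o : Odd k) where
  open Words c

  private
    A = P Q 1ℤ 0ℤ k
    B = N Q 0ℤ 1ℤ k

    power-skew : ∀ u v → power Q k v u ≡ ℤ.- power Q k u v
    power-skew u v = trans
      (cong₂ _+ℤ_ (P-transpose 1ℤ refl refl k u v) (N-transpose -1ℤ refl refl k u v))
      (trans (cong (λ g → 1ℤ *ℤ g *ℤ A u v +ℤ ℤ.- (-1ℤ *ℤ g *ℤ B u v)) (-1^odd o)) (lem (A u v) (B u v)))
      where
      lem : ∀ a b → 1ℤ *ℤ -1ℤ *ℤ a +ℤ ℤ.- (-1ℤ *ℤ -1ℤ *ℤ b) ≡ ℤ.- (a +ℤ b)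
      lem = solve-∀

    power-off : ∀ {u v} → u ≢ v → IsSign (power Q k u v)
    power-off {u} {v} u≢v with cell k u v
    ... | onDiagonal u≡v _ _ _ _ = contradiction u≡v u≢v
    ... | column₁ a _ _ d = subst IsSign (sym (trans (cong (A u v +ℤ_) d) (ℤP.+-identityʳ (A u v)))) a
    ... | column₂ a _ _ d = subst IsSign (sym (trans (cong (_+ℤ B u v) a) (ℤP.+-identityˡ (B u v)))) d

    power-rowSum : ∀ u → rowSum (power Q k) u ≡ 0ℤ
    power-rowSum u = trans (∑-distrib-+ (A u) (B u))
      (cong₂ _+ℤ_ (trans (rowSum-P 1ℤ 0ℤ k u) (ρ-vanishes o 1ℤ))
                  (trans (rowSum-N 0ℤ 1ℤ k u) (σ-vanishes o 1ℤ)))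

    -- For odd `k` the cross terms vanish. With A Aᵀ = n Y - J from `gram-difference`, what remains
    -- is n Y + B Bᵀ, which is the total for the single column (0, 1).
    power-gram : ∀ u v → gram (power Q k) (power Q k) u v ≡ + (n ^ k) *ℤ I (n ^ k) u v ℤ.- 1ℤ
    power-gram u v = begin
      gram (A +ᴹ B) (A +ᴹ B) u v
        ≡⟨ gram-+ˡ A B (A +ᴹ B) u v ⟩
      gram A (A +ᴹ B) u v +ℤ gram B (A +ᴹ B) u v
        ≡⟨ cong₂ _+ℤ_ (gram-+ʳ A A B u v) (gram-+ʳ B A B u v) ⟩
      gram A A u v +ℤ gram A B u v +ℤ (gram B A u v +ℤ gram B B u v)
        ≡⟨ cong₂ (λ a b → a +ℤ (b +ℤ gram B B u v))
             (cong₂ _+ℤ_ (trans (gram-difference k u v) (cong (+ n *ℤ Y +ℤ_) (-1^odd o)))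
               (trans (gram-PN 1ℤ 0ℤ 0ℤ 1ℤ k u v) (alternate-odd o 1ℤ 0ℤ)))
             (trans (gram-NP 0ℤ 1ℤ 1ℤ 0ℤ k u v) (alternate-odd o 1ℤ 0ℤ)) ⟩
      + n *ℤ Y +ℤ -1ℤ +ℤ 0ℤ +ℤ (0ℤ +ℤ gram B B u v)
        ≡⟨ lem₁ (+ n *ℤ Y) (gram B B u v) ⟩
      + n *ℤ Y +ℤ gram B B u v ℤ.- 1ℤ
        ≡⟨ cong (ℤ._- 1ℤ) (gram-total 0ℤ 1ℤ k u v) ⟩
      + (n ^ k) *ℤ (+ n *ℤ 0ℤ +ℤ 1ℤ) *ℤ I (n ^ k) u v ℤ.- 1ℤ
        ≡⟨ lem₂ (+ n) (+ (n ^ k)) (I (n ^ k) u v) ⟩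
      + (n ^ k) *ℤ I (n ^ k) u v ℤ.- 1ℤ ∎
      where
      open ≡-Reasoning
      Y = gram (P Q 0ℤ 1ℤ k) (P Q 0ℤ 1ℤ k) u v
      lem₁ : ∀ y b → y +ℤ -1ℤ +ℤ 0ℤ +ℤ (0ℤ +ℤ b) ≡ y +ℤ b ℤ.- 1ℤ
      lem₁ = solve-∀
      lem₂ : ∀ n m d → m *ℤ (n *ℤ 0ℤ +ℤ 1ℤ) *ℤ d ℤ.- 1ℤ ≡ m *ℤ d ℤ.- 1ℤ
      lem₂ = solve-∀

  power-core : IsCore (n ^ k) (power Q k)
  power-core = record
    { diagonal = λ u → self-neg⇒0 (power-skew u u) ; offDiag = power-off ; skew = power-skew
    ; rowSum-0 = power-rowSum ; gram-Q = power-gram }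

-- Complex matrices built from a core

module ℝR = CommutativeRing ℝ-commutativeRing

/1-+ : ∀ a b → (a +ℤ b) ℚ./ 1 ≡ a ℚ./ 1 ℚ.+ b ℚ./ 1
/1-+ a b = trans
  (ℚP.fromℚᵘ-cong {mkℚᵘ (a +ℤ b) 0} {mkℚᵘ a 0 ℚᵘ.+ mkℚᵘ b 0} (ℚᵘ.*≡* (lem a b)))
  (RationalEstimates./ᵘ-+ (mkℚᵘ a 0) (mkℚᵘ b 0))
  where
  lem : ∀ a b → (a +ℤ b) *ℤ 1ℤ ≡ (a *ℤ 1ℤ +ℤ b *ℤ 1ℤ) *ℤ 1ℤ
  lem = solve-∀

/ᵘ-* : ∀ p q → ℚ.fromℚᵘ (p ℚᵘ.* q) ≡ ℚ.fromℚᵘ p ℚ.* ℚ.fromℚᵘ q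
/ᵘ-* p q = ℚP.toℚᵘ-injective (ℚᵘP.≃-trans (ℚP.toℚᵘ-fromℚᵘ (p ℚᵘ.* q))
  (ℚᵘP.≃-trans (ℚᵘP.*-cong (ℚᵘP.≃-sym (ℚP.toℚᵘ-fromℚᵘ p)) (ℚᵘP.≃-sym (ℚP.toℚᵘ-fromℚᵘ q)))
    (ℚᵘP.≃-sym (ℚP.toℚᵘ-homo-* (ℚ.fromℚᵘ p) (ℚ.fromℚᵘ q)))))

/1-* : ∀ a b → (a *ℤ b) ℚ./ 1 ≡ (a ℚ./ 1) ℚ.* (b ℚ./ 1)
/1-* a b = trans
  (ℚP.fromℚᵘ-cong {mkℚᵘ (a *ℤ b) 0} {mkℚᵘ a 0 ℚᵘ.* mkℚᵘ b 0} (ℚᵘ.*≡* refl))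
  (/ᵘ-* (mkℚᵘ a 0) (mkℚᵘ b 0))

fromℤ-+ : ∀ a b → fromℤ (a +ℤ b) ≈ fromℤ a + fromℤ b
fromℤ-+ a b = pointwise λ _ → /1-+ a b

fromℤ-* : ∀ a b → fromℤ (a *ℤ b) ≈ fromℤ a * fromℤ b
fromℤ-* a b = pointwise λ _ → /1-* a b

fromℤ-neg : ∀ a → fromℤ (ℤ.- a) ≈ - fromℤ a
fromℤ-neg a = AbelianGroupProperties.inverseˡ-unique ℝR.+-abelianGroup (fromℤ (ℤ.- a)) (fromℤ a)
  (≈-trans (≈-sym (fromℤ-+ (ℤ.- a) a)) (ℝR.reflexive (cong fromℤ (ℤP.+-inverseˡ a))))

-- Integer coefficients give the ring solver a coefficient test that decides, which equality of
-- Cauchy reals does not.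
ℤ⟶ℝ : ℤ.+-*-rawRing -Raw-AlmostCommutative⟶ fromCommutativeRing ℝ-commutativeRing
ℤ⟶ℝ = record
  { ⟦_⟧ = fromℤ ; +-homo = fromℤ-+ ; *-homo = fromℤ-* ; -‿homo = fromℤ-neg
  ; 0-homo = ≈-refl ; 1-homo = ≈-refl }

coeff≟ : ∀ a b → Maybe (fromℤ a ≈ fromℤ b)
coeff≟ a b with a ℤP.≟ b
... | yes refl = just ≈-refl
... | no  _    = nothing

module ℝS = RingSolver ℤ.+-*-rawRing (fromCommutativeRing ℝ-commutativeRing) ℤ⟶ℝ coeff≟
open ℝS using (con; _:+_; _:*_; :-_; _:=_)

open RawMonoidDefs (RawRing.+-rawMonoid ℂ-rawRing) using () renaming (sum to sumᶜ)

-- All real parts summed below are integer multiples of one fixed real, so complex sums reduce to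
-- the integer sums already computed.
sum-re : ∀ {n} c (f : Fin n → ℂ) (g : Fin n → ℤ) → (∀ i → ℂ.re (f i) ≈ c * fromℤ (g i)) →
         ℂ.re (sumᶜ f) ≈ c * fromℤ (sum g)
sum-re {zero}  c f g h = ≈-sym (ℝR.zeroʳ c)
sum-re {suc n} c f g h = ≈-trans (ℝR.+-cong (h zero) (sum-re c (f ∘ suc) (g ∘ suc) (h ∘ suc)))
  (≈-sym (≈-trans (ℝR.*-congˡ (fromℤ-+ (g zero) (sum (g ∘ suc)))) (ℝR.distribˡ c _ _)))

sum-im : ∀ {n} c (f : Fin n → ℂ) (g : Fin n → ℤ) → (∀ i → ℂ.im (f i) ≈ c * fromℤ (g i)) →
         ℂ.im (sumᶜ f) ≈ c * fromℤ (sum g)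
sum-im {zero}  c f g h = ≈-sym (ℝR.zeroʳ c)
sum-im {suc n} c f g h = ≈-trans (ℝR.+-cong (h zero) (sum-im c (f ∘ suc) (g ∘ suc) (h ∘ suc)))
  (≈-sym (≈-trans (ℝR.*-congˡ (fromℤ-+ (g zero) (sum (g ∘ suc)))) (ℝR.distribˡ c _ _)))

fromℚ-nonneg : ∀ {p} → 0ℚ ℚ.≤ p → NonNegative (fromℚ p)
fromℚ-nonneg p≥0 ε ε>0 = 0 , λ _ _ → ℚP.+-mono-≤-< p≥0 ε>0

Positive-+ : ∀ {x y} → Positive x → Positive y → Positive (x + y)
Positive-+ (ε , ε>0 , N , f) (δ , δ>0 , M , g) =
  ε ℚ.+ δ , RationalEstimates.+-pos ε>0 δ>0 , N ℕ.⊔ M , λ n le →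
    ℚP.+-mono-< (f n (ℕP.m⊔n≤o⇒m≤o N M le)) (g n (ℕP.m⊔n≤o⇒n≤o N M le))

-- The root is a limit of approximations, so this is not a computation. From s² = 1 comes s (s + 1)
-- = s + 1, and the positive factor s + 1 can be cancelled.
√1≈1 : √ fromℕ 1 ≈ fromℕ 1
√1≈1 = begin
  s                               ≈⟨ ℝR.*-identityʳ s ⟨
  s * fromℕ 1                     ≈⟨ ℝR.*-congˡ (recip-inverse t t>0) ⟨
  s * (t * recip t t>0)           ≈⟨ ℝS.solve 2 (λ s r → s :* ((s :+ con 1ℤ) :* r) := (s :* s :+ s) :* r) ≈-refl s (recip t t>0) ⟩
  (s * s + s) * recip t t>0       ≈⟨ ℝR.*-congʳ (ℝR.+-congʳ (√-square (fromℕ 1) (fromℚ-nonneg (RationalEstimates./-nonneg 1 0)))) ⟩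
  (fromℕ 1 + s) * recip t t>0     ≈⟨ ℝR.*-congʳ (ℝR.+-comm (fromℕ 1) s) ⟩
  t * recip t t>0                 ≈⟨ recip-inverse t t>0 ⟩
  fromℕ 1                         ∎
  where
  open SetoidReasoning ℝR.setoid
  s = √ fromℕ 1
  t = s + fromℕ 1
  t>0 : Positive t
  t>0 = Positive-+ {s} {fromℕ 1} (√-positive (fromℕ 1) (suc-positive 0)) (suc-positive 0)

α-square : ∀ q → α q * α q * fromℕ (suc q) ≈ fromℕ 1
α-square q = begin
  r * r * fromℕ (suc q)   ≈⟨ ℝR.*-congˡ (√-square (fromℕ (suc q)) (fromℚ-nonneg (RationalEstimates./-nonneg (suc q) 0))) ⟨
  r * r * (s * s)         ≈⟨ ℝS.solve 2 (λ r s → r :* r :* (s :* s) := (s :* r) :* (s :* r)) ≈-refl r s ⟩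
  (s * r) * (s * r)       ≈⟨ ℝR.*-cong sr sr ⟩
  fromℕ 1 * fromℕ 1       ≈⟨ ℝR.*-identityˡ (fromℕ 1) ⟩
  fromℕ 1                 ∎
  where
  open SetoidReasoning ℝR.setoid
  r = α q
  s = √ fromℕ (suc q)
  sr : s * r ≈ fromℕ 1
  sr = recip-inverse s (√-positive (fromℕ (suc q)) (suc-positive q))

-- This turns the weights α² and β² into the integer weights 1 and q of `gram-total` and `ρσ-norm`.
β-square : ∀ q → β q * β q ≈ fromℕ q * (α q * α q)
β-square q = begin
  β q * β q                              ≈⟨ √-square x (fromℚ-nonneg (RationalEstimates./-nonneg q q)) ⟩
  x                                      ≈⟨ ℝR.*-identityʳ x ⟨
  x * fromℕ 1                            ≈⟨ ℝR.*-congˡ (α-square q) ⟨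
  x * (α q * α q * fromℕ (suc q))        ≈⟨ ℝS.solve 3 (λ x u s → x :* (u :* s) := x :* s :* u) ≈-refl x (α q * α q) (fromℕ (suc q)) ⟩
  x * fromℕ (suc q) * (α q * α q)        ≈⟨ ℝR.*-congʳ (pointwise λ _ → cancel) ⟩
  fromℕ q * (α q * α q)                  ∎
  where
  open SetoidReasoning ℝR.setoid
  x = fromℚ (+ q ℚ./ suc q)
  cancel : + q ℚ./ suc q ℚ.* (+ suc q ℚ./ 1) ≡ + q ℚ./ 1
  cancel = trans (sym (/ᵘ-* (mkℚᵘ (+ q) q) (mkℚᵘ (+ suc q) 0)))
    (ℚP.fromℚᵘ-cong {mkℚᵘ (+ q) q ℚᵘ.* mkℚᵘ (+ suc q) 0} {mkℚᵘ (+ q) 0}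
      (ℚᵘ.*≡* (trans (lem (+ q) (+ suc q)) (cong (+ q *ℤ_) (cong +_ (sym (ℕP.*-identityʳ (suc q))))))))
    where
    lem : ∀ a b → a *ℤ b *ℤ 1ℤ ≡ a *ℤ b
    lem = solve-∀

norm² : ∀ q (s r : ℤ) M → + q *ℤ (r *ℤ r) +ℤ s *ℤ s ≡ M *ℤ + suc q →
        (α q * fromℤ s) * (α q * fromℤ s) + (β q * fromℤ r) * (β q * fromℤ r) ≈ fromℤ M
norm² q s r M h = begin
  (a * S) * (a * S) + (b * R) * (b * R)
    ≈⟨ ℝS.solve 4 (λ a S b R → (a :* S) :* (a :* S) :+ (b :* R) :* (b :* R) :=
                     a :* a :* (S :* S) :+ (b :* b) :* (R :* R)) ≈-refl a S b R ⟩
  a * a * (S * S) + (b * b) * (R * R)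
    ≈⟨ ℝR.+-congˡ (ℝR.*-congʳ (β-square q)) ⟩
  a * a * (S * S) + fromℕ q * (a * a) * (R * R)
    ≈⟨ ℝS.solve 4 (λ u S Q R → u :* (S :* S) :+ Q :* u :* (R :* R) := u :* (Q :* (R :* R) :+ S :* S))
         ≈-refl (a * a) S (fromℕ q) R ⟩
  a * a * (fromℕ q * (R * R) + S * S)
    ≈⟨ ℝR.*-congˡ (ℝR.+-cong (ℝR.*-congˡ (fromℤ-* r r)) (fromℤ-* s s)) ⟨
  a * a * (fromℕ q * fromℤ (r *ℤ r) + fromℤ (s *ℤ s))
    ≈⟨ ℝR.*-congˡ (≈-trans (fromℤ-+ (+ q *ℤ (r *ℤ r)) (s *ℤ s)) (ℝR.+-congʳ (fromℤ-* (+ q) (r *ℤ r)))) ⟨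
  a * a * fromℤ (+ q *ℤ (r *ℤ r) +ℤ s *ℤ s)
    ≈⟨ ℝR.*-congˡ (≈-trans (ℝR.reflexive (cong fromℤ h)) (fromℤ-* M (+ suc q))) ⟩
  a * a * (fromℤ M * fromℕ (suc q))
    ≈⟨ ℝS.solve 3 (λ u M s → u :* (M :* s) := M :* (u :* s)) ≈-refl (a * a) (fromℤ M) (fromℕ (suc q)) ⟩
  fromℤ M * (a * a * fromℕ (suc q))
    ≈⟨ ≈-trans (ℝR.*-congˡ (α-square q)) (ℝR.*-identityʳ (fromℤ M)) ⟩
  fromℤ M ∎
  where
  open SetoidReasoning ℝR.setoid
  a = α q
  b = β q
  S = fromℤ s
  R = fromℤ r

-- Needed for entries with `M` = 1, for row sums with `M` = qᵐ and for the excess with `M` = q³ᵐ.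
modulus-αβ : ∀ q z (s r : ℤ) M → ℂ.re z ≈ α q * fromℤ s → ℂ.im z ≈ β q * fromℤ r →
             + q *ℤ (r *ℤ r) +ℤ s *ℤ s ≡ M *ℤ + suc q → modulus z ≈ √ fromℤ M
modulus-αβ q z s r M hs hr h = √-cong (≈-trans (ℝR.+-cong (ℝR.*-cong hs hs) (ℝR.*-cong hr hr)) (norm² q s r M h))

-- The matrix built from a core is a regular QUH matrix

mutual
  𝒜≡P : ∀ {q} (Q : Matrix ℤ q q) m i j → 𝒜 Q m i j ≡ P Q 1ℤ 1ℤ m i j
  𝒜≡P Q zero    i j = refl
  𝒜≡P {q} Q (suc m) i j = trans (ℤP.+-comm ((I q ⊗ 𝒥 Q m) i j) ((Q ⊗ 𝒜 Q m) i j))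
    (cong₂ (λ a b → Q (hi i) (hi j) *ℤ a +ℤ I q (hi i) (hi j) *ℤ b)
      (𝒜≡P Q m (lo i) (lo j)) (𝒥≡N Q m (lo i) (lo j)))
    where
    hi : Fin (q ^ suc m) → Fin q
    hi x = proj₁ (remQuot {q} (q ^ m) x)
    lo : Fin (q ^ suc m) → Fin (q ^ m)
    lo x = proj₂ (remQuot {q} (q ^ m) x)

  𝒥≡N : ∀ {q} (Q : Matrix ℤ q q) m i j → 𝒥 Q m i j ≡ N Q 1ℤ 1ℤ m i j
  𝒥≡N Q zero    i j = refl
  𝒥≡N Q (suc m) i j = cong (1ℤ *ℤ_) (𝒜≡P Q m _ _)

hadamardFromCore-re : ∀ {q} (Q : Matrix ℤ q q) m i j →
                      ℂ.re (hadamardFromCore Q m i j) ≈ α q * fromℤ (N Q 1ℤ 1ℤ m i j)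
hadamardFromCore-re {q} Q m i j = ≈-trans
  (ℝS.solve 4 (λ a b s r →
      (a :* s :+ :- (con 0ℤ :* con 0ℤ)) :+
      ((con 0ℤ :* b :+ :- (con 1ℤ :* con 0ℤ)) :* r :+ :- ((con 0ℤ :* con 0ℤ :+ con 1ℤ :* b) :* con 0ℤ)) :=
      a :* s) ≈-refl (α q) (β q) (fromℤ (𝒥 Q m i j)) (fromℤ (𝒜 Q m i j)))
  (ℝR.*-congˡ (ℝR.reflexive (cong fromℤ (𝒥≡N Q m i j))))

hadamardFromCore-im : ∀ {q} (Q : Matrix ℤ q q) m i j →
                      ℂ.im (hadamardFromCore Q m i j) ≈ β q * fromℤ (P Q 1ℤ 1ℤ m i j)
hadamardFromCore-im {q} Q m i j = ≈-trans
  (ℝS.solve 4 (λ a b s r →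
      (a :* con 0ℤ :+ con 0ℤ :* s) :+
      ((con 0ℤ :* b :+ :- (con 1ℤ :* con 0ℤ)) :* con 0ℤ :+ (con 0ℤ :* con 0ℤ :+ con 1ℤ :* b) :* r) :=
      b :* r) ≈-refl (α q) (β q) (fromℤ (𝒥 Q m i j)) (fromℤ (𝒜 Q m i j)))
  (ℝR.*-congˡ (ℝR.reflexive (cong fromℤ (𝒜≡P Q m i j))))

δᶜ-re : ∀ {n} (i j : Fin n) → ℂ.re (ℂᴹ.I n i j) ≈ fromℤ (I n i j)
δᶜ-re i j with i ≟ᶠ j
... | yes _ = ≈-refl
... | no  _ = ≈-refl

δᶜ-im : ∀ {n} (i j : Fin n) → ℂ.im (ℂᴹ.I n i j) ≈ fromℕ 0
δᶜ-im i j with i ≟ᶠ j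
... | yes _ = ≈-refl
... | no  _ = ≈-refl

module _ {q} {Q : Matrix ℤ q q} (c : IsCore q Q) (m : ℕ) where
  open Words c
  private
    H = hadamardFromCore Q m
    A = P Q 1ℤ 1ℤ m
    B = N Q 1ℤ 1ℤ m
    a = α q
    b = β q
    u = a * a

    total : ∀ i j → + q *ℤ gram A A i j +ℤ gram B B i j ≡ + (q ^ m) *ℤ + suc q *ℤ I (q ^ m) i j
    total i j = trans (gram-total 1ℤ 1ℤ m i j)
      (cong (λ z → + (q ^ m) *ℤ z *ℤ I (q ^ m) i j)
        (trans (ℤP.+-comm (+ q *ℤ 1ℤ) 1ℤ) (cong (1ℤ +ℤ_) (ℤP.*-identityʳ (+ q)))))

  unit-entries : ∀ i j → modulus (H i j) ≈ fromℕ 1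
  unit-entries i j = ≈-trans
    (modulus-αβ q (H i j) (B i j) (A i j) 1ℤ (hadamardFromCore-re Q m i j) (hadamardFromCore-im Q m i j)
      (trans (cong₂ (λ x y → + q *ℤ x +ℤ y) (IsSign⇒square (P-sign m i j)) (IsSign⇒square (N-sign m i j)))
        (lem (+ q))))
    √1≈1
    where
    lem : ∀ q → q *ℤ 1ℤ +ℤ 1ℤ ≡ 1ℤ *ℤ (1ℤ +ℤ q)
    lem = solve-∀

  private
    product-re : ∀ i j k → ℂ.re (H i k *ᶜ conj (H j k)) ≈
                 u * fromℤ (+ q *ℤ (A i k *ℤ A j k) +ℤ 1ℤ *ℤ (B i k *ℤ B j k))
    product-re i j k = begin
      ℂ.re (H i k) * ℂ.re (H j k) + - (ℂ.im (H i k) * - ℂ.im (H j k))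
        ≈⟨ ℝR.+-cong (ℝR.*-cong (hadamardFromCore-re Q m i k) (hadamardFromCore-re Q m j k))
             (ℝR.-‿cong (ℝR.*-cong (hadamardFromCore-im Q m i k) (ℝR.-‿cong (hadamardFromCore-im Q m j k)))) ⟩
      (a * s) * (a * s′) + - ((b * r) * - (b * r′))
        ≈⟨ ℝS.solve 6 (λ a b s s′ r r′ → (a :* s) :* (a :* s′) :+ :- ((b :* r) :* :- (b :* r′)) :=
             a :* a :* (s :* s′) :+ b :* b :* (r :* r′)) ≈-refl a b s s′ r r′ ⟩
      u * (s * s′) + b * b * (r * r′)
        ≈⟨ ℝR.+-congˡ (ℝR.*-congʳ (β-square q)) ⟩
      u * (s * s′) + fromℕ q * u * (r * r′)
        ≈⟨ ℝS.solve 4 (λ u S Q R → u :* S :+ Q :* u :* R := u :* (Q :* R :+ con 1ℤ :* S))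
             ≈-refl u (s * s′) (fromℕ q) (r * r′) ⟩
      u * (fromℕ q * (r * r′) + fromℕ 1 * (s * s′))
        ≈⟨ ℝR.*-congˡ (ℝR.+-cong (ℝR.*-congˡ (fromℤ-* (A i k) (A j k))) (ℝR.*-congˡ (fromℤ-* (B i k) (B j k)))) ⟨
      u * (fromℕ q * fromℤ (A i k *ℤ A j k) + fromℕ 1 * fromℤ (B i k *ℤ B j k))
        ≈⟨ ℝR.*-congˡ (≈-trans (fromℤ-+ (+ q *ℤ (A i k *ℤ A j k)) (1ℤ *ℤ (B i k *ℤ B j k)))
             (ℝR.+-cong (fromℤ-* (+ q) (A i k *ℤ A j k)) (fromℤ-* 1ℤ (B i k *ℤ B j k)))) ⟨
      u * fromℤ (+ q *ℤ (A i k *ℤ A j k) +ℤ 1ℤ *ℤ (B i k *ℤ B j k)) ∎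
      where
      open SetoidReasoning ℝR.setoid
      s = fromℤ (B i k)
      s′ = fromℤ (B j k)
      r = fromℤ (A i k)
      r′ = fromℤ (A j k)

    product-im : ∀ i j k → ℂ.im (H i k *ᶜ conj (H j k)) ≈
                 (a * b) * fromℤ (1ℤ *ℤ (A i k *ℤ B j k) +ℤ -1ℤ *ℤ (B i k *ℤ A j k))
    product-im i j k = begin
      ℂ.re (H i k) * - ℂ.im (H j k) + ℂ.im (H i k) * ℂ.re (H j k)
        ≈⟨ ℝR.+-cong
             (ℝR.*-cong (hadamardFromCore-re Q m i k) (ℝR.-‿cong (hadamardFromCore-im Q m j k)))
             (ℝR.*-cong (hadamardFromCore-im Q m i k) (hadamardFromCore-re Q m j k)) ⟩
      (a * s) * - (b * r′) + (b * r) * (a * s′)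
        ≈⟨ ℝS.solve 6 (λ a b s s′ r r′ → (a :* s) :* :- (b :* r′) :+ (b :* r) :* (a :* s′) :=
             (a :* b) :* (con 1ℤ :* (r :* s′) :+ con -1ℤ :* (s :* r′))) ≈-refl a b s s′ r r′ ⟩
      (a * b) * (fromℕ 1 * (r * s′) + fromℤ -1ℤ * (s * r′))
        ≈⟨ ℝR.*-congˡ (ℝR.+-cong (ℝR.*-congˡ (fromℤ-* (A i k) (B j k))) (ℝR.*-congˡ (fromℤ-* (B i k) (A j k)))) ⟨
      (a * b) * (fromℕ 1 * fromℤ (A i k *ℤ B j k) + fromℤ -1ℤ * fromℤ (B i k *ℤ A j k))
        ≈⟨ ℝR.*-congˡ (≈-trans (fromℤ-+ (1ℤ *ℤ (A i k *ℤ B j k)) (-1ℤ *ℤ (B i k *ℤ A j k)))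
             (ℝR.+-cong (fromℤ-* 1ℤ (A i k *ℤ B j k)) (fromℤ-* -1ℤ (B i k *ℤ A j k)))) ⟨
      (a * b) * fromℤ (1ℤ *ℤ (A i k *ℤ B j k) +ℤ -1ℤ *ℤ (B i k *ℤ A j k)) ∎
      where
      open SetoidReasoning ℝR.setoid
      s = fromℤ (B i k)
      s′ = fromℤ (B j k)
      r = fromℤ (A i k)
      r′ = fromℤ (A j k)

    product-sum-re : ∀ i j → ℂ.re ((H ℂᴹ.*ᴹ map conj (H ᵀ)) i j) ≈ fromℕ (q ^ m) * fromℤ (I (q ^ m) i j)
    product-sum-re i j = begin
      ℂ.re ((H ℂᴹ.*ᴹ map conj (H ᵀ)) i j)
        ≈⟨ sum-re u _ _ (product-re i j) ⟩
      u * fromℤ (sum λ k → + q *ℤ (A i k *ℤ A j k) +ℤ 1ℤ *ℤ (B i k *ℤ B j k))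
        ≈⟨ ℝR.*-congˡ (ℝR.reflexive (cong fromℤ int)) ⟩
      u * fromℤ (M *ℤ D *ℤ + suc q)
        ≈⟨ ℝR.*-congˡ (≈-trans (fromℤ-* (M *ℤ D) (+ suc q)) (ℝR.*-congʳ (fromℤ-* M D))) ⟩
      u * (fromℤ M * fromℤ D * fromℕ (suc q))
        ≈⟨ ℝS.solve 4 (λ u M D S → u :* (M :* D :* S) := (M :* D) :* (u :* S)) ≈-refl u (fromℤ M) (fromℤ D) (fromℕ (suc q)) ⟩
      fromℤ M * fromℤ D * (u * fromℕ (suc q))
        ≈⟨ ≈-trans (ℝR.*-congˡ (α-square q)) (ℝR.*-identityʳ _) ⟩
      fromℤ M * fromℤ D ∎
      where
      open SetoidReasoning ℝR.setoid
      M = + (q ^ m)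
      D = I (q ^ m) i j
      lem : ∀ m s d → m *ℤ s *ℤ d ≡ m *ℤ d *ℤ s
      lem = solve-∀
      int : (sum λ k → + q *ℤ (A i k *ℤ A j k) +ℤ 1ℤ *ℤ (B i k *ℤ B j k)) ≡ M *ℤ D *ℤ + suc q
      int = trans (sum-linear (+ q) 1ℤ (λ k → A i k *ℤ A j k) (λ k → B i k *ℤ B j k))
        (trans (cong (+ q *ℤ gram A A i j +ℤ_) (ℤP.*-identityˡ (gram B B i j)))
          (trans (total i j) (lem M (+ suc q) D)))

    -- The imaginary part is a b (A Bᵀ - B Aᵀ), and the two Gram matrices agree.
    product-sum-im : ∀ i j → ℂ.im ((H ℂᴹ.*ᴹ map conj (H ᵀ)) i j) ≈ fromℕ 0
    product-sum-im i j = ≈-trans (sum-im (a * b) _ _ (product-im i j))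
      (≈-trans (ℝR.*-congˡ (ℝR.reflexive (cong fromℤ int))) (ℝR.zeroʳ (a * b)))
      where
      lem : ∀ x → 1ℤ *ℤ x +ℤ -1ℤ *ℤ x ≡ 0ℤ
      lem = solve-∀
      int : (sum λ k → 1ℤ *ℤ (A i k *ℤ B j k) +ℤ -1ℤ *ℤ (B i k *ℤ A j k)) ≡ 0ℤ
      int = trans (sum-linear 1ℤ -1ℤ (λ k → A i k *ℤ B j k) (λ k → B i k *ℤ A j k))
        (trans (cong (λ z → 1ℤ *ℤ z +ℤ -1ℤ *ℤ gram B A i j) (gram-PN≡NP 1ℤ 1ℤ m i j)) (lem (gram B A i j)))

  isUnitHadamard : IsUnitHadamard (q ^ m) H
  isUnitHadamard = unit-entries , λ i j → mk≈ᶜ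
    (≈-trans (product-sum-re i j) (≈-sym (≈-trans
      (ℝR.+-cong (ℝR.*-congˡ (δᶜ-re i j)) (ℝR.-‿cong (ℝR.*-congˡ (δᶜ-im i j))))
      (ℝS.solve 2 (λ M D → M :* D :+ :- (con 0ℤ :* con 0ℤ) := M :* D) ≈-refl (fromℕ (q ^ m)) (fromℤ (I (q ^ m) i j))))))
    (≈-trans (product-sum-im i j) (≈-sym (≈-trans
      (ℝR.+-cong (ℝR.*-congˡ (δᶜ-im i j)) (ℝR.*-congˡ (δᶜ-re i j)))
      (ℝS.solve 2 (λ M D → M :* con 0ℤ :+ con 0ℤ :* D := con 0ℤ) ≈-refl (fromℕ (q ^ m)) (fromℤ (I (q ^ m) i j))))))

  isQUH : IsQUH (q ^ m) q H
  isQUH = isUnitHadamard , λ i j → B i j , A i j , N-sign m i j , P-sign m i j , mk≈ᶜ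
    (≈-trans (hadamardFromCore-re Q m i j)
      (ℝS.solve 4 (λ a b s r → a :* s :=
          (s :* a :+ :- (con 0ℤ :* con 0ℤ)) :+
          ((r :* con 0ℤ :+ :- (con 0ℤ :* con 1ℤ)) :* b :+ :- ((r :* con 1ℤ :+ con 0ℤ :* con 0ℤ) :* con 0ℤ)))
        ≈-refl a b (fromℤ (B i j)) (fromℤ (A i j))))
    (≈-trans (hadamardFromCore-im Q m i j)
      (ℝS.solve 4 (λ a b s r → b :* r :=
          (s :* con 0ℤ :+ con 0ℤ :* a) :+
          ((r :* con 0ℤ :+ :- (con 0ℤ :* con 1ℤ)) :* con 0ℤ :+ (r :* con 1ℤ :+ con 0ℤ :* con 0ℤ) :* b))
        ≈-refl a b (fromℤ (B i j)) (fromℤ (A i j))))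

  private
    row-re : ∀ i → ℂ.re (ℂᴹ.rowSum H i) ≈ a * fromℤ (rowSum B i)
    row-re i = sum-re a (H i) (B i) (hadamardFromCore-re Q m i)

    row-im : ∀ i → ℂ.im (ℂᴹ.rowSum H i) ≈ b * fromℤ (rowSum A i)
    row-im i = sum-im b (H i) (A i) (hadamardFromCore-im Q m i)

    r = ρ 1ℤ 1ℤ m
    s = σ 1ℤ 1ℤ m

    row-norm : + q *ℤ (r *ℤ r) +ℤ s *ℤ s ≡ + (q ^ m) *ℤ + suc q
    row-norm = trans (ρσ-norm 1ℤ 1ℤ m) (cong (+ (q ^ m) *ℤ_) (lem (+ q)))
      where
      lem : ∀ q → q *ℤ 1ℤ +ℤ 1ℤ ≡ 1ℤ +ℤ q
      lem = solve-∀

  isRegular : IsRegular (q ^ m) H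
  isRegular i = modulus-αβ q (ℂᴹ.rowSum H i) s r (+ (q ^ m))
    (≈-trans (row-re i) (ℝR.*-congˡ (ℝR.reflexive (cong fromℤ (rowSum-N 1ℤ 1ℤ m i)))))
    (≈-trans (row-im i) (ℝR.*-congˡ (ℝR.reflexive (cong fromℤ (rowSum-P 1ℤ 1ℤ m i)))))
    row-norm

  -- All K = qᵐ rows have the same sum, of squared modulus K, so the excess has squared modulus K²
  -- K.
  excess-modulus : modulus (ℂᴹ.excess H) ≈ √ fromℕ (q ^ (3 ℕ.* m))
  excess-modulus = ≈-trans
    (modulus-αβ q (ℂᴹ.excess H) (+ K *ℤ s) (+ K *ℤ r) (+ K *ℤ + K *ℤ + K)
      (≈-trans (sum-re a (ℂᴹ.rowSum H) (rowSum B) row-re)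
        (ℝR.*-congˡ (ℝR.reflexive (cong fromℤ (trans (sum-cong-≗ (rowSum-N 1ℤ 1ℤ m)) (sum-const K s))))))
      (≈-trans (sum-im b (ℂᴹ.rowSum H) (rowSum A) row-im)
        (ℝR.*-congˡ (ℝR.reflexive (cong fromℤ (trans (sum-cong-≗ (rowSum-P 1ℤ 1ℤ m)) (sum-const K r))))))
      (trans (lem₁ (+ q) (+ K) s r) (trans (cong (+ K *ℤ + K *ℤ_) row-norm) (sym (ℤP.*-assoc (+ K *ℤ + K) (+ K) (+ suc q))))))
    (√-cong (ℝR.reflexive (cong fromℤ cube)))
    where
    K = q ^ m
    lem₁ : ∀ q K s r → q *ℤ (K *ℤ r *ℤ (K *ℤ r)) +ℤ K *ℤ s *ℤ (K *ℤ s) ≡ K *ℤ K *ℤ (q *ℤ (r *ℤ r) +ℤ s *ℤ s)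
    lem₁ = solve-∀
    cube : + K *ℤ + K *ℤ + K ≡ + (q ^ (3 ℕ.* m))
    cube = trans (cong (_*ℤ + K) (sym (ℤP.pos-* K K))) (trans (sym (ℤP.pos-* (K ℕ.* K) K)) (cong +_ (sym eq)))
      where
      eq : q ^ (m ℕ.+ (m ℕ.+ (m ℕ.+ 0))) ≡ K ℕ.* K ℕ.* K
      eq = trans (ℕP.^-distribˡ-+-* q m (m ℕ.+ (m ℕ.+ 0)))
        (trans (cong (K ℕ.*_) (ℕP.^-distribˡ-+-* q m (m ℕ.+ 0)))
          (trans (cong (λ z → K ℕ.* (K ℕ.* q ^ z)) (ℕP.+-identityʳ m)) (sym (ℕP.*-assoc K K K))))

-- Multicirculant matrices

-- Every level has exactly `p` blocks per row, so two such matrices share their block pattern and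
-- can be combined entrywise; `Multicirculant` leaves the pattern free.
Circulant : ∀ p k → Matrix ℤ (p ^ k) (p ^ k) → Set
Circulant p zero    M = ⊤
Circulant p (suc k) M = Σ[ A ∈ (Fin p → Matrix ℤ (p ^ k) (p ^ k)) ]
  (∀ x y → M x y ≡ circ A x y) × (∀ i → Circulant p k (A i))

Circulant-map₂ : ∀ {p} k (f : ℤ → ℤ → ℤ) {M N : Matrix ℤ (p ^ k) (p ^ k)} →
                 Circulant p k M → Circulant p k N → Circulant p k (λ i j → f (M i j) (N i j))
Circulant-map₂ zero    f _ _ = tt
Circulant-map₂ (suc k) f (A , a , c) (B , b , d) =
  (λ i r s → f (A i r s) (B i r s)) , (λ x y → cong₂ f (a x y) (b x y)) ,
  λ i → Circulant-map₂ k f (c i) (d i)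

Circulant-⊗ : ∀ {p} k {T : Matrix ℤ p p} {t : Fin p → ℤ} {M : Matrix ℤ (p ^ k) (p ^ k)} →
              (∀ i j → T i j ≡ t (offset i j)) → Circulant p k M → Circulant p (suc k) (T ⊗ M)
Circulant-⊗ {p} k {T} {t} {M} e c = (λ i r s → t i *ℤ M r s) ,
  (λ x y → cong (_*ℤ M (lo x) (lo y)) (e (hi x) (hi y))) ,
  λ i → Circulant-map₂ k (λ a _ → t i *ℤ a) c c
  where
  hi : Fin (p ^ suc k) → Fin p
  hi x = proj₁ (remQuot {p} (p ^ k) x)
  lo : Fin (p ^ suc k) → Fin (p ^ k)
  lo x = proj₂ (remQuot {p} (p ^ k) x)

-- Through this identity I inherits every circulant structure of Q.
core-identity : ∀ {n} {Q : Matrix ℤ n n} → IsCore n Q → ∀ i j → I n i j ≡ 1ℤ ℤ.- Q i j *ℤ Q i j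
core-identity {n} {Q} c i j with i ≟ᶠ j
... | yes refl = sym (cong (λ z → 1ℤ ℤ.- z *ℤ z) (IsCore.diagonal c i))
... | no  i≢j  = sym (cong (λ z → 1ℤ ℤ.- z) (IsSign⇒square (IsCore.offDiag c i≢j)))

module _ {p} {Q : Matrix ℤ p p} (c : IsCore p Q) {t : Fin p → ℤ} (e : ∀ i j → Q i j ≡ t (offset i j)) where
  private
    δ-circulant : ∀ i j → I p i j ≡ 1ℤ ℤ.- t (offset i j) *ℤ t (offset i j)
    δ-circulant i j = trans (core-identity c i j) (cong (λ z → 1ℤ ℤ.- z *ℤ z) (e i j))

  mutual
    P-circulant : ∀ x y k → Circulant p k (P Q x y k)
    P-circulant x y zero    = tt
    P-circulant x y (suc k) = Circulant-map₂ (suc k) _+ℤ_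
      (Circulant-⊗ k {T = Q} {t} e (P-circulant x y k))
      (Circulant-⊗ k {T = I p} {λ z → 1ℤ ℤ.- t z *ℤ t z} δ-circulant (N-circulant x y k))

    N-circulant : ∀ x y k → Circulant p k (N Q x y k)
    N-circulant x y zero    = tt
    N-circulant x y (suc k) = Circulant-⊗ k {T = J p} {λ _ → 1ℤ} (λ _ _ → refl) (P-circulant x y k)

  power-circulant : ∀ k → Circulant p k (power Q k)
  power-circulant k = Circulant-map₂ k _+ℤ_ (P-circulant 1ℤ 0ℤ k) (N-circulant 0ℤ 1ℤ k)

-- Besides changing the order, it serves with `eq` = `refl` to replace a matrix by a pointwise equal
-- one.
Multicirculant-cast : {M : Matrix ℂ m m} {N : Matrix ℂ n n} (eq : m ≡ n) →
  (∀ i j → M i j ≡ N (cast eq i) (cast eq j)) → ℂᴹ.Multicirculant N → ℂᴹ.Multicirculant M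
Multicirculant-cast {M = M} refl h (ℂᴹ.order-1 N) = ℂᴹ.order-1 M
Multicirculant-cast {M = M} eq h (ℂᴹ.blocks N k b eq′ 2≤k A N≈ mc) =
  ℂᴹ.blocks M k b (trans eq eq′) 2≤k A
    (λ i j → subst₂ _≈ᶜ_ (sym (h i j))
      (cong₂ (circ A) (cast-trans eq eq′ i) (cast-trans eq eq′ j))
      (N≈ (cast eq i) (cast eq j))) mc

≈ᶜ-refl : ∀ {z} → z ≈ᶜ z
≈ᶜ-refl = mk≈ᶜ ≈-refl ≈-refl

-- A generalised Kronecker product: the block may be any function of the entry of `D`, not just a
-- multiple of one matrix.
blockwise : ∀ l b → Matrix ℤ l l → (ℤ → Matrix ℂ b b) → Matrix ℂ (l ℕ.* b) (l ℕ.* b)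
blockwise l b D B x y =
  let (i , r) = remQuot {l} b x
      (j , s) = remQuot {l} b y
  in B (D i j) r s

remQuot-1 : ∀ b (x : Fin (1 ℕ.* b)) → remQuot {1} b x ≡ (zero , cast (ℕP.*-identityˡ b) x)
remQuot-1 b x = cong₂ _,_ (all-zero _) (toℕ-injective (begin
  toℕ (proj₂ (remQuot {1} b x))
    ≡⟨ cong (ℕ._+ toℕ (proj₂ (remQuot {1} b x))) (ℕP.*-zeroʳ b) ⟨
  b ℕ.* 0 ℕ.+ toℕ (proj₂ (remQuot {1} b x))
    ≡⟨ toℕ-combine {1} zero (proj₂ (remQuot {1} b x)) ⟨
  toℕ (combine {1} zero (proj₂ (remQuot {1} b x)))
    ≡⟨ cong (λ i → toℕ (combine {1} i (proj₂ (remQuot {1} b x)))) (all-zero (proj₁ (remQuot {1} b x))) ⟨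
  toℕ (uncurry combine (remQuot {1} b x))
    ≡⟨ cong toℕ (combine-remQuot {1} b x) ⟩
  toℕ x
    ≡⟨ toℕ-cast (ℕP.*-identityˡ b) x ⟨
  toℕ (cast (ℕP.*-identityˡ b) x) ∎))
  where
  open ≡-Reasoning
  all-zero : (i : Fin 1) → i ≡ zero
  all-zero zero = refl

-- Under `toℕ` both ways of splitting are the same mixed radix expansion of `x`.
remQuot-assoc : ∀ p l b (x : Fin (p ℕ.* l ℕ.* b)) →
  let (y , t) = remQuot {p ℕ.* l} b x
      (i , r) = remQuot {p} l y
  in remQuot {p} (l ℕ.* b) (cast (ℕP.*-assoc p l b) x) ≡ (i , combine r t)
remQuot-assoc p l b x = trans (cong (remQuot {p} (l ℕ.* b)) (toℕ-injective (begin
    toℕ (cast (ℕP.*-assoc p l b) x)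
      ≡⟨ toℕ-cast (ℕP.*-assoc p l b) x ⟩
    toℕ x
      ≡⟨ cong toℕ (combine-remQuot {p ℕ.* l} b x) ⟨
    toℕ (combine y t)
      ≡⟨ toℕ-combine y t ⟩
    b ℕ.* toℕ y ℕ.+ toℕ t
      ≡⟨ cong (λ z → b ℕ.* toℕ z ℕ.+ toℕ t) (combine-remQuot {p} l y) ⟨
    b ℕ.* toℕ (combine i r) ℕ.+ toℕ t
      ≡⟨ cong (λ z → b ℕ.* z ℕ.+ toℕ t) (toℕ-combine i r) ⟩
    b ℕ.* (l ℕ.* toℕ i ℕ.+ toℕ r) ℕ.+ toℕ t
      ≡⟨ lem b l (toℕ i) (toℕ r) (toℕ t) ⟩
    l ℕ.* b ℕ.* toℕ i ℕ.+ (b ℕ.* toℕ r ℕ.+ toℕ t)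
      ≡⟨ cong (l ℕ.* b ℕ.* toℕ i ℕ.+_) (toℕ-combine r t) ⟨
    l ℕ.* b ℕ.* toℕ i ℕ.+ toℕ (combine r t)
      ≡⟨ toℕ-combine i (combine r t) ⟨
    toℕ (combine i (combine r t)) ∎)))
  (remQuot-combine i (combine r t))
  where
  open ≡-Reasoning
  y = proj₁ (remQuot {p ℕ.* l} b x)
  t = proj₂ (remQuot {p ℕ.* l} b x)
  i = proj₁ (remQuot {p} l y)
  r = proj₂ (remQuot {p} l y)
  lem : ∀ b l i r t → b ℕ.* (l ℕ.* i ℕ.+ r) ℕ.+ t ≡ l ℕ.* b ℕ.* i ℕ.+ (b ℕ.* r ℕ.+ t)
  lem = ℕSolver.solve-∀

-- The levels of `D` become the outer levels of the result; once they are used up, a single block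
-- `B z` is left.
blockwise-multicirculant : ∀ p k b → 2 ≤ p → (D : Matrix ℤ (p ^ k) (p ^ k)) → Circulant p k D →
  (B : ℤ → Matrix ℂ b b) → (∀ z → ℂᴹ.Multicirculant (B z)) →
  ℂᴹ.Multicirculant (blockwise (p ^ k) b D B)
blockwise-multicirculant p zero b 2≤p D _ B mc = Multicirculant-cast (ℕP.*-identityˡ b)
  (λ x y → cong₂ (λ u v → B (D (proj₁ u) (proj₁ v)) (proj₂ u) (proj₂ v)) (remQuot-1 b x) (remQuot-1 b y))
  (mc (D zero zero))
blockwise-multicirculant p (suc k) b 2≤p D (A , D≡ , circs) B mc =
  ℂᴹ.blocks _ p (p ^ k ℕ.* b) assoc 2≤p A′
    (λ x y → subst (blockwise (p ^ suc k) b D B x y ≈ᶜ_) (entry x y) ≈ᶜ-refl)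
    (λ o → blockwise-multicirculant p k b 2≤p (A o) (circs o) B mc)
  where
  assoc = ℕP.*-assoc p (p ^ k) b
  A′ : Fin p → Matrix ℂ (p ^ k ℕ.* b) (p ^ k ℕ.* b)
  A′ o = blockwise (p ^ k) b (A o) B
  hi : Fin (p ^ suc k ℕ.* b) → Fin (p ^ suc k)
  hi x = proj₁ (remQuot {p ^ suc k} b x)
  lo : Fin (p ^ suc k ℕ.* b) → Fin b
  lo x = proj₂ (remQuot {p ^ suc k} b x)
  top : Fin (p ^ suc k ℕ.* b) → Fin p
  top x = proj₁ (remQuot {p} (p ^ k) (hi x))
  mid : Fin (p ^ suc k ℕ.* b) → Fin (p ^ k)
  mid x = proj₂ (remQuot {p} (p ^ k) (hi x))
  entry : ∀ x y → blockwise (p ^ suc k) b D B x y ≡ circ A′ (cast assoc x) (cast assoc y)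
  entry x y = begin
    B (D (hi x) (hi y)) (lo x) (lo y)
      ≡⟨ cong (λ z → B z (lo x) (lo y)) (D≡ (hi x) (hi y)) ⟩
    B (A (offset (top x) (top y)) (mid x) (mid y)) (lo x) (lo y)
      ≡⟨ cong₂ (λ u v → B (A (offset (top x) (top y)) (proj₁ u) (proj₁ v)) (proj₂ u) (proj₂ v))
           (remQuot-combine (mid x) (lo x)) (remQuot-combine (mid y) (lo y)) ⟨
    A′ (offset (top x) (top y)) (combine (mid x) (lo x)) (combine (mid y) (lo y))
      ≡⟨ cong₂ (λ u v → A′ (offset (proj₁ u) (proj₁ v)) (proj₂ u) (proj₂ v))
           (remQuot-assoc p (p ^ k) b x) (remQuot-assoc p (p ^ k) b y) ⟨
    circ A′ (cast assoc x) (cast assoc y) ∎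
    where open ≡-Reasoning

-- Since I = J − Q ∘ Q entrywise, the block at (i , j) depends on Q i j only; it has the same form
-- with another f, which is why f is arbitrary.
𝒥𝒜-multicirculant : ∀ p k → 2 ≤ p → {Q : Matrix ℤ (p ^ k) (p ^ k)} → IsCore (p ^ k) Q → Circulant p k Q →
  ∀ m (f : ℤ → ℤ → ℂ) → ℂᴹ.Multicirculant (λ i j → f (𝒥 Q m i j) (𝒜 Q m i j))
𝒥𝒜-multicirculant p k 2≤p         c circs zero    f = ℂᴹ.order-1 _
𝒥𝒜-multicirculant p k 2≤p {Q = Q} c circs (suc m) f = Multicirculant-cast refl
  (λ x y → trans
    (cong (λ d → f (1ℤ *ℤ 𝒜 Q m (lo x) (lo y))
                   (d *ℤ 𝒥 Q m (lo x) (lo y) +ℤ Q (hi x) (hi y) *ℤ 𝒜 Q m (lo x) (lo y)))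
      (core-identity c (hi x) (hi y)))
    (sym (cong₂ (blockwise (p ^ k) (q ^ m) Q B) (cast-is-id refl x) (cast-is-id refl y))))
  (blockwise-multicirculant p k (q ^ m) 2≤p Q circs B
    (λ z → 𝒥𝒜-multicirculant p k 2≤p c circs m (λ u v → f (1ℤ *ℤ v) ((1ℤ ℤ.- z *ℤ z) *ℤ u +ℤ z *ℤ v))))
  where
  q = p ^ k
  B : ℤ → Matrix ℂ (q ^ m) (q ^ m)
  B z r s = f (1ℤ *ℤ 𝒜 Q m r s) ((1ℤ ℤ.- z *ℤ z) *ℤ 𝒥 Q m r s +ℤ z *ℤ 𝒜 Q m r s)
  hi : Fin (q ^ suc m) → Fin q
  hi x = proj₁ (remQuot {q} (q ^ m) x)
  lo : Fin (q ^ suc m) → Fin (q ^ m)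
  lo x = proj₂ (remQuot {q} (q ^ m) x)

-- Paley cores of prime order

^-distribʳ-* : ∀ a b n → (a *ℤ b) ℤ.^ n ≡ a ℤ.^ n *ℤ b ℤ.^ n
^-distribʳ-* a b zero    = refl
^-distribʳ-* a b (suc n) = trans (cong (a *ℤ b *ℤ_) (^-distribʳ-* a b n)) (lem a b (a ℤ.^ n) (b ℤ.^ n))
  where
  lem : ∀ a b x y → a *ℤ b *ℤ (x *ℤ y) ≡ a *ℤ x *ℤ (b *ℤ y)
  lem = solve-∀

module Residues (p : ℕ) .{{_ : ℕ.NonZero p}} where
  infix 4 _≋_
  -- Working with congruent integers, and not with arithmetic on `Fin p`, leaves polynomial
  -- identities to the integer ring solver; `Fin p` only indexes sums and products.
  record _≋_ (a b : ℤ) : Set where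
    constructor by
    field
      quotient : ℤ
      equality : a ≡ b +ℤ quotient *ℤ + p

  ≋-refl : ∀ {a} → a ≋ a
  ≋-refl {a} = by 0ℤ (sym (ℤP.+-identityʳ a))

  ≋-reflexive : ∀ {a b} → a ≡ b → a ≋ b
  ≋-reflexive refl = ≋-refl

  ≋-sym : ∀ {a b} → a ≋ b → b ≋ a
  ≋-sym {a} {b} (by q eq) = by (ℤ.- q) (trans (lem b q (+ p)) (cong (_+ℤ ℤ.- q *ℤ + p) (sym eq)))
    where
    lem : ∀ b q p → b ≡ b +ℤ q *ℤ p +ℤ ℤ.- q *ℤ p
    lem = solve-∀

  ≋-trans : ∀ {a b c} → a ≋ b → b ≋ c → a ≋ c
  ≋-trans {c = c} (by q eq) (by r eq′) = by (r +ℤ q)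
    (trans eq (trans (cong (_+ℤ q *ℤ + p) eq′) (lem c r q (+ p))))
    where
    lem : ∀ c r q p → c +ℤ r *ℤ p +ℤ q *ℤ p ≡ c +ℤ (r +ℤ q) *ℤ p
    lem = solve-∀

  ≋-+ : ∀ {a b c d} → a ≋ b → c ≋ d → a +ℤ c ≋ b +ℤ d
  ≋-+ {b = b} {d = d} (by q eq) (by r eq′) = by (q +ℤ r) (trans (cong₂ _+ℤ_ eq eq′) (lem b d q r (+ p)))
    where
    lem : ∀ b d q r p → b +ℤ q *ℤ p +ℤ (d +ℤ r *ℤ p) ≡ b +ℤ d +ℤ (q +ℤ r) *ℤ p
    lem = solve-∀

  ≋-* : ∀ {a b c d} → a ≋ b → c ≋ d → a *ℤ c ≋ b *ℤ d
  ≋-* {b = b} {d = d} (by q eq) (by r eq′) = by (b *ℤ r +ℤ q *ℤ d +ℤ q *ℤ r *ℤ + p)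
    (trans (cong₂ _*ℤ_ eq eq′) (lem b d q r (+ p)))
    where
    lem : ∀ b d q r p → (b +ℤ q *ℤ p) *ℤ (d +ℤ r *ℤ p) ≡ b *ℤ d +ℤ (b *ℤ r +ℤ q *ℤ d +ℤ q *ℤ r *ℤ p) *ℤ p
    lem = solve-∀

  ≋-*ˡ : ∀ c {a b} → a ≋ b → c *ℤ a ≋ c *ℤ b
  ≋-*ˡ c = ≋-* (≋-refl {c})

  ≋-*ʳ : ∀ c {a b} → a ≋ b → a *ℤ c ≋ b *ℤ c
  ≋-*ʳ c e = ≋-* e (≋-refl {c})

  ≋-+ˡ : ∀ c {a b} → a ≋ b → c +ℤ a ≋ c +ℤ b
  ≋-+ˡ c = ≋-+ (≋-refl {c})

  ≋-+ʳ : ∀ c {a b} → a ≋ b → a +ℤ c ≋ b +ℤ c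
  ≋-+ʳ c e = ≋-+ e (≋-refl {c})

  ≋-^ : ∀ {a b} → a ≋ b → ∀ n → a ℤ.^ n ≋ b ℤ.^ n
  ≋-^ e zero    = ≋-refl
  ≋-^ e (suc n) = ≋-* e (≋-^ e n)

  ≋⇒≡ : ∀ {a b} → a ≋ b → ℤ.∣ a ℤ.- b ∣ < p → a ≡ b
  ≋⇒≡ {a} {b} (by q eq) small with ℤ.∣ a ℤ.- b ∣ in abs
  ... | zero  = ℤP.i-j≡0⇒i≡j a b (ℤP.∣i∣≡0⇒i≡0 abs)
  ... | suc _ = contradiction (subst (p ℕDiv.∣_) abs (∣⇒∣ᵤ (divides q (trans (cong (ℤ._- b) eq) (lem b (q *ℤ + p))))))
                  (ℕDiv.>⇒∤ small)
    where
    lem : ∀ b x → b +ℤ x ℤ.- b ≡ x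
    lem = solve-∀

  residue : ℤ → Fin p
  residue z = fromℕ< (ℤD.n%ℕd<d z p)

  ⟦_⟧ : Fin p → ℤ
  ⟦ i ⟧ = + toℕ i

  ⟦residue⟧ : ∀ z → ⟦ residue z ⟧ ≋ z
  ⟦residue⟧ z = ≋-sym (by (z ℤD./ℕ p) (trans (ℤD.a≡a%ℕn+[a/ℕn]*n z p)
    (cong (λ r → + r +ℤ z ℤD./ℕ p *ℤ + p) (sym (toℕ-fromℕ< (ℤD.n%ℕd<d z p))))))

  ⟦⟧-injective : ∀ {i j} → ⟦ i ⟧ ≋ ⟦ j ⟧ → i ≡ j
  ⟦⟧-injective {i} {j} e = toℕ-injective (ℤP.+-injective (≋⇒≡ e
    (subst (_< p) (sym (cong ℤ.∣_∣ (ℤP.m-n≡m⊖n (toℕ i) (toℕ j))))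
      (ℕP.≤-<-trans (ℤP.∣m⊝n∣≤m⊔n (toℕ i) (toℕ j)) (ℕP.⊔-pres-<m (toℕ<n i) (toℕ<n j))))))

  residue-cong : ∀ {a b} → a ≋ b → residue a ≡ residue b
  residue-cong {a} {b} e = ⟦⟧-injective (≋-trans (⟦residue⟧ a) (≋-trans e (≋-sym (⟦residue⟧ b))))

  _≋?_ : ∀ a b → Dec (a ≋ b)
  a ≋? b with residue a ≟ᶠ residue b
  ... | yes eq = yes (≋-trans (≋-sym (⟦residue⟧ a)) (≋-trans (≋-reflexive (cong ⟦_⟧ eq)) (⟦residue⟧ b)))
  ... | no neq = no (neq ∘ residue-cong)

  module Reindex {c ℓ} (M : CommutativeMonoid c ℓ) where
    private
      module M = CommutativeMonoid M
      module S = MonoidSum M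

    -- A map invertible modulo `p` permutes the residues. The monoid is a parameter because this is
    -- applied both to products modulo `p` and to integer sums of characters.
    reindex : (f : ℤ → M.Carrier) → (∀ {a b} → a ≋ b → f a M.≈ f b) →
              (g g⁻¹ : ℤ → ℤ) → (∀ {a b} → a ≋ b → g a ≋ g b) → (∀ {a b} → a ≋ b → g⁻¹ a ≋ g⁻¹ b) →
              (∀ z → g (g⁻¹ z) ≋ z) → (∀ z → g⁻¹ (g z) ≋ z) →
              S.sum (λ i → f ⟦ i ⟧) M.≈ S.sum (λ i → f (g ⟦ i ⟧))
    reindex f f-cong g g⁻¹ g-cong g⁻¹-cong gg⁻¹ g⁻¹g = M.trans
      (S.sum-permute (λ i → f ⟦ i ⟧) (permutation (on g) (on g⁻¹) (on-inverse g g⁻¹ g-cong gg⁻¹) (on-inverse g⁻¹ g g⁻¹-cong g⁻¹g)))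
      (S.sum-cong-≋ λ i → f-cong (⟦residue⟧ (g ⟦ i ⟧)))
      where
      on : (ℤ → ℤ) → Fin p → Fin p
      on h i = residue (h ⟦ i ⟧)
      on-inverse : ∀ h h⁻¹ → (∀ {a b} → a ≋ b → h a ≋ h b) → (∀ z → h (h⁻¹ z) ≋ z) → ∀ i → on h (on h⁻¹ i) ≡ i
      on-inverse h h⁻¹ h-cong hh⁻¹ i = ⟦⟧-injective (≋-trans (⟦residue⟧ (h ⟦ on h⁻¹ i ⟧))
        (≋-trans (h-cong (⟦residue⟧ (h⁻¹ ⟦ i ⟧))) (hh⁻¹ ⟦ i ⟧)))

  ≋-*-commutativeMonoid : CommutativeMonoid _ _
  ≋-*-commutativeMonoid = record
    { Carrier = ℤ ; _≈_ = _≋_ ; _∙_ = _*ℤ_ ; ε = 1ℤ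
    ; isCommutativeMonoid = record
      { isMonoid = record
        { isSemigroup = record
          { isMagma = record
            { isEquivalence = record { refl = ≋-refl ; sym = ≋-sym ; trans = ≋-trans }
            ; ∙-cong = ≋-* }
          ; assoc = λ a b c → ≋-reflexive (ℤP.*-assoc a b c) }
        ; identity = (λ a → ≋-reflexive (ℤP.*-identityˡ a)) , (λ a → ≋-reflexive (ℤP.*-identityʳ a)) }
      ; comm = λ a b → ≋-reflexive (ℤP.*-comm a b) } }

  difference-0 : ∀ {a b} → a ℤ.- b ≋ 0ℤ → a ≋ b
  difference-0 {a} {b} (by q eq) = by q (trans (lem a b) (trans (cong (b +ℤ_) eq) (cong (b +ℤ_) (ℤP.+-identityˡ (q *ℤ + p)))))
    where
    lem : ∀ a b → a ≡ b +ℤ (a ℤ.- b)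
    lem = solve-∀

  0-difference : ∀ {a b} → a ≋ b → a ℤ.- b ≋ 0ℤ
  0-difference {a} {b} e = ≋-trans (≋-+ʳ (ℤ.- b) e) (≋-reflexive (ℤP.+-inverseʳ b))

  module Field (prime : Prime p) where
    inverse : ∀ {a} → ¬ (a ≋ 0ℤ) → Σ[ w ∈ ℤ ] a *ℤ w ≋ 1ℤ
    inverse {a} a≢0 with toℕ (residue a) in eq | toℕ<n (residue a)
    ... | zero  | _   = contradiction (≋-trans (≋-sym (⟦residue⟧ a)) (≋-reflexive (cong +_ eq))) a≢0
    ... | suc r | r<p = fromBézout (coprime-Bézout (prime⇒coprime prime r<p))
      where
      a≋ : a ≋ + suc r
      a≋ = ≋-trans (≋-sym (⟦residue⟧ a)) (≋-reflexive (cong +_ eq))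
      fromBézout : Bézout.Identity 1 p (suc r) → Σ[ w ∈ ℤ ] a *ℤ w ≋ 1ℤ
      -- Here 1 + y (r + 1) = x p, so the inverse is -y; in the other case 1 + x p = y (r + 1).
      fromBézout (Bézout.+- x y e) = ℤ.- + y , ≋-trans (≋-*ʳ (ℤ.- + y) a≋)
        (by (ℤ.- + x) (trans (lem (+ suc r) (+ y) (+ x) (+ p)) (trans
          (cong (λ z → 1ℤ +ℤ ℤ.- + x *ℤ + p +ℤ (z ℤ.- (1ℤ +ℤ + y *ℤ + suc r)))
            (trans (sym (ℤP.pos-* x p)) (trans (cong +_ (sym e)) (cong (1ℤ +ℤ_) (ℤP.pos-* y (suc r))))))
          (trans (cong (1ℤ +ℤ ℤ.- + x *ℤ + p +ℤ_) (ℤP.+-inverseʳ (1ℤ +ℤ + y *ℤ + suc r))) (ℤP.+-identityʳ _)))))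
        where
        lem : ∀ r y x p → r *ℤ ℤ.- y ≡ 1ℤ +ℤ ℤ.- x *ℤ p +ℤ (x *ℤ p ℤ.- (1ℤ +ℤ y *ℤ r))
        lem = solve-∀
      fromBézout (Bézout.-+ x y e) = + y , ≋-trans (≋-*ʳ (+ y) a≋)
        (by (+ x) (trans (ℤP.*-comm (+ suc r) (+ y)) (trans (sym (ℤP.pos-* y (suc r)))
          (trans (cong +_ (sym e)) (cong (1ℤ +ℤ_) (ℤP.pos-* x p))))))

    cancel : ∀ {a b} → ¬ (a ≋ 0ℤ) → a *ℤ b ≋ 0ℤ → b ≋ 0ℤ
    cancel {a} {b} a≢0 ab with inverse a≢0
    ... | w , aw = ≋-trans (≋-reflexive (sym (ℤP.*-identityˡ b)))
      (≋-trans (≋-*ʳ b (≋-sym aw)) (≋-trans (≋-reflexive (lem a w b))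
        (≋-trans (≋-*ˡ w ab) (≋-reflexive (ℤP.*-zeroʳ w)))))
      where
      lem : ∀ a w b → a *ℤ w *ℤ b ≡ w *ℤ (a *ℤ b)
      lem = solve-∀

-- With h = (p - 1)/2, oddness of h says that p ≡ 3 modulo 4. Writing p as 2 h + 1 lets exponents
-- and index sets compute.
module Legendre (h′ : ℕ) (prime : Prime (suc (suc h′ ℕ.+ suc h′))) (odd : Odd (suc h′)) where
  h p-1 p : ℕ
  h = suc h′
  p-1 = h ℕ.+ h
  p = suc p-1

  open Residues p
  open Field prime

  private module Π = MonoidSum ≋-*-commutativeMonoid

  2<p : 2 < p
  2<p = s≤s (s≤s (subst (1 ≤_) (sym (ℕP.+-suc h′ h′)) (s≤s z≤n)))

  0<i⇒≢0 : (i : Fin p-1) → ¬ (⟦ suc i ⟧ ≋ 0ℤ)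
  0<i⇒≢0 i e with () ← ⟦⟧-injective {suc i} {zero} e

  1≢0 : ¬ (1ℤ ≋ 0ℤ)
  1≢0 e with () ← ≋⇒≡ e (ℕP.<-trans (s≤s (s≤s z≤n)) 2<p)

  private
    -- Replacing 0 by 1 lets the product of the nonzero residues run over all of `Fin p`, as
    -- `reindex` requires.
    unit : ∀ z → Dec (z ≋ 0ℤ) → ℤ
    unit z (yes _) = 1ℤ
    unit z (no _)  = z

    unit-nonzero : ∀ z d → ¬ (unit z d ≋ 0ℤ)
    unit-nonzero z (yes _) = 1≢0
    unit-nonzero z (no ne) = ne

    unit-cong : ∀ {a b} d d′ → a ≋ b → unit a d ≋ unit b d′
    unit-cong (yes _) (yes _) e = ≋-refl
    unit-cong (yes a) (no ¬b) e = contradiction (≋-trans (≋-sym e) a) ¬b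
    unit-cong (no ¬a) (yes b) e = contradiction (≋-trans e b) ¬a
    unit-cong (no _)  (no _)  e = e

    ∏-nonzero : ∀ {n} (f : Fin n → ℤ) → (∀ i → ¬ (f i ≋ 0ℤ)) → ¬ (Π.sum f ≋ 0ℤ)
    ∏-nonzero {zero}  f ne = 1≢0
    ∏-nonzero {suc n} f ne e = ∏-nonzero (f ∘ suc) (ne ∘ suc) (cancel (ne zero) e)

    ∏-const : ∀ n a → Π.sum {n} (λ _ → a) ≡ a ℤ.^ n
    ∏-const zero    a = refl
    ∏-const (suc n) a = cong (a *ℤ_) (∏-const n a)

  module _ {a : ℤ} (a≢0 : ¬ (a ≋ 0ℤ)) where
    private
      a⁻¹ = proj₁ (inverse a≢0)
      aa⁻¹ = proj₂ (inverse a≢0)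

      f : ℤ → ℤ
      f z = unit z (z ≋? 0ℤ)

      factor : Fin p → ℤ
      factor zero    = 1ℤ
      factor (suc _) = a

      f-* : ∀ i → f (a *ℤ ⟦ i ⟧) ≋ factor i *ℤ f ⟦ i ⟧
      f-* zero = ≋-trans (unit-cong _ (0ℤ ≋? 0ℤ) (≋-reflexive (ℤP.*-zeroʳ a))) (≋-reflexive (sym (ℤP.*-identityˡ _)))
      f-* (suc i) = split ((a *ℤ ⟦ suc i ⟧) ≋? 0ℤ) (⟦ suc i ⟧ ≋? 0ℤ)
        where
        split : ∀ d d′ → unit (a *ℤ ⟦ suc i ⟧) d ≋ a *ℤ unit ⟦ suc i ⟧ d′
        split _       (yes e) = contradiction e (0<i⇒≢0 i)
        split (yes e) (no ne) = contradiction (cancel a≢0 e) ne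
        split (no _)  (no _)  = ≋-refl

      F = Π.sum (λ i → f ⟦ i ⟧)

      scaled : F ≋ a ℤ.^ p-1 *ℤ F
      scaled = ≋-trans
        (Reindex.reindex ≋-*-commutativeMonoid f (unit-cong _ _) (a *ℤ_) (a⁻¹ *ℤ_)
          (≋-*ˡ a) (≋-*ˡ a⁻¹)
          (λ z → ≋-trans (≋-reflexive (sym (ℤP.*-assoc a a⁻¹ z)))
            (≋-trans (≋-*ʳ z aa⁻¹) (≋-reflexive (ℤP.*-identityˡ z))))
          (λ z → ≋-trans (≋-reflexive (trans (sym (ℤP.*-assoc a⁻¹ a z)) (cong (_*ℤ z) (ℤP.*-comm a⁻¹ a))))
            (≋-trans (≋-*ʳ z aa⁻¹) (≋-reflexive (ℤP.*-identityˡ z)))))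
        (≋-trans (Π.sum-cong-≋ f-*) (≋-trans (Π.∑-distrib-+ factor (λ i → f ⟦ i ⟧))
          (≋-*ʳ F (≋-reflexive (trans (ℤP.*-identityˡ _) (∏-const p-1 a))))))

    -- Multiplication by `a` permutes the nonzero residues, so their product `F` satisfies F = aᵖ⁻¹
    -- F, and `F` can be cancelled.
    fermat : a ℤ.^ p-1 ≋ 1ℤ
    fermat = difference-0 (cancel (∏-nonzero (λ i → f ⟦ i ⟧) (λ i → unit-nonzero ⟦ i ⟧ (⟦ i ⟧ ≋? 0ℤ)))
      (≋-trans (≋-reflexive (lem F (a ℤ.^ p-1))) (0-difference (≋-sym scaled))))
      where
      lem : ∀ F x → F *ℤ (x ℤ.- 1ℤ) ≡ x *ℤ F ℤ.- F
      lem = solve-∀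

  Trit : ℤ → Set
  Trit z = z ≡ 0ℤ ⊎ IsSign z

  private
    -- Two of -1, 0, 1 differ by at most 2, and 2 < p.
    Trit-unique : ∀ {a b} → Trit a → Trit b → a ≋ b → a ≡ b
    Trit-unique s t e = ≋⇒≡ e (small s t)
      where
      0<p = ℕP.<-trans (s≤s z≤n) 2<p
      1<p = ℕP.<-trans (s≤s (s≤s z≤n)) 2<p
      small : ∀ {a b} → Trit a → Trit b → ℤ.∣ a ℤ.- b ∣ < p
      small (inj₁ refl)        (inj₁ refl)        = 0<p
      small (inj₁ refl)        (inj₂ (inj₁ refl)) = 1<p
      small (inj₁ refl)        (inj₂ (inj₂ refl)) = 1<p
      small (inj₂ (inj₁ refl)) (inj₁ refl)        = 1<p
      small (inj₂ (inj₁ refl)) (inj₂ (inj₁ refl)) = 0<p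
      small (inj₂ (inj₁ refl)) (inj₂ (inj₂ refl)) = 2<p
      small (inj₂ (inj₂ refl)) (inj₁ refl)        = 1<p
      small (inj₂ (inj₂ refl)) (inj₂ (inj₁ refl)) = 2<p
      small (inj₂ (inj₂ refl)) (inj₂ (inj₂ refl)) = 0<p

    Trit-* : ∀ {a b} → Trit a → Trit b → Trit (a *ℤ b)
    Trit-* {b = b} (inj₁ refl) _           = inj₁ refl
    Trit-* {a}     (inj₂ _)    (inj₁ refl) = inj₁ (ℤP.*-zeroʳ a)
    Trit-*         (inj₂ s)    (inj₂ t)    = inj₂ (IsSign-* s t)

    -- For nonzero z, Fermat's theorem gives (zʰ - 1)(zʰ + 1) = 0 modulo p.
    euler : ∀ z → Σ[ c ∈ ℤ ] Trit c × z ℤ.^ h ≋ c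
    euler z with z ≋? 0ℤ
    ... | yes e = 0ℤ , inj₁ refl , ≋-*ʳ (z ℤ.^ h′) e
    ... | no ne with (z ℤ.^ h) ≋? 1ℤ
    ...   | yes e = 1ℤ , inj₂ (inj₁ refl) , e
    ...   | no ¬1 = -1ℤ , inj₂ (inj₂ refl) , difference-0 (cancel (¬1 ∘ difference-0)
              (≋-trans (≋-reflexive (trans (lem (z ℤ.^ h)) (cong (ℤ._- 1ℤ) (sym (ℤP.^-distribˡ-+-* z h h)))))
                (0-difference (fermat ne))))
      where
      lem : ∀ x → (x ℤ.- 1ℤ) *ℤ (x ℤ.- -1ℤ) ≡ x *ℤ x ℤ.- 1ℤ
      lem = solve-∀

  opaque
    -- The Legendre symbol, defined by Euler's criterion so that multiplicativity is a law of
    -- exponents.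
    χ : ℤ → ℤ
    χ z = proj₁ (euler z)

    χ-trit : ∀ z → Trit (χ z)
    χ-trit z = proj₁ (proj₂ (euler z))

    χ-euler : ∀ z → z ℤ.^ h ≋ χ z
    χ-euler z = proj₂ (proj₂ (euler z))

  χ-determined : ∀ {z c} → Trit c → z ℤ.^ h ≋ c → χ z ≡ c
  χ-determined {z} t e = Trit-unique (χ-trit z) t (≋-trans (≋-sym (χ-euler z)) e)

  χ-cong : ∀ {a b} → a ≋ b → χ a ≡ χ b
  χ-cong {a} {b} e = χ-determined {a} (χ-trit b) (≋-trans (≋-^ e h) (χ-euler b))

  χ-* : ∀ a b → χ (a *ℤ b) ≡ χ a *ℤ χ b
  χ-* a b = χ-determined {a *ℤ b} (Trit-* (χ-trit a) (χ-trit b))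
    (≋-trans (≋-reflexive (^-distribʳ-* a b h)) (≋-* (χ-euler a) (χ-euler b)))

  -- Oddness of `h` enters here, as (-1)ʰ = -1; it makes the Paley matrix skew and the sum of `χ`
  -- vanish.
  χ-neg : ∀ a → χ (ℤ.- a) ≡ ℤ.- χ a
  χ-neg a = trans (cong χ (sym (ℤP.-1*i≡-i a))) (trans (χ-* -1ℤ a)
    (trans (cong (_*ℤ χ a) (χ-determined { -1ℤ} (inj₂ (inj₂ refl)) (≋-reflexive (-1^odd odd)))) (ℤP.-1*i≡-i (χ a))))

  χ-0 : ∀ {z} → z ≋ 0ℤ → χ z ≡ 0ℤ
  χ-0 {z} e = χ-determined {z} (inj₁ refl) (≋-*ʳ (z ℤ.^ h′) e)

  χ-sign : ∀ {z} → ¬ (z ≋ 0ℤ) → IsSign (χ z)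
  χ-sign {z} ne with χ-trit z
  ... | inj₂ s = s
  ... | inj₁ e = contradiction
    (≋-trans (≋-sym (fermat ne)) (≋-trans (≋-reflexive (ℤP.^-distribˡ-+-* z h h))
      (≋-*ʳ (z ℤ.^ h) (≋-trans (χ-euler z) (≋-reflexive e))))) 1≢0

  inv : ℤ → ℤ
  inv z = z ℤ.^ (h′ ℕ.+ h)  -- the exponent is p − 2

  inv-0 : ∀ {z} → z ≋ 0ℤ → inv z ≋ 0ℤ
  inv-0 {z} e = ≋-trans (≋-reflexive (cong (z ℤ.^_) (ℕP.+-suc h′ h′))) (≋-*ʳ (z ℤ.^ (h′ ℕ.+ h′)) e)

  inv-* : ∀ {z} → ¬ (z ≋ 0ℤ) → z *ℤ inv z ≋ 1ℤ
  inv-* = fermat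

  inv-cong : ∀ {a b} → a ≋ b → inv a ≋ inv b
  inv-cong e = ≋-^ e (h′ ℕ.+ h)

  inv-nonzero : ∀ {z} → ¬ (z ≋ 0ℤ) → ¬ (inv z ≋ 0ℤ)
  inv-nonzero {z} ne e = 1≢0 (≋-trans (≋-sym (inv-* ne)) (≋-trans (≋-*ˡ z e) (≋-reflexive (ℤP.*-zeroʳ z))))

  -- As `inv` fixes 0, this also holds there, and `inv` permutes all residues.
  inv-involutive : ∀ z → inv (inv z) ≋ z
  inv-involutive z with z ≋? 0ℤ
  ... | yes e = ≋-trans (inv-0 (inv-0 e)) (≋-sym e)
  ... | no ne = ≋-trans (≋-reflexive (sym (ℤP.*-identityˡ _)))
    (≋-trans (≋-*ʳ (inv (inv z)) (≋-sym (inv-* ne)))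
      (≋-trans (≋-reflexive (ℤP.*-assoc z (inv z) (inv (inv z))))
        (≋-trans (≋-*ˡ z (inv-* (inv-nonzero ne))) (≋-reflexive (ℤP.*-identityʳ z)))))

  private
    open Reindex ℤP.+-0-commutativeMonoid

    minus : ∀ a {b c} → b ≋ c → b ℤ.- a ≋ c ℤ.- a
    minus a e = ≋-+ʳ (ℤ.- a) e

    cancel⁺ : ∀ a z → z +ℤ a ℤ.- a ≡ z
    cancel⁺ = solve-∀

    cancel⁻ : ∀ a z → z ℤ.- a +ℤ a ≡ z
    cancel⁻ = solve-∀

  sum-shift : ∀ a (f : ℤ → ℤ) → (∀ {b c} → b ≋ c → f b ≡ f c) →
              sum {p} (λ i → f (⟦ i ⟧ ℤ.- a)) ≡ sum {p} (λ i → f ⟦ i ⟧)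
  sum-shift a f f-cong = sym (reindex f f-cong (ℤ._- a) (_+ℤ a) (minus a) (≋-+ʳ a)
    (λ z → ≋-reflexive (cancel⁺ a z)) (λ z → ≋-reflexive (cancel⁻ a z)))

  -- Negating the index permutes the residues and flips the sign of every term.
  sum-χ : sum {p} (λ i → χ ⟦ i ⟧) ≡ 0ℤ
  sum-χ = self-neg⇒0 (trans
    (reindex χ χ-cong ℤ.-_ ℤ.-_ neg-cong neg-cong
      (λ z → ≋-reflexive (ℤP.neg-involutive z)) (λ z → ≋-reflexive (ℤP.neg-involutive z)))
    (trans (sum-cong-≗ (λ (i : Fin p) → χ-neg ⟦ i ⟧)) (sum-neg (λ (i : Fin p) → χ ⟦ i ⟧))))
    where
    neg-cong : ∀ {a b} → a ≋ b → ℤ.- a ≋ ℤ.- b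
    neg-cong {a} {b} e = ≋-trans (≋-reflexive (sym (ℤP.-1*i≡-i a)))
      (≋-trans (≋-*ˡ -1ℤ e) (≋-reflexive (ℤP.-1*i≡-i b)))

  autocorrelation : ℤ → ℤ
  autocorrelation d = sum {p} (λ i → χ ⟦ i ⟧ *ℤ χ (⟦ i ⟧ +ℤ d))

  autocorrelation-0 : ∀ {d} → d ≋ 0ℤ → autocorrelation d ≡ + p-1
  autocorrelation-0 {d} e = trans
    (cong₂ _+ℤ_ (cong (_*ℤ χ (0ℤ +ℤ d)) (χ-0 {0ℤ} ≋-refl))
      (trans (sum-cong-≗ λ i → trans
          (cong (χ ⟦ suc i ⟧ *ℤ_) (χ-cong (≋-trans (≋-+ˡ ⟦ suc i ⟧ e) (≋-reflexive (ℤP.+-identityʳ ⟦ suc i ⟧)))))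
          (IsSign⇒square (χ-sign (0<i⇒≢0 i))))
        (sum-const p-1 1ℤ)))
    (trans (ℤP.+-identityˡ _) (ℤP.*-identityʳ (+ p-1)))

  -- χ x χ (x + d) = χ (1 + d / x) for x ≠ 0, and x ↦ 1 + d / x is a permutation once 1 / 0 = 0.
  autocorrelation-≢0 : ∀ {d} → ¬ (d ≋ 0ℤ) → autocorrelation d ≡ -1ℤ
  autocorrelation-≢0 {d} d≢0 = trans (sum-cong-≗ term)
    (trans (∑-distrib-+ (λ (i : Fin p) → χ (g ⟦ i ⟧)) correction)
      (cong₂ _+ℤ_
        (trans (sym (reindex χ χ-cong g g⁻¹ g-cong g⁻¹-cong gg⁻¹ g⁻¹g)) sum-χ)
        (cong (-1ℤ +ℤ_) (sum-replicate-zero p-1))))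
    where
    g g⁻¹ : ℤ → ℤ
    g z = 1ℤ +ℤ d *ℤ inv z
    g⁻¹ y = inv ((y ℤ.- 1ℤ) *ℤ inv d)
    g-cong : ∀ {a b} → a ≋ b → g a ≋ g b
    g-cong e = ≋-+ˡ 1ℤ (≋-*ˡ d (inv-cong e))
    g⁻¹-cong : ∀ {a b} → a ≋ b → g⁻¹ a ≋ g⁻¹ b
    g⁻¹-cong e = inv-cong (≋-*ʳ (inv d) (minus 1ℤ e))
    gg⁻¹ : ∀ z → g (g⁻¹ z) ≋ z
    gg⁻¹ z = ≋-trans (≋-+ˡ 1ℤ (≋-*ˡ d (inv-involutive ((z ℤ.- 1ℤ) *ℤ inv d))))
      (≋-trans (≋-reflexive (lem d z (inv d)))
        (≋-trans (≋-+ˡ 1ℤ (≋-*ʳ (z ℤ.- 1ℤ) (inv-* d≢0))) (≋-reflexive (lem′ z))))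
      where
      lem : ∀ d z i → 1ℤ +ℤ d *ℤ ((z ℤ.- 1ℤ) *ℤ i) ≡ 1ℤ +ℤ d *ℤ i *ℤ (z ℤ.- 1ℤ)
      lem = solve-∀
      lem′ : ∀ z → 1ℤ +ℤ 1ℤ *ℤ (z ℤ.- 1ℤ) ≡ z
      lem′ = solve-∀
    g⁻¹g : ∀ z → g⁻¹ (g z) ≋ z
    g⁻¹g z = ≋-trans (inv-cong (≋-trans (≋-reflexive (lem d (inv z) (inv d)))
        (≋-trans (≋-*ʳ (inv z) (inv-* d≢0)) (≋-reflexive (ℤP.*-identityˡ (inv z))))))
      (inv-involutive z)
      where
      lem : ∀ d x i → (1ℤ +ℤ d *ℤ x ℤ.- 1ℤ) *ℤ i ≡ d *ℤ i *ℤ x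
      lem = solve-∀
    -- At x = 0 the product is 0 while `χ (g 0)` is 1.
    correction : Fin p → ℤ
    correction zero    = -1ℤ
    correction (suc _) = 0ℤ
    term : ∀ i → χ ⟦ i ⟧ *ℤ χ (⟦ i ⟧ +ℤ d) ≡ χ (g ⟦ i ⟧) +ℤ correction i
    term zero = trans (cong (_*ℤ χ (0ℤ +ℤ d)) (χ-0 {0ℤ} ≋-refl)) (sym (cong (_+ℤ -1ℤ)
      (χ-determined {g 0ℤ} (inj₂ (inj₁ refl)) (≋-trans (≋-^ g0 h) (≋-reflexive (ℤP.^-zeroˡ h))))))
      where
      g0 : g 0ℤ ≋ 1ℤ
      g0 = ≋-trans (≋-+ˡ 1ℤ (≋-*ˡ d (inv-0 {0ℤ} ≋-refl))) (≋-reflexive (cong (1ℤ +ℤ_) (ℤP.*-zeroʳ d)))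
    term (suc i) = trans (cong (χ x *ℤ_) (χ-cong x+d)) (trans (cong (χ x *ℤ_) (χ-* x (g x)))
      (trans (sym (ℤP.*-assoc (χ x) (χ x) (χ (g x))))
        (trans (cong (_*ℤ χ (g x)) (IsSign⇒square (χ-sign (0<i⇒≢0 i))))
          (trans (ℤP.*-identityˡ (χ (g x))) (sym (ℤP.+-identityʳ (χ (g x))))))))
      where
      x = ⟦ suc i ⟧
      lem : ∀ x d i → x *ℤ (1ℤ +ℤ d *ℤ i) ≡ x +ℤ d *ℤ (x *ℤ i)
      lem = solve-∀
      x+d : x +ℤ d ≋ x *ℤ g x
      x+d = ≋-sym (≋-trans (≋-reflexive (lem x d (inv x))) (≋-+ˡ x
        (≋-trans (≋-*ˡ d (inv-* (0<i⇒≢0 i))) (≋-reflexive (ℤP.*-identityʳ d)))))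

  Paley : Matrix ℤ p p
  Paley i j = χ (⟦ j ⟧ ℤ.- ⟦ i ⟧)

  Paley-core : IsCore p Paley
  Paley-core = record
    { diagonal = λ i → χ-0 (≋-reflexive (ℤP.+-inverseʳ ⟦ i ⟧))
    ; offDiag  = λ i≢j → χ-sign λ e → i≢j (sym (⟦⟧-injective (difference-0 e)))
    ; skew     = λ i j → trans (cong χ (lem ⟦ i ⟧ ⟦ j ⟧)) (χ-neg (⟦ j ⟧ ℤ.- ⟦ i ⟧))
    ; rowSum-0 = λ i → trans (sum-shift ⟦ i ⟧ χ χ-cong) sum-χ
    ; gram-Q   = λ i j → trans (gram≡autocorrelation i j) (value i j) }
    where
    lem : ∀ i j → i ℤ.- j ≡ ℤ.- (j ℤ.- i)
    lem = solve-∀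
    lem₂ : ∀ k i j → k ℤ.- i +ℤ (i ℤ.- j) ≡ k ℤ.- j
    lem₂ = solve-∀
    gram≡autocorrelation : ∀ i j → gram Paley Paley i j ≡ autocorrelation (⟦ i ⟧ ℤ.- ⟦ j ⟧)
    gram≡autocorrelation i j = trans
      (sum-cong-≗ λ k → cong (λ z → χ (⟦ k ⟧ ℤ.- ⟦ i ⟧) *ℤ χ z) (sym (lem₂ ⟦ k ⟧ ⟦ i ⟧ ⟦ j ⟧)))
      (sum-shift ⟦ i ⟧ (λ z → χ z *ℤ χ (z +ℤ (⟦ i ⟧ ℤ.- ⟦ j ⟧)))
        (λ e → cong₂ _*ℤ_ (χ-cong e) (χ-cong (≋-+ʳ (⟦ i ⟧ ℤ.- ⟦ j ⟧) e))))
    value : ∀ i j → autocorrelation (⟦ i ⟧ ℤ.- ⟦ j ⟧) ≡ + p *ℤ I p i j ℤ.- 1ℤ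
    value i j = split (i ≟ᶠ j)
      where
      split : Dec (i ≡ j) → autocorrelation (⟦ i ⟧ ℤ.- ⟦ j ⟧) ≡ + p *ℤ I p i j ℤ.- 1ℤ
      split (yes i≡j) = trans (autocorrelation-0 (0-difference (≋-reflexive (cong ⟦_⟧ i≡j))))
        (sym (cong (ℤ._- 1ℤ) (trans (cong (+ p *ℤ_) (trans (cong (I p i) (sym i≡j)) (δ-diag i))) (ℤP.*-identityʳ (+ p)))))
      split (no  i≢j) = trans (autocorrelation-≢0 (i≢j ∘ ⟦⟧-injective ∘ difference-0))
        (sym (cong (ℤ._- 1ℤ) (trans (cong (+ p *ℤ_) (δ-off i≢j)) (ℤP.*-zeroʳ (+ p)))))

  Paley-circulant : ∀ i j → Paley i j ≡ χ ⟦ offset i j ⟧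
  Paley-circulant i j = χ-cong {⟦ j ⟧ ℤ.- ⟦ i ⟧} {⟦ offset i j ⟧} (≋-sym (≋-trans
    (≋-reflexive (cong +_ (toℕ-fromℕ< _)))
    (≋-trans (≋-sym (by (+ (w / p))
        (trans (cong +_ (m≡m%n+[m/n]*n w p)) (cong (+ (w % p) +ℤ_) (ℤP.pos-* (w / p) p)))))
      (≋-trans (≋-reflexive w≡) (by 1ℤ (lem ⟦ i ⟧ ⟦ j ⟧ (+ p)))))))
    where
    w = (toℕ j ℕ.+ p) ℕ.∸ toℕ i
    -- The truncated subtraction is exact because i < p; adding p in `offset` is invisible modulo p.
    w≡ : + w ≡ + (toℕ j ℕ.+ p) ℤ.- + toℕ i
    w≡ = trans (sym (ℤP.⊖-≥ (ℕP.≤-trans (ℕP.<⇒≤ (toℕ<n i)) (ℕP.m≤n+m p (toℕ j)))))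
      (sym (ℤP.m-n≡m⊖n (toℕ j ℕ.+ p) (toℕ i)))
    lem : ∀ i j p → j +ℤ p ℤ.- i ≡ j ℤ.- i +ℤ 1ℤ *ℤ p
    lem = solve-∀

-- Prime powers modulo 4 and the choice of the core

≡3-mod-4 : ∀ {r x} → r < 4 → x < 4 → (r ℕ.* x) % 4 ≡ 3 → (r ≡ 1 × x ≡ 3) ⊎ (r ≡ 3 × x ≡ 1)
≡3-mod-4 {0} {_} _ _ ()
≡3-mod-4 {1} {0} _ _ ()
≡3-mod-4 {1} {1} _ _ ()
≡3-mod-4 {1} {2} _ _ ()
≡3-mod-4 {1} {3} _ _ _ = inj₁ (refl , refl)
≡3-mod-4 {2} {0} _ _ ()
≡3-mod-4 {2} {1} _ _ ()
≡3-mod-4 {2} {2} _ _ ()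
≡3-mod-4 {2} {3} _ _ ()
≡3-mod-4 {3} {0} _ _ ()
≡3-mod-4 {3} {1} _ _ _ = inj₂ (refl , refl)
≡3-mod-4 {3} {2} _ _ ()
≡3-mod-4 {3} {3} _ _ ()
≡3-mod-4 {suc (suc (suc (suc _)))} (s≤s (s≤s (s≤s (s≤s ())))) _ _
≡3-mod-4 {_} {suc (suc (suc (suc _)))} _ (s≤s (s≤s (s≤s (s≤s ())))) _

3x≡1-mod-4 : ∀ {x} → x < 4 → (3 ℕ.* x) % 4 ≡ 1 → x ≡ 3
3x≡1-mod-4 {0} _ ()
3x≡1-mod-4 {1} _ ()
3x≡1-mod-4 {2} _ ()
3x≡1-mod-4 {3} _ _ = refl
3x≡1-mod-4 {suc (suc (suc (suc _)))} (s≤s (s≤s (s≤s (s≤s ())))) _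

module _ (p : ℕ) where
  private
    power-step : ∀ k {c} → (p ^ suc k) % 4 ≡ c → ((p % 4) ℕ.* (p ^ k % 4)) % 4 ≡ c
    power-step k e = trans (sym (%-distribˡ-* p (p ^ k) 4)) e

  -- Modulo 4 the residue 3 arises only as 1 · 3, so either `p` or the shorter power is 3.
  base≡3-mod-4 : ∀ k → p ^ k % 4 ≡ 3 → p % 4 ≡ 3
  base≡3-mod-4 (suc k) e with ≡3-mod-4 (m%n<n p 4) (m%n<n (p ^ k) 4) (power-step k e)
  ... | inj₁ (_ , e′) = base≡3-mod-4 k e′
  ... | inj₂ (r , _)  = r

  -- Since 3 · 3 = 1 modulo 4, the exponent can be lowered by two, and it cannot reach 0.
  exponent-odd : p % 4 ≡ 3 → ∀ k → p ^ k % 4 ≡ 3 → Odd k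
  exponent-odd r 1 _ = one
  exponent-odd r (suc (suc k)) e with ≡3-mod-4 (m%n<n p 4) (m%n<n (p ^ suc k) 4) (power-step (suc k) e)
  ... | inj₁ (r′ , _) = contradiction (trans (sym r) r′) λ ()
  ... | inj₂ (_ , e′) = 2+ exponent-odd r k (3x≡1-mod-4 (m%n<n (p ^ k) 4)
          (trans (cong (λ z → (z ℕ.* (p ^ k % 4)) % 4) (sym r)) (power-step k e′)))

suc-double-odd : ∀ t → Odd (suc (t ℕ.+ t))
suc-double-odd zero    = one
suc-double-odd (suc t) = subst (λ z → Odd (suc (suc z))) (sym (ℕP.+-suc t t)) (2+ suc-double-odd t)

circulantCore : ∀ {p} k → Prime p → p % 4 ≡ 3 → Odd k →
                Σ[ Q ∈ Matrix ℤ (p ^ k) (p ^ k) ] IsCore (p ^ k) Q × Circulant p k Q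
circulantCore {p} k prime-p p≡3 k-odd = subst Goal (sym p≡) goal prime-p
  where
  t = p / 4
  Goal : ℕ → Set
  Goal p = Prime p → Σ[ Q ∈ Matrix ℤ (p ^ k) (p ^ k) ] IsCore (p ^ k) Q × Circulant p k Q
  -- p = 4 t + 3 = 2 h + 1 with h = 2 t + 1, the form that `Legendre` expects.
  p≡ : p ≡ suc (suc (t ℕ.+ t) ℕ.+ suc (t ℕ.+ t))
  p≡ = trans (m≡m%n+[m/n]*n p 4) (trans (cong (ℕ._+ t ℕ.* 4) p≡3) (lem t))
    where
    lem : ∀ t → 3 ℕ.+ t ℕ.* 4 ≡ suc (suc (t ℕ.+ t) ℕ.+ suc (t ℕ.+ t))
    lem = ℕSolver.solve-∀
  goal : Goal (suc (suc (t ℕ.+ t) ℕ.+ suc (t ℕ.+ t)))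
  goal prime-p = power Paley k , power-core Paley-core k-odd , power-circulant Paley-core {t = λ o → χ (+ toℕ o)} Paley-circulant k
    where open Legendre (t ℕ.+ t) prime-p (suc-double-odd t)

theorem3p3 : (q : ℕ) → 1 ≤ q →
    ((Σ[ Q ∈ Matrix ℤ q q ] IsSkewCore q Q) →
    ∀ m → 1 ≤ m → Σ[ H ∈ Matrix ℂ (q ^ m) (q ^ m) ]
    IsQUH (q ^ m) q H × IsRegular (q ^ m) H × modulus (ℂᴹ.excess H) ≈ √ fromℕ (q ^ (3 ℕ.* m)))
    ×
    (IsOddPrimePower q → q % 4 ≡ 3 →
    Σ[ Q ∈ Matrix ℤ q q ] IsSkewCore q Q ×
    (∀ m → 1 ≤ m → let H = hadamardFromCore Q m in
    IsQUH (q ^ m) q H × IsRegular (q ^ m) H ×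
    modulus (ℂᴹ.excess H) ≈ √ fromℕ (q ^ (3 ℕ.* m)) × ℂᴹ.Multicirculant H))
theorem3p3 q _ = fromCore , fromPrimePower
  where
  fromCore : (Σ[ Q ∈ Matrix ℤ q q ] IsSkewCore q Q) → ∀ m → 1 ≤ m → Σ[ H ∈ Matrix ℂ (q ^ m) (q ^ m) ]
    IsQUH (q ^ m) q H × IsRegular (q ^ m) H × modulus (ℂᴹ.excess H) ≈ √ fromℕ (q ^ (3 ℕ.* m))
  fromCore (Q , s) m _ = hadamardFromCore Q m , isQUH c m , isRegular c m , excess-modulus c m
    where c = IsSkewCore⇒IsCore s

  fromPrimePower : IsOddPrimePower q → q % 4 ≡ 3 → Σ[ Q ∈ Matrix ℤ q q ] IsSkewCore q Q ×
    (∀ m → 1 ≤ m → let H = hadamardFromCore Q m in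
      IsQUH (q ^ m) q H × IsRegular (q ^ m) H ×
      modulus (ℂᴹ.excess H) ≈ √ fromℕ (q ^ (3 ℕ.* m)) × ℂᴹ.Multicirculant H)
  fromPrimePower (p , k , prime-p , _ , _ , refl) q≡3 =
    let p≡3 = base≡3-mod-4 p k q≡3
        Q , c , circulant = circulantCore k prime-p p≡3 (exponent-odd p p≡3 k q≡3)
        2≤p = ℕ.nonTrivial⇒n>1 p {{prime⇒nonTrivial prime-p}}
    in Q , IsCore⇒IsSkewCore c , λ m _ → isQUH c m , isRegular c m , excess-modulus c m ,
       -- With this function the matrix is `hadamardFromCore` by unfolding.
       𝒥𝒜-multicirculant p k 2≤p c circulant m
         (λ s r → ofReal (α q) *ᶜ ℤ→ℂ s +ᶜ (𝕚 *ᶜ ofReal (β q)) *ᶜ ℤ→ℂ r)
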